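{- Let $d$ and $k$ be positive integers. Let $\mathbf L=(L_1,\dots,L_d)\in\mathbb{Z}^d$ and $\mathbf N^{(j)}=(N^{(j)}_1,\dots,N^{(j)}_d)\in\mathbb{Z}^d$, $j=1,\dots,k$, satisfy $\mathbf 0\le \mathbf L\le \mathbf N^{(1)}$ and $\mathbf N^{(2)}\ge\mathbf 0,\dots,\mathbf N^{(k)}\ge \mathbf 0$. Define the formal power series in $\mathbf z=(z_1,\dots,z_d)$ $$F_{\mathbf N}(\mathbf z)=\sum_{\mathbf m\ge\mathbf 0}\mathbf z^{\mathbf m}\prod_{j=1}^{k}\frac{\big(\sum_{i=1}^d N^{(j)}_im_i\big)!}{\prod_{i=1}^{d}m_i!^{N_i^{(j)}}},\qquad G_{\mathbf L,\mathbf N}(\mathbf z)=\sum_{\mathbf m\ge\mathbf 0}\mathbf z^{\mathbf m}H_{\sum_{i=1}^d L_im_i}\prod_{j=1}^{k}\frac{\big(\sum_{i=1}^d N^{(j)}_im_i\big)!}{\prod_{i=1}^{d}m_i!^{N_i^{(j)}}}.$$ Then $$q_{\mathbf L,\mathbf N}(\mathbf z):=\exp\big(G_{\mathbf L,\mathbf N}(\mathbf z)/F_{\mathbf N}(\mathbf z)\big)\in\mathbb{Z}[[\mathbf z]].$$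
   Context: $H_m=\sum_{j=1}^m 1/j$ is the $m$-th harmonic number, with $H_0=0$. For $\mathbf m\in\mathbb{Z}_{\ge0}^d$, $\mathbf z^{\mathbf m}=z_1^{m_1}\cdots z_d^{m_d}$. Vector inequalities are componentwise, $\mathbf 0=(0,\dots,0)$. $\mathbb{Z}[[\mathbf z]]$ is the ring of formal power series in $z_1,\dots,z_d$ with integer coefficients; $F_{\mathbf N}(\mathbf z)$ has constant term $1$ and $G_{\mathbf L,\mathbf N}$ has zero constant term, so the exponential of their quotient is a well-defined formal power series with rational coefficients. -}

module Defs where

open import Data.Nat as ℕ using (ℕ; zero; suc; _!; _∸_)
open import Data.Nat.Properties using (_!≢0)
open import Data.Integer using (ℤ; +_)
open import Data.Rational as ℚ using (ℚ; 0ℚ; 1ℚ)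
open import Data.Fin using (Fin)
open import Data.Vec using (Vec; []; _∷_)
open import Data.List as List using (List; []; _∷_)
open import Data.Product using (Σ; _×_; _,_)
open import Relation.Binary.PropositionalEquality using (_≡_)

MultiIndex : ℕ → Set
MultiIndex d = Vec ℕ d

-- Formal power series in d variables with rational coefficients,
-- given by their coefficient function  m ↦ [z^m] f.
PowerSeries : ℕ → Set
PowerSeries d = MultiIndex d → ℚ

sumℚ : List ℚ → ℚ
sumℚ = List.foldr ℚ._+_ 0ℚ

sumTo : ℕ → (ℕ → ℚ) → ℚ
sumTo N f = sumℚ (List.map f (List.upTo (suc N)))

prodℚ : List ℚ → ℚ
prodℚ = List.foldr ℚ._*_ 1ℚ

splits : ∀ {d} → MultiIndex d → List (MultiIndex d × MultiIndex d)
splits [] = ([] , []) ∷ []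
splits (x ∷ m) =
  List.concatMap (λ i → List.map (λ { (a , b) → (i ∷ a , (x ∸ i) ∷ b) }) (splits m))
                 (List.upTo (suc x))

∣_∣ₘ : ∀ {d} → MultiIndex d → ℕ
∣ [] ∣ₘ = 0
∣ x ∷ m ∣ₘ = x ℕ.+ ∣ m ∣ₘ


oneₚ : ∀ {d} → PowerSeries d
oneₚ m with ∣ m ∣ₘ
... | zero = 1ℚ
... | suc _ = 0ℚ

_-ₚ_ : ∀ {d} → PowerSeries d → PowerSeries d → PowerSeries d
(f -ₚ g) m = f m ℚ.- g m

_*ₚ_ : ∀ {d} → PowerSeries d → PowerSeries d → PowerSeries d
(f *ₚ g) m = sumℚ (List.map (λ { (a , b) → f a ℚ.* g b }) (splits m))

_^ₚ_ : ∀ {d} → PowerSeries d → ℕ → PowerSeries d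
f ^ₚ zero = oneₚ
f ^ₚ suc n = f *ₚ (f ^ₚ n)

invFact : ℕ → ℚ
invFact n = (+ 1 ℚ./ (n !)) {{n !≢0}}

-- Inverse of a series f with constant term 1:  1/f = Σ_{n≥0} (1 - f)^n.
-- Since 1 - f has zero constant term, only n ≤ |m| contribute to [z^m].
invₚ : ∀ {d} → PowerSeries d → PowerSeries d
invₚ f m = sumTo ∣ m ∣ₘ (λ n → ((oneₚ -ₚ f) ^ₚ n) m)

-- Exponential of a series h with zero constant term:  exp h = Σ_{n≥0} h^n / n!.
-- Only n ≤ |m| contribute to [z^m].
expₚ : ∀ {d} → PowerSeries d → PowerSeries d
expₚ h m = sumTo ∣ m ∣ₘ (λ n → (h ^ₚ n) m ℚ.* invFact n)

harmonic : ℕ → ℚ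
harmonic zero = 0ℚ
harmonic (suc n) = harmonic n ℚ.+ (+ 1 ℚ./ suc n)

dot : ∀ {d} → Vec ℕ d → MultiIndex d → ℕ
dot [] [] = 0
dot (v ∷ vs) (x ∷ m) = v ℕ.* x ℕ.+ dot vs m

powℚ : ℚ → ℕ → ℚ
powℚ q zero = 1ℚ
powℚ q (suc n) = q ℚ.* powℚ q n

invFactPow : ∀ {d} → Vec ℕ d → MultiIndex d → ℚ
invFactPow [] [] = 1ℚ
invFactPow (v ∷ vs) (x ∷ m) = powℚ (invFact x) v ℚ.* invFactPow vs m

factRatio : ∀ {d} → Vec ℕ d → MultiIndex d → ℚ
factRatio v m = (+ (dot v m !) ℚ./ 1) ℚ.* invFactPow v m

coeffA : ∀ {d k} → (Fin k → Vec ℕ d) → MultiIndex d → ℚ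
coeffA {k = k} N m = prodℚ (List.map (λ j → factRatio (N j) m) (List.allFin k))

F : ∀ {d k} → (Fin k → Vec ℕ d) → PowerSeries d
F N m = coeffA N m

G : ∀ {d k} → Vec ℕ d → (Fin k → Vec ℕ d) → PowerSeries d
G L N m = harmonic (dot L m) ℚ.* coeffA N m

q : ∀ {d k} → Vec ℕ d → (Fin k → Vec ℕ d) → PowerSeries d
q L N = expₚ (G L N *ₚ invₚ (F N))

IntegralSeries : ∀ {d} → PowerSeries d → Set
IntegralSeries {d} f = (m : MultiIndex d) → Σ ℤ (λ c → f m ≡ (c ℚ./ 1))

{-# OPTIONS --safe #-}
module Submission where

-- It suffices to prove p-integrality for every prime p. Write F = Σ B(m) z^m and
-- G = Σ H(m) B(m) z^m with H(m) = H_{L·m}, and let ψ be the substitution z ↦ z^p.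
-- By the Dieudonné–Dwork lemma exp(G/F) is p-integral as soon as
-- F ψ(G) ≡ p G ψ(F) modulo p.
--
-- For digits a (all components < p) one has B(a + pk) = B(k) Y_a(k), where Y_a is
-- p-integral and Y_a(k + p^s n) ≡ Y_a(k) modulo p^(s+1), and B(a + pk) (H(a + pk) - H(k)/p)
-- is p-integral; the latter uses L ≤ N^(1). The congruence then reduces to the claim that
--   S_{φ,χ}(K) = Σ_{k+l=K} B(k) B(l) φ(k) χ(l) (H(l) - H(k))
-- is p-integral whenever φ, χ satisfy φ(m + p^s n) ≡ φ(m) modulo p^s. This is an induction
-- on K: grouping k = a + pk′, l = b + pl′ by residues, S_{φ,χ}(K) is, up to p-integral terms,
-- a sum of S_{Φ,X}(K′)/p with Φ = c + pφ₁, X = e + pχ₁ and φ₁, χ₁ of the same kind as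
-- φ, χ; the contribution of the constants c e vanishes because the summand is antisymmetric.

open import Defs
open import Algebra.Bundles using (CommutativeRing; CommutativeSemiring)
open import Algebra.Structures using (IsCommutativeRing)
import Algebra.Properties.CommutativeSemiring.Binomial as Binomial
import Algebra.Properties.Semiring.Exp as Exp
import Algebra.Properties.Semiring.Mult as Mult
import Algebra.Properties.Semiring.Sum as Sum
import Algebra.Solver.Ring.NaturalCoefficients.Default as SemiringSolver
open import Data.Empty using (⊥-elim)
open import Data.Fin as Fin using (Fin; toℕ; fromℕ; fromℕ<; inject₁)
import Data.Fin.Properties as FinP
open import Data.Integer as ℤ using (ℤ)
import Data.Integer.Properties as ℤP
open import Data.List as List using (List; []; _∷_; _++_; applyUpTo; concatMap; upTo)
import Data.List.Properties as ListP
import Data.List.Relation.Unary.All as ListAll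
open import Data.Nat as ℕ using (ℕ; zero; suc; s≤s; z≤n; NonZero; _≤_; _<_; _∸_; _!)
open import Data.Nat.Combinatorics using (_C_; nCn≡1; nCk≡n!/k![n-k]!; k![n∸k]!∣n!)
open import Data.Nat.Coprimality as Coprime using (Coprime)
open import Data.Nat.Divisibility as ℕD using (_∣_; _∤_; divides; _∣?_)
open import Data.Nat.DivMod using (_%_; m≡m%n+[m/n]*n; m%n<n; /-mono-≤; m*n/n≡m; m/n*n≡m; m<n⇒m/n≡0; +-distrib-/-∣ʳ)
open import Data.Nat.Primality using (Prime; euclidsLemma; prime⇒nonZero; prime⇒nonTrivial; ¬prime[1])
open import Data.Nat.Primality.Factorisation using (factorise)
import Data.Nat.Properties as ℕP
import Data.Nat.Tactic.RingSolver as ℕSolver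
open import Data.Product using (Σ; ∃; _×_; _,_; proj₁; proj₂)
open import Data.Rational as ℚ using (ℚ; mkℚ; 0ℚ; 1ℚ; _+_; _*_; _-_; -_; _/_; toℚᵘ)
open import Data.Rational.Properties
  using (+-*-commutativeRing; +-comm; +-assoc; +-identityˡ; +-identityʳ; +-inverseˡ; +-inverseʳ
        ; *-comm; *-assoc; *-identityˡ; *-identityʳ; *-zeroˡ; *-zeroʳ; *-distribˡ-+; *-distribʳ-+
        ; neg-distribˡ-*; _≟_; toℚᵘ-injective; toℚᵘ-fromℚᵘ; toℚᵘ-homo-+; toℚᵘ-homo-*; toℚᵘ-homo‿-)
import Data.Rational.Unnormalised as ℚᵘ
import Data.Rational.Unnormalised.Properties as ℚᵘP
open import Data.Sum using (_⊎_; inj₁; inj₂; [_,_]′)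
open import Data.Vec as Vec using (Vec; []; _∷_; zipWith; replicate)
open import Data.Vec.Relation.Binary.Pointwise.Inductive using (Pointwise; []; _∷_)
open import Data.Vec.Relation.Unary.All using (All; []; _∷_)
open import Function using (_∘_; id; flip)
open import Level using (0ℓ)
open import Relation.Binary.PropositionalEquality
import Relation.Binary.Reasoning.Setoid as SetoidReasoning
open import Relation.Nullary using (yes; no)
open import Relation.Nullary.Decidable using (dec⇒maybe)
open import Tactic.RingSolver using (solve-∀)
open import Tactic.RingSolver.Core.AlmostCommutativeRing using (AlmostCommutativeRing; fromCommutativeRing)

-- Splitting off digits is not neutral: the factors Y_a accumulate as weights, and every digit costs
-- a division by p. A statement about B and H alone is therefore not stable, and S carries the
-- weights φ, χ. The division is paid by precision: on a residue class, φ(a + p k) varies by p^(s+1)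
-- when k moves by p^s, so its nonconstant part already contains the missing factor p.
--
-- The congruence for Y_a would usually call for Wilson's theorem, with its exception at p = 2. Here
-- the product over a period is left unevaluated: it occurs to the same power N·n in the numerator
-- and in the denominator of B, because m_i! is taken to the power N_i.
--
-- The hypothesis L ≤ N^(1) concerns the terms 1/j of H(a + p k) with j > p L·k. Such a j may be
-- divisible by p, and the first factor of B must then contain a compensating power of p.
--
-- Everything takes place inside ℚ, where p-integral means having a denominator prime to p.

private variable
  d : ℕ

-- Integers and reciprocals inside the rationals.

ℚ-ring : AlmostCommutativeRing _ _
ℚ-ring = fromCommutativeRing +-*-commutativeRing (λ x → dec⇒maybe (0ℚ ≟ x))

opaque
  -- Opaque, so that the gcd normalisation in `_/_` does not unfold; the arithmetic laws pass
  -- through unnormalised fractions.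
  ι : ℤ → ℚ
  ι c = c / 1

  ι-def : ∀ c → ι c ≡ c / 1
  ι-def c = refl

  ι-0 : ι (ℤ.+ 0) ≡ 0ℚ
  ι-0 = refl

  ι-1 : ι (ℤ.+ 1) ≡ 1ℚ
  ι-1 = refl

  toℚᵘ-ι : ∀ c → toℚᵘ (ι c) ℚᵘ.≃ ℚᵘ.mkℚᵘ c 0
  toℚᵘ-ι c = toℚᵘ-fromℚᵘ (ℚᵘ.mkℚᵘ c 0)

  ι-+ : ∀ a b → ι (a ℤ.+ b) ≡ ι a + ι b
  ι-+ a b = toℚᵘ-injective (begin
    toℚᵘ (ι (a ℤ.+ b))                   ≈⟨ toℚᵘ-ι (a ℤ.+ b) ⟩
    ℚᵘ.mkℚᵘ (a ℤ.+ b) 0                  ≡⟨ cong (λ c → ℚᵘ.mkℚᵘ c 0) (cong₂ ℤ._+_ (sym (ℤP.*-identityʳ a)) (sym (ℤP.*-identityʳ b))) ⟩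
    ℚᵘ.mkℚᵘ a 0 ℚᵘ.+ ℚᵘ.mkℚᵘ b 0         ≈⟨ ℚᵘP.+-cong (toℚᵘ-ι a) (toℚᵘ-ι b) ⟨
    toℚᵘ (ι a) ℚᵘ.+ toℚᵘ (ι b)           ≈⟨ toℚᵘ-homo-+ (ι a) (ι b) ⟨
    toℚᵘ (ι a + ι b)                     ∎)
    where open ℚᵘP.≃-Reasoning

  ι-* : ∀ a b → ι (a ℤ.* b) ≡ ι a * ι b
  ι-* a b = toℚᵘ-injective (begin
    toℚᵘ (ι (a ℤ.* b))                   ≈⟨ toℚᵘ-ι (a ℤ.* b) ⟩
    ℚᵘ.mkℚᵘ a 0 ℚᵘ.* ℚᵘ.mkℚᵘ b 0         ≈⟨ ℚᵘP.*-cong (toℚᵘ-ι a) (toℚᵘ-ι b) ⟨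
    toℚᵘ (ι a) ℚᵘ.* toℚᵘ (ι b)           ≈⟨ toℚᵘ-homo-* (ι a) (ι b) ⟨
    toℚᵘ (ι a * ι b)                     ∎)
    where open ℚᵘP.≃-Reasoning

  ι-neg : ∀ a → ι (ℤ.- a) ≡ - ι a
  ι-neg a = toℚᵘ-injective (begin
    toℚᵘ (ι (ℤ.- a))      ≈⟨ toℚᵘ-ι (ℤ.- a) ⟩
    ℚᵘ.- ℚᵘ.mkℚᵘ a 0      ≈⟨ ℚᵘP.-‿cong (toℚᵘ-ι a) ⟨
    ℚᵘ.- toℚᵘ (ι a)       ≈⟨ toℚᵘ-homo‿- (ι a) ⟨
    toℚᵘ (- ι a)          ∎)
    where open ℚᵘP.≃-Reasoning

  ι-injective : ∀ {a b} → ι a ≡ ι b → a ≡ b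
  ι-injective {a} {b} eq with ℚᵘP.≃-trans (ℚᵘP.≃-sym (toℚᵘ-ι a)) (ℚᵘP.≃-trans (ℚᵘP.≃-reflexive (cong toℚᵘ eq)) (toℚᵘ-ι b))
  ... | ℚᵘ.*≡* e = trans (sym (ℤP.*-identityʳ a)) (trans e (ℤP.*-identityʳ b))

  ↥-↧ : ∀ x → x * ι (ℚ.↧ x) ≡ ι (ℚ.↥ x)
  ↥-↧ x@(mkℚ n d-1 _) = toℚᵘ-injective (begin
    toℚᵘ (x * ι (ℤ.+ suc d-1))                       ≈⟨ toℚᵘ-homo-* x (ι (ℤ.+ suc d-1)) ⟩
    ℚᵘ.mkℚᵘ n d-1 ℚᵘ.* toℚᵘ (ι (ℤ.+ suc d-1))        ≈⟨ ℚᵘP.*-cong (ℚᵘP.≃-refl {ℚᵘ.mkℚᵘ n d-1}) (toℚᵘ-ι (ℤ.+ suc d-1)) ⟩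
    ℚᵘ.mkℚᵘ n d-1 ℚᵘ.* ℚᵘ.mkℚᵘ (ℤ.+ suc d-1) 0       ≈⟨ ℚᵘ.*≡* (trans (ℤP.*-identityʳ (n ℤ.* ℤ.+ suc d-1)) (cong (λ t → n ℤ.* ℤ.+ t) (sym (ℕP.*-identityʳ (suc d-1))))) ⟩
    ℚᵘ.mkℚᵘ n 0                                      ≈⟨ toℚᵘ-ι n ⟨
    toℚᵘ (ι n)                                       ∎)
    where open ℚᵘP.≃-Reasoning

⟦_⟧ : ℕ → ℚ
⟦ n ⟧ = ι (ℤ.+ n)

⟦⟧-+ : ∀ m n → ⟦ m ℕ.+ n ⟧ ≡ ⟦ m ⟧ + ⟦ n ⟧
⟦⟧-+ m n = ι-+ (ℤ.+ m) (ℤ.+ n)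

⟦⟧-* : ∀ m n → ⟦ m ℕ.* n ⟧ ≡ ⟦ m ⟧ * ⟦ n ⟧
⟦⟧-* m n = trans (cong ι (ℤP.pos-* m n)) (ι-* (ℤ.+ m) (ℤ.+ n))

opaque
  unfolding ι

  inv : ℕ → ℚ
  -- A default value that makes `inv` total, so that its argument can be rewritten without carrying
  -- a proof that it is nonzero.
  inv zero = 0ℚ
  inv n@(suc _) = ℤ.+ 1 / n

  inv-def : ∀ n .{{_ : NonZero n}} → inv n ≡ ℤ.+ 1 / n
  inv-def (suc n) = refl

  inv-* : ∀ n .{{_ : NonZero n}} → ⟦ n ⟧ * inv n ≡ 1ℚ
  inv-* n@(suc n-1) = toℚᵘ-injective (begin
    toℚᵘ (⟦ n ⟧ * inv n)              ≈⟨ toℚᵘ-homo-* ⟦ n ⟧ (inv n) ⟩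
    toℚᵘ ⟦ n ⟧ ℚᵘ.* toℚᵘ (inv n)      ≈⟨ ℚᵘP.*-cong (toℚᵘ-ι (ℤ.+ n)) (toℚᵘ-fromℚᵘ (ℚᵘ.mkℚᵘ (ℤ.+ 1) n-1)) ⟩
    ℚᵘ.mkℚᵘ (ℤ.+ n) 0 ℚᵘ.* ℚᵘ.mkℚᵘ (ℤ.+ 1) n-1  ≈⟨ ℚᵘ.*≡* (cong ℤ.+_ (trans (ℕP.*-identityʳ (n ℕ.* 1)) (trans (ℕP.*-comm n 1) (sym (cong (1 ℕ.*_) (ℕP.*-identityˡ n)))))) ⟩
    toℚᵘ 1ℚ                           ∎)
    where open ℚᵘP.≃-Reasoning

-- The local ring at p: integrality, divisibility and congruence of rationals.

module Local (p : ℕ) (isPrime : Prime p) where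

  instance
    p≢0 : NonZero p
    p≢0 = prime⇒nonZero isPrime

  p>1 : 1 ℕ.< p
  p>1 = ℕ.nonTrivial⇒n>1 p {{prime⇒nonTrivial isPrime}}

  -- Drives the inductions that divide an index by p. They run on a bound n and not on the index
  -- itself, since division by p leaves 0 unchanged.
  p*x≤1+n⇒x≤n : ∀ x {n} → p ℕ.* x ℕ.≤ suc n → x ℕ.≤ n
  p*x≤1+n⇒x≤n zero    _  = z≤n
  p*x≤1+n⇒x≤n (suc x) le = ℕP.≤-pred (ℕP.≤-trans (subst (suc x ℕ.<_) (ℕP.*-comm (suc x) p) (ℕP.m<m*n (suc x) p p>1)) le)

  ∤-* : ∀ {a b} → p ∤ a → p ∤ b → p ∤ a ℕ.* b
  ∤-* {a} {b} p∤a p∤b p∣ab with euclidsLemma a b isPrime p∣ab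
  ... | inj₁ p∣a = p∤a p∣a
  ... | inj₂ p∣b = p∤b p∣b

  ∤-1 : p ∤ 1
  ∤-1 p∣1 = ℕP.<⇒≱ p>1 (ℕD.∣⇒≤ p∣1)

  ∤⇒≢0 : ∀ {n} → p ∤ n → NonZero n
  ∤⇒≢0 {zero} p∤0 = ⊥-elim (p∤0 (p ℕD.∣0))
  ∤⇒≢0 {suc n} _ = _

  -- Membership in the localisation of ℤ at p. The fraction `num / den` need not be reduced, so
  -- closure under the ring operations involves no gcd.
  record Int (x : ℚ) : Set where
    constructor mkInt
    field
      den  : ℕ
      num  : ℤ
      p∤den : p ∤ den
      eq   : x * ⟦ den ⟧ ≡ ι num

  Int-ι : ∀ c → Int (ι c)
  Int-ι c = mkInt 1 c ∤-1 (trans (cong (ι c *_) ι-1) (*-identityʳ (ι c)))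

  Int-⟦⟧ : ∀ n → Int ⟦ n ⟧
  Int-⟦⟧ n = Int-ι (ℤ.+ n)

  Int-0 : Int 0ℚ
  Int-0 = subst Int ι-0 (Int-⟦⟧ 0)

  Int-1 : Int 1ℚ
  Int-1 = subst Int ι-1 (Int-⟦⟧ 1)

  Int-+ : ∀ {x y} → Int x → Int y → Int (x + y)
  Int-+ {x} {y} (mkInt b c p∤b e) (mkInt b′ c′ p∤b′ e′) =
    mkInt (b ℕ.* b′) (c ℤ.* ℤ.+ b′ ℤ.+ c′ ℤ.* ℤ.+ b) (∤-* p∤b p∤b′) (begin
      (x + y) * ⟦ b ℕ.* b′ ⟧                ≡⟨ cong ((x + y) *_) (⟦⟧-* b b′) ⟩
      (x + y) * (⟦ b ⟧ * ⟦ b′ ⟧)            ≡⟨ lem x y ⟦ b ⟧ ⟦ b′ ⟧ ⟩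
      x * ⟦ b ⟧ * ⟦ b′ ⟧ + y * ⟦ b′ ⟧ * ⟦ b ⟧ ≡⟨ cong₂ (λ s t → s * ⟦ b′ ⟧ + t * ⟦ b ⟧) e e′ ⟩
      ι c * ⟦ b′ ⟧ + ι c′ * ⟦ b ⟧           ≡⟨ cong₂ _+_ (ι-* c (ℤ.+ b′)) (ι-* c′ (ℤ.+ b)) ⟨
      ι (c ℤ.* ℤ.+ b′) + ι (c′ ℤ.* ℤ.+ b)       ≡⟨ ι-+ (c ℤ.* ℤ.+ b′) (c′ ℤ.* ℤ.+ b) ⟨
      ι (c ℤ.* ℤ.+ b′ ℤ.+ c′ ℤ.* ℤ.+ b)         ∎)
    where
    open ≡-Reasoning
    lem : ∀ x y s t → (x + y) * (s * t) ≡ x * s * t + y * t * s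
    lem = solve-∀ ℚ-ring

  Int-* : ∀ {x y} → Int x → Int y → Int (x * y)
  Int-* {x} {y} (mkInt b c p∤b e) (mkInt b′ c′ p∤b′ e′) =
    mkInt (b ℕ.* b′) (c ℤ.* c′) (∤-* p∤b p∤b′) (begin
      x * y * ⟦ b ℕ.* b′ ⟧             ≡⟨ cong (x * y *_) (⟦⟧-* b b′) ⟩
      x * y * (⟦ b ⟧ * ⟦ b′ ⟧)         ≡⟨ lem x y ⟦ b ⟧ ⟦ b′ ⟧ ⟩
      (x * ⟦ b ⟧) * (y * ⟦ b′ ⟧)       ≡⟨ cong₂ _*_ e e′ ⟩
      ι c * ι c′                       ≡⟨ ι-* c c′ ⟨
      ι (c ℤ.* c′)                     ∎)
    where
    open ≡-Reasoning
    lem : ∀ x y s t → x * y * (s * t) ≡ (x * s) * (y * t)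
    lem = solve-∀ ℚ-ring

  Int-neg : ∀ {x} → Int x → Int (- x)
  Int-neg {x} (mkInt b c p∤b e) = mkInt b (ℤ.- c) p∤b
    (trans (sym (neg-distribˡ-* x ⟦ b ⟧)) (trans (cong -_ e) (sym (ι-neg c))))

  Int-sub : ∀ {x y} → Int x → Int y → Int (x - y)
  Int-sub ix iy = Int-+ ix (Int-neg iy)

  Int-inv : ∀ {n} → p ∤ n → Int (inv n)
  Int-inv {n} p∤n = mkInt n (ℤ.+ 1) p∤n (trans (*-comm (inv n) ⟦ n ⟧) (trans (inv-* n {{∤⇒≢0 p∤n}}) (sym ι-1)))

  record Div (s : ℕ) (x : ℚ) : Set where
    constructor mkDiv
    field
      quot   : ℚ
      intq   : Int quot
      factor : x ≡ ⟦ p ℕ.^ s ⟧ * quot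

  Div⇒Int : ∀ {s x} → Div s x → Int x
  Div⇒Int {s} (mkDiv y iy refl) = Int-* (Int-⟦⟧ (p ℕ.^ s)) iy

  Div-zero : ∀ {s} → Div s 0ℚ
  Div-zero {s} = mkDiv 0ℚ Int-0 (sym (*-zeroʳ ⟦ p ℕ.^ s ⟧))

  Div-+ : ∀ {s x y} → Div s x → Div s y → Div s (x + y)
  Div-+ {s} (mkDiv x′ ix refl) (mkDiv y′ iy refl) =
    mkDiv (x′ + y′) (Int-+ ix iy) (sym (*-distribˡ-+ ⟦ p ℕ.^ s ⟧ x′ y′))

  Div-*ʳ : ∀ {s x y} → Div s x → Int y → Div s (x * y)
  Div-*ʳ {s} {y = y} (mkDiv x′ ix refl) iy =
    mkDiv (x′ * y) (Int-* ix iy) (*-assoc ⟦ p ℕ.^ s ⟧ x′ y)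

  Div-*ˡ : ∀ {s x y} → Int x → Div s y → Div s (x * y)
  Div-*ˡ {s} {x} {y} ix dy = subst (Div s) (*-comm y x) (Div-*ʳ dy ix)

  Div-neg : ∀ {s x} → Div s x → Div s (- x)
  Div-neg {s} {x} d = subst (Div s) (lem x) (Div-*ˡ (Int-neg Int-1) d)
    where
    lem : ∀ x → - 1ℚ * x ≡ - x
    lem = solve-∀ ℚ-ring

  Div-sub : ∀ {s x y} → Div s x → Div s y → Div s (x - y)
  Div-sub dx dy = Div-+ dx (Div-neg dy)

  p*inv-p : ⟦ p ⟧ * inv p ≡ 1ℚ
  p*inv-p = inv-* p

  Div-pred : ∀ {s x} → Div (suc s) x → Div s (inv p * x)
  Div-pred {s} (mkDiv y iy refl) = mkDiv y iy (begin
    inv p * (⟦ p ℕ.* p ℕ.^ s ⟧ * y)         ≡⟨ cong (λ t → inv p * (t * y)) (⟦⟧-* p (p ℕ.^ s)) ⟩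
    inv p * (⟦ p ⟧ * ⟦ p ℕ.^ s ⟧ * y)       ≡⟨ lem (inv p) ⟦ p ⟧ ⟦ p ℕ.^ s ⟧ y ⟩
    (⟦ p ⟧ * inv p) * (⟦ p ℕ.^ s ⟧ * y)     ≡⟨ cong (_* (⟦ p ℕ.^ s ⟧ * y)) p*inv-p ⟩
    1ℚ * (⟦ p ℕ.^ s ⟧ * y)                  ≡⟨ *-identityˡ _ ⟩
    ⟦ p ℕ.^ s ⟧ * y                         ∎)
    where
    open ≡-Reasoning
    lem : ∀ i p q y → i * (p * q * y) ≡ (p * i) * (q * y)
    lem = solve-∀ ℚ-ring

  Div-p* : ∀ {x} → Int x → Div 1 (⟦ p ⟧ * x)
  Div-p* {x} ix = mkDiv x ix (cong (λ n → ⟦ n ⟧ * x) (sym (ℕP.*-identityʳ p)))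

  Div₁⇒Int : ∀ {x} → Div 1 x → Int (inv p * x)
  Div₁⇒Int d = Div⇒Int (Div-pred d)

  infix 4 _≈[_]_
  record _≈[_]_ (x : ℚ) (s : ℕ) (y : ℚ) : Set where
    constructor mk≈
    field ≈⇒Div : Div s (x - y)
  open _≈[_]_ public

  ≈-reflexive : ∀ {s x y} → x ≡ y → x ≈[ s ] y
  ≈-reflexive {s} {x} refl = mk≈ (subst (Div s) (sym (+-inverseʳ x)) Div-zero)

  ≈-refl : ∀ {s x} → x ≈[ s ] x
  ≈-refl = ≈-reflexive refl

  ≈-sym : ∀ {s x y} → x ≈[ s ] y → y ≈[ s ] x
  ≈-sym {s} {x} {y} (mk≈ d) = mk≈ (subst (Div s) (lem x y) (Div-neg d))
    where
    lem : ∀ x y → - (x - y) ≡ y - x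
    lem = solve-∀ ℚ-ring

  ≈-trans : ∀ {s x y z} → x ≈[ s ] y → y ≈[ s ] z → x ≈[ s ] z
  ≈-trans {s} {x} {y} {z} (mk≈ d) (mk≈ e) = mk≈ (subst (Div s) (lem x y z) (Div-+ d e))
    where
    lem : ∀ x y z → (x - y) + (y - z) ≡ x - z
    lem = solve-∀ ℚ-ring

  ≈-+ : ∀ {s x x′ y y′} → x ≈[ s ] x′ → y ≈[ s ] y′ → x + y ≈[ s ] x′ + y′
  ≈-+ {s} {x} {x′} {y} {y′} (mk≈ d) (mk≈ e) = mk≈ (subst (Div s) (lem x x′ y y′) (Div-+ d e))
    where
    lem : ∀ x x′ y y′ → (x - x′) + (y - y′) ≡ (x + y) - (x′ + y′)
    lem = solve-∀ ℚ-ring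

  ≈-* : ∀ {s x x′ y y′} → Int y → Int x′ → x ≈[ s ] x′ → y ≈[ s ] y′ → x * y ≈[ s ] x′ * y′
  ≈-* {s} {x} {x′} {y} {y′} iy ix′ (mk≈ d) (mk≈ e) =
    mk≈ (subst (Div s) (lem x x′ y y′) (Div-+ (Div-*ʳ d iy) (Div-*ˡ ix′ e)))
    where
    lem : ∀ x x′ y y′ → (x - x′) * y + x′ * (y - y′) ≡ x * y - x′ * y′
    lem = solve-∀ ℚ-ring

-- Convolution sums over multi-indices.

infixl 6 _⊕_
_⊕_ : ∀ {d} → MultiIndex d → MultiIndex d → MultiIndex d
_⊕_ = zipWith ℕ._+_

𝟎 : ∀ {d} → MultiIndex d
𝟎 = replicate _ 0

∣⊕∣ : ∀ {d} (a b : MultiIndex d) → ∣ a ⊕ b ∣ₘ ≡ ∣ a ∣ₘ ℕ.+ ∣ b ∣ₘ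
∣⊕∣ [] [] = refl
∣⊕∣ (x ∷ a) (y ∷ b) = trans (cong (x ℕ.+ y ℕ.+_) (∣⊕∣ a b)) (lem x y ∣ a ∣ₘ ∣ b ∣ₘ)
  where
  lem : ∀ x y a b → x ℕ.+ y ℕ.+ (a ℕ.+ b) ≡ x ℕ.+ a ℕ.+ (y ℕ.+ b)
  lem = ℕSolver.solve-∀

interchange : ∀ a b c e → (a + b) + (c + e) ≡ (a + c) + (b + e)
interchange = solve-∀ ℚ-ring

-- The sum of `f i j` over i + j = x. Recursion on x produces both indices directly, which keeps
-- truncated subtraction out of the laws below.
σ : ℕ → (ℕ → ℕ → ℚ) → ℚ
σ zero    f = f 0 0
σ (suc x) f = f 0 (suc x) + σ x (λ i j → f (suc i) j)

σ-cong : ∀ x {f g : ℕ → ℕ → ℚ} → (∀ i j → i ℕ.+ j ≡ x → f i j ≡ g i j) → σ x f ≡ σ x g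
σ-cong zero    f≗g = f≗g 0 0 refl
σ-cong (suc x) f≗g = cong₂ _+_ (f≗g 0 (suc x) refl) (σ-cong x (λ i j e → f≗g (suc i) j (cong suc e)))

σ-+ : ∀ x (f g : ℕ → ℕ → ℚ) → σ x (λ i j → f i j + g i j) ≡ σ x f + σ x g
σ-+ zero    f g = refl
σ-+ (suc x) f g = trans (cong (f 0 (suc x) + g 0 (suc x) +_) (σ-+ x _ _))
                        (interchange (f 0 (suc x)) (g 0 (suc x)) _ _)

σ-*ˡ : ∀ x c (f : ℕ → ℕ → ℚ) → σ x (λ i j → c * f i j) ≡ c * σ x f
σ-*ˡ zero    c f = refl
σ-*ˡ (suc x) c f = trans (cong (c * f 0 (suc x) +_) (σ-*ˡ x c _)) (sym (*-distribˡ-+ c _ _))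

-- One principle for integrality, divisibility and vanishing (`_≡ 0ℚ`). Closure under `_+_` suffices
-- because the sum always has at least one term.
σ-closed : ∀ (P : ℚ → Set) → (∀ {x y} → P x → P y → P (x + y)) →
           ∀ x {f : ℕ → ℕ → ℚ} → (∀ i j → i ℕ.+ j ≡ x → P (f i j)) → P (σ x f)
σ-closed P P+ zero    Pf = Pf 0 0 refl
σ-closed P P+ (suc x) Pf = P+ (Pf 0 (suc x) refl) (σ-closed P P+ x (λ i j e → Pf (suc i) j (cong suc e)))

σ-sucʳ : ∀ x (f : ℕ → ℕ → ℚ) → σ (suc x) f ≡ σ x (λ i j → f i (suc j)) + f (suc x) 0
σ-sucʳ zero    f = refl
σ-sucʳ (suc x) f = trans (cong (f 0 (suc (suc x)) +_) (σ-sucʳ x (λ i → f (suc i))))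
                         (sym (+-assoc (f 0 (suc (suc x))) (σ x (λ i j → f (suc i) (suc j))) (f (suc (suc x)) 0)))

σ-comm : ∀ x (f : ℕ → ℕ → ℚ) → σ x f ≡ σ x (flip f)
σ-comm zero    f = refl
σ-comm (suc x) f = begin
  f 0 (suc x) + σ x (λ i j → f (suc i) j)  ≡⟨ cong (f 0 (suc x) +_) (σ-comm x _) ⟩
  f 0 (suc x) + σ x (λ i j → f (suc j) i)  ≡⟨ +-comm (f 0 (suc x)) _ ⟩
  σ x (λ i j → f (suc j) i) + f 0 (suc x)  ≡⟨ σ-sucʳ x (flip f) ⟨
  σ (suc x) (flip f)                       ∎
  where open ≡-Reasoning

σ-assoc : ∀ x (f : ℕ → ℕ → ℕ → ℚ) →
          σ x (λ i j → σ i (λ k l → f k l j)) ≡ σ x (λ k r → σ r (λ l j → f k l j))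
σ-assoc zero    f = refl
σ-assoc (suc x) f = begin
  f 0 0 (suc x) + σ x (λ i j → f 0 (suc i) j + σ i (λ k l → f (suc k) l j))
    ≡⟨ cong (f 0 0 (suc x) +_) (σ-+ x _ _) ⟩
  f 0 0 (suc x) + (σ x (λ i j → f 0 (suc i) j) + σ x (λ i j → σ i (λ k l → f (suc k) l j)))
    ≡⟨ cong (λ t → f 0 0 (suc x) + (σ x (λ i j → f 0 (suc i) j) + t)) (σ-assoc x (λ k → f (suc k))) ⟩
  f 0 0 (suc x) + (σ x (λ i j → f 0 (suc i) j) + σ x (λ k r → σ r (λ l j → f (suc k) l j)))
    ≡⟨ +-assoc (f 0 0 (suc x)) _ _ ⟨
  f 0 0 (suc x) + σ x (λ i j → f 0 (suc i) j) + σ x (λ k r → σ r (λ l j → f (suc k) l j)) ∎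
  where open ≡-Reasoning

σ-last : ∀ x (f : ℕ → ℕ → ℚ) → (∀ i j → i ℕ.+ suc j ≡ x → f i (suc j) ≡ 0ℚ) → σ x f ≡ f x 0
σ-last zero    f f≗0 = refl
σ-last (suc x) f f≗0 = trans (cong₂ _+_ (f≗0 0 x refl) (σ-last x _ (λ i j e → f≗0 (suc i) j (cong suc e))))
                             (+-identityˡ _)

conv : ∀ {d} → MultiIndex d → (MultiIndex d → MultiIndex d → ℚ) → ℚ
conv []      f = f [] []
conv (x ∷ m) f = σ x (λ i j → conv m (λ a b → f (i ∷ a) (j ∷ b)))

conv-cong : (m : MultiIndex d) {f g : MultiIndex d → MultiIndex d → ℚ} →
            (∀ a b → a ⊕ b ≡ m → f a b ≡ g a b) → conv m f ≡ conv m g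
conv-cong []      f≗g = f≗g [] [] refl
conv-cong (x ∷ m) f≗g = σ-cong x (λ i j e → conv-cong m (λ a b e′ → f≗g (i ∷ a) (j ∷ b) (cong₂ _∷_ e e′)))

conv-cong′ : (m : MultiIndex d) {f g : MultiIndex d → MultiIndex d → ℚ} →
             (∀ a b → f a b ≡ g a b) → conv m f ≡ conv m g
conv-cong′ m f≗g = conv-cong m (λ a b _ → f≗g a b)

conv-+ : (m : MultiIndex d) (f g : MultiIndex d → MultiIndex d → ℚ) →
         conv m (λ a b → f a b + g a b) ≡ conv m f + conv m g
conv-+ []      f g = refl
conv-+ (x ∷ m) f g = trans (σ-cong x (λ i j _ → conv-+ m _ _)) (σ-+ x _ _)

conv-*ˡ : (m : MultiIndex d) (c : ℚ) (f : MultiIndex d → MultiIndex d → ℚ) →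
          conv m (λ a b → c * f a b) ≡ c * conv m f
conv-*ˡ []      c f = refl
conv-*ˡ (x ∷ m) c f = trans (σ-cong x (λ i j _ → conv-*ˡ m c _)) (σ-*ˡ x c _)

conv-closed : ∀ (P : ℚ → Set) → (∀ {x y} → P x → P y → P (x + y)) →
              (m : MultiIndex d) {f : MultiIndex d → MultiIndex d → ℚ} →
              (∀ a b → a ⊕ b ≡ m → P (f a b)) → P (conv m f)
conv-closed P P+ []      Pf = Pf [] [] refl
conv-closed P P+ (x ∷ m) Pf =
  σ-closed P P+ x (λ i j e → conv-closed P P+ m (λ a b e′ → Pf (i ∷ a) (j ∷ b) (cong₂ _∷_ e e′)))

conv-comm : (m : MultiIndex d) (f : MultiIndex d → MultiIndex d → ℚ) → conv m f ≡ conv m (flip f)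
conv-comm []      f = refl
conv-comm (x ∷ m) f = trans (σ-comm x _) (σ-cong x (λ i j _ → conv-comm m _))

conv-zero : (m : MultiIndex d) {f : MultiIndex d → MultiIndex d → ℚ} →
            (∀ a b → a ⊕ b ≡ m → f a b ≡ 0ℚ) → conv m f ≡ 0ℚ
conv-zero m f≗0 = conv-closed (_≡ 0ℚ) (λ { refl refl → refl }) m f≗0

conv-last : (m : MultiIndex d) (f : MultiIndex d → MultiIndex d → ℚ) →
            (∀ a b → a ⊕ b ≡ m → 0 ℕ.< ∣ b ∣ₘ → f a b ≡ 0ℚ) → conv m f ≡ f m 𝟎
conv-last []      f f≗0 = refl
conv-last (x ∷ m) f f≗0 = trans
  (σ-last x _ (λ i j e → conv-zero m (λ a b e′ → f≗0 (i ∷ a) (suc j ∷ b) (cong₂ _∷_ e e′) (s≤s z≤n))))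
  (conv-last m _ (λ a b e pos → f≗0 (x ∷ a) (0 ∷ b) (cong₂ _∷_ (ℕP.+-identityʳ x) e) pos))

conv-σ : (m : MultiIndex d) (x : ℕ) (f : ℕ → ℕ → MultiIndex d → MultiIndex d → ℚ) →
         σ x (λ i j → conv m (f i j)) ≡ conv m (λ a b → σ x (λ i j → f i j a b))
conv-σ m zero    f = refl
conv-σ m (suc x) f = trans (cong (conv m (f 0 (suc x)) +_) (conv-σ m x _)) (sym (conv-+ m _ _))

conv-assoc : (m : MultiIndex d) (f : MultiIndex d → MultiIndex d → MultiIndex d → ℚ) →
             conv m (λ a b → conv a (λ c e → f c e b)) ≡ conv m (λ c r → conv r (λ e b → f c e b))
conv-assoc []      f = refl
conv-assoc (x ∷ m) f = begin
  σ x (λ i j → conv m (λ a b → σ i (λ k l → conv a (λ c e → f (k ∷ c) (l ∷ e) (j ∷ b)))))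
    ≡⟨ σ-cong x (λ i j _ → conv-σ m i _) ⟨
  σ x (λ i j → σ i (λ k l → conv m (λ a b → conv a (λ c e → f (k ∷ c) (l ∷ e) (j ∷ b)))))
    ≡⟨ σ-cong x (λ i j _ → σ-cong i (λ k l _ → conv-assoc m _)) ⟩
  σ x (λ i j → σ i (λ k l → conv m (λ c r → conv r (λ e b → f (k ∷ c) (l ∷ e) (j ∷ b)))))
    ≡⟨ σ-assoc x _ ⟩
  σ x (λ k t → σ t (λ l j → conv m (λ c r → conv r (λ e b → f (k ∷ c) (l ∷ e) (j ∷ b)))))
    ≡⟨ σ-cong x (λ k t _ → conv-σ m t _) ⟩
  σ x (λ k t → conv m (λ c r → σ t (λ l j → conv r (λ e b → f (k ∷ c) (l ∷ e) (j ∷ b))))) ∎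
  where open ≡-Reasoning

-- Comparison with the list sums of the definitions.

sumℚ-++ : ∀ xs ys → sumℚ (xs ++ ys) ≡ sumℚ xs + sumℚ ys
sumℚ-++ []       ys = sym (+-identityˡ _)
sumℚ-++ (x ∷ xs) ys = trans (cong (x +_) (sumℚ-++ xs ys)) (sym (+-assoc x _ _))

module _ {A B : Set} where
  sumℚ-concatMap : (f : B → ℚ) (g : A → List B) (xs : List A) →
    sumℚ (List.map f (concatMap g xs)) ≡ sumℚ (List.map (λ x → sumℚ (List.map f (g x))) xs)
  sumℚ-concatMap f g []       = refl
  sumℚ-concatMap f g (x ∷ xs) = begin
    sumℚ (List.map f (g x ++ concatMap g xs))                       ≡⟨ cong sumℚ (ListP.map-++ f (g x) (concatMap g xs)) ⟩
    sumℚ (List.map f (g x) ++ List.map f (concatMap g xs))          ≡⟨ sumℚ-++ (List.map f (g x)) _ ⟩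
    sumℚ (List.map f (g x)) + sumℚ (List.map f (concatMap g xs))    ≡⟨ cong (sumℚ (List.map f (g x)) +_) (sumℚ-concatMap f g xs) ⟩
    sumℚ (List.map (λ x → sumℚ (List.map f (g x))) (x ∷ xs))        ∎
    where open ≡-Reasoning

sumℚ-cong : {A : Set} {f g : A → ℚ} → (∀ x → f x ≡ g x) → ∀ xs → sumℚ (List.map f xs) ≡ sumℚ (List.map g xs)
sumℚ-cong f≗g xs = cong sumℚ (ListP.map-cong f≗g xs)

sumℚ-upTo : ∀ x (f : ℕ → ℕ → ℚ) → sumℚ (List.map (λ i → f i (x ∸ i)) (upTo (suc x))) ≡ σ x f
sumℚ-upTo x f = trans (cong sumℚ (ListP.map-applyUpTo id (λ i → f i (x ∸ i)) (suc x))) (lem x f)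
  where
  lem : ∀ x f → sumℚ (applyUpTo (λ i → f i (x ∸ i)) (suc x)) ≡ σ x f
  lem zero    f = +-identityʳ (f 0 0)
  lem (suc x) f = cong (f 0 (suc x) +_) (lem x (λ i → f (suc i)))

sumℚ-splits : (m : MultiIndex d) (f : MultiIndex d × MultiIndex d → ℚ) →
              sumℚ (List.map f (splits m)) ≡ conv m (λ a b → f (a , b))
sumℚ-splits []      f = +-identityʳ (f ([] , []))
sumℚ-splits (x ∷ m) f = begin
  sumℚ (List.map f (splits (x ∷ m)))
    -- Trades the anonymous pattern lambda of `splits` for the named function `cons`, so that the
    -- two maps can be fused.
    ≡⟨ cong (sumℚ ∘ List.map f) (ListP.concatMap-cong (λ i → ListP.map-cong (λ { (a , b) → refl }) (splits m)) (upTo (suc x))) ⟩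
  sumℚ (List.map f (concatMap (λ i → List.map (cons i) (splits m)) (upTo (suc x))))
    ≡⟨ sumℚ-concatMap f (λ i → List.map (cons i) (splits m)) (upTo (suc x)) ⟩
  sumℚ (List.map (λ i → sumℚ (List.map f (List.map (cons i) (splits m)))) (upTo (suc x)))
    ≡⟨ sumℚ-cong (λ i → trans (cong sumℚ (sym (ListP.map-∘ {g = f} {f = cons i} (splits m)))) (sumℚ-splits m (f ∘ cons i))) (upTo (suc x)) ⟩
  sumℚ (List.map (λ i → conv m (λ a b → f (i ∷ a , (x ∸ i) ∷ b))) (upTo (suc x)))
    ≡⟨ sumℚ-upTo x (λ i j → conv m (λ a b → f (i ∷ a , j ∷ b))) ⟩
  conv (x ∷ m) (λ a b → f (a , b)) ∎
  where
  open ≡-Reasoning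
  cons : ℕ → MultiIndex _ × MultiIndex _ → MultiIndex _ × MultiIndex _
  cons i (a , b) = i ∷ a , (x ∸ i) ∷ b

-- The commutative ring of formal power series.

*ₚ-conv : (f g : PowerSeries d) (m : MultiIndex d) → (f *ₚ g) m ≡ conv m (λ a b → f a * g b)
*ₚ-conv f g m = sumℚ-splits m _

-- Equality and the operations are kept from unfolding, so that the arguments
-- of the ring laws below can be inferred.
infix 4 _≈ₚ_
record _≈ₚ_ {d} (f g : PowerSeries d) : Set where
  constructor mk≈ₚ
  field at : ∀ m → f m ≡ g m
open _≈ₚ_ public

infixl 6 _⊞_
infixl 7 _⊛_
opaque
  _⊞_ : PowerSeries d → PowerSeries d → PowerSeries d
  (f ⊞ g) m = f m + g m

  ⊟_ : PowerSeries d → PowerSeries d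
  (⊟ f) m = - f m

  0ₚ : PowerSeries d
  0ₚ m = 0ℚ

  _⊛_ : PowerSeries d → PowerSeries d → PowerSeries d
  _⊛_ = _*ₚ_

  ⊞-at : (f g : PowerSeries d) (m : MultiIndex d) → (f ⊞ g) m ≡ f m + g m
  ⊞-at f g m = refl

  0ₚ-at : (m : MultiIndex d) → 0ₚ m ≡ 0ℚ
  0ₚ-at m = refl

  ⊛-def : (f g : PowerSeries d) → f ⊛ g ≡ f *ₚ g
  ⊛-def f g = refl

  ⊛-at : (f g : PowerSeries d) (m : MultiIndex d) → (f ⊛ g) m ≡ conv m (λ a b → f a * g b)
  ⊛-at = *ₚ-conv

∣𝟎∣ : ∀ d → ∣ 𝟎 {d} ∣ₘ ≡ 0
∣𝟎∣ zero = refl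
∣𝟎∣ (suc d) = ∣𝟎∣ d

oneₚ-𝟎 : ∀ d → oneₚ {d} 𝟎 ≡ 1ℚ
oneₚ-𝟎 d with ∣ 𝟎 {d} ∣ₘ in e
... | zero  = refl
... | suc _ with () ← trans (sym e) (∣𝟎∣ d)

oneₚ-+ : (m : MultiIndex d) → 0 ℕ.< ∣ m ∣ₘ → oneₚ m ≡ 0ℚ
oneₚ-+ m pos with ∣ m ∣ₘ
... | suc _ = refl

≈ₚ-refl : {f : PowerSeries d} → f ≈ₚ f
≈ₚ-refl = mk≈ₚ (λ m → refl)

≈ₚ-sym : {f g : PowerSeries d} → f ≈ₚ g → g ≈ₚ f
≈ₚ-sym e = mk≈ₚ (λ m → sym (at e m))

≈ₚ-trans : {f g h : PowerSeries d} → f ≈ₚ g → g ≈ₚ h → f ≈ₚ h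
≈ₚ-trans e e′ = mk≈ₚ (λ m → trans (at e m) (at e′ m))

opaque
  unfolding _⊞_

  ⊛-comm : (f g : PowerSeries d) → f ⊛ g ≈ₚ g ⊛ f
  ⊛-comm f g = mk≈ₚ (λ m → begin
    (f ⊛ g) m                     ≡⟨ ⊛-at f g m ⟩
    conv m (λ a b → f a * g b)    ≡⟨ conv-comm m _ ⟩
    conv m (λ a b → f b * g a)    ≡⟨ conv-cong′ m (λ a b → *-comm (f b) (g a)) ⟩
    conv m (λ a b → g a * f b)    ≡⟨ ⊛-at g f m ⟨
    (g ⊛ f) m                     ∎)
    where open ≡-Reasoning

  ⊛-assoc : (f g h : PowerSeries d) → (f ⊛ g) ⊛ h ≈ₚ f ⊛ (g ⊛ h)
  ⊛-assoc f g h = mk≈ₚ (λ m → begin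
    ((f ⊛ g) ⊛ h) m
      ≡⟨ ⊛-at (f ⊛ g) h m ⟩
    conv m (λ a b → (f ⊛ g) a * h b)
      ≡⟨ conv-cong′ m (λ a b → trans (cong (_* h b) (⊛-at f g a)) (*-comm (conv a (λ c e → f c * g e)) (h b))) ⟩
    conv m (λ a b → h b * conv a (λ c e → f c * g e))
      ≡⟨ conv-cong′ m (λ a b → conv-*ˡ a (h b) _) ⟨
    conv m (λ a b → conv a (λ c e → h b * (f c * g e)))
      ≡⟨ conv-assoc m (λ c e b → h b * (f c * g e)) ⟩
    conv m (λ c r → conv r (λ e b → h b * (f c * g e)))
      ≡⟨ conv-cong′ m (λ c r → conv-cong′ r (λ e b → trans (*-comm (h b) _) (*-assoc (f c) (g e) (h b)))) ⟩
    conv m (λ c r → conv r (λ e b → f c * (g e * h b)))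
      ≡⟨ conv-cong′ m (λ c r → trans (conv-*ˡ r (f c) _) (cong (f c *_) (sym (⊛-at g h r)))) ⟩
    conv m (λ c r → f c * (g ⊛ h) r)
      ≡⟨ ⊛-at f (g ⊛ h) m ⟨
    (f ⊛ (g ⊛ h)) m ∎)
    where open ≡-Reasoning

  ⊛-cong : {f f′ g g′ : PowerSeries d} → f ≈ₚ f′ → g ≈ₚ g′ → f ⊛ g ≈ₚ f′ ⊛ g′
  ⊛-cong {f = f} {f′} {g} {g′} e e′ = mk≈ₚ (λ m → begin
    (f ⊛ g) m                      ≡⟨ ⊛-at f g m ⟩
    conv m (λ a b → f a * g b)     ≡⟨ conv-cong′ m (λ a b → cong₂ _*_ (at e a) (at e′ b)) ⟩
    conv m (λ a b → f′ a * g′ b)   ≡⟨ ⊛-at f′ g′ m ⟨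
    (f′ ⊛ g′) m                    ∎)
    where open ≡-Reasoning

  ⊛-identityʳ : (f : PowerSeries d) → f ⊛ oneₚ ≈ₚ f
  ⊛-identityʳ {d} f = mk≈ₚ (λ m → begin
    (f ⊛ oneₚ) m                     ≡⟨ ⊛-at f oneₚ m ⟩
    conv m (λ a b → f a * oneₚ b)    ≡⟨ conv-last m _ (λ a b _ pos → trans (cong (f a *_) (oneₚ-+ b pos)) (*-zeroʳ (f a))) ⟩
    f m * oneₚ (𝟎 {d})                ≡⟨ cong (f m *_) (oneₚ-𝟎 d) ⟩
    f m * 1ℚ                         ≡⟨ *-identityʳ (f m) ⟩
    f m                              ∎)
    where open ≡-Reasoning

  ⊛-distribˡ : (f g h : PowerSeries d) → f ⊛ (g ⊞ h) ≈ₚ (f ⊛ g) ⊞ (f ⊛ h)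
  ⊛-distribˡ f g h = mk≈ₚ (λ m → begin
    (f ⊛ (g ⊞ h)) m                                        ≡⟨ ⊛-at f (g ⊞ h) m ⟩
    conv m (λ a b → f a * (g b + h b))                     ≡⟨ conv-cong′ m (λ a b → *-distribˡ-+ (f a) (g b) (h b)) ⟩
    conv m (λ a b → f a * g b + f a * h b)                 ≡⟨ conv-+ m _ _ ⟩
    conv m (λ a b → f a * g b) + conv m (λ a b → f a * h b) ≡⟨ cong₂ _+_ (⊛-at f g m) (⊛-at f h m) ⟨
    (f ⊛ g) m + (f ⊛ h) m                                  ∎)
    where open ≡-Reasoning

  isCommutativeRing : IsCommutativeRing (_≈ₚ_ {d}) _⊞_ _⊛_ ⊟_ 0ₚ oneₚ
  isCommutativeRing = record
    { isRing = record
      { +-isAbelianGroup = record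
        { isGroup = record
          { isMonoid = record
            { isSemigroup = record
              { isMagma = record
                { isEquivalence = record { refl = ≈ₚ-refl ; sym = ≈ₚ-sym ; trans = ≈ₚ-trans }
                ; ∙-cong = λ e e′ → mk≈ₚ (λ m → cong₂ _+_ (at e m) (at e′ m))
                }
              ; assoc = λ f g h → mk≈ₚ (λ m → +-assoc (f m) (g m) (h m))
              }
            ; identity = (λ f → mk≈ₚ (λ m → +-identityˡ (f m))) , (λ f → mk≈ₚ (λ m → +-identityʳ (f m)))
            }
          ; inverse = (λ f → mk≈ₚ (λ m → +-inverseˡ (f m))) , (λ f → mk≈ₚ (λ m → +-inverseʳ (f m)))
          ; ⁻¹-cong = λ e → mk≈ₚ (λ m → cong -_ (at e m))
          }
        ; comm = λ f g → mk≈ₚ (λ m → +-comm (f m) (g m))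
        }
      ; *-cong = ⊛-cong
      ; *-assoc = ⊛-assoc
      ; *-identity = (λ f → ≈ₚ-trans (⊛-comm oneₚ f) (⊛-identityʳ f)) , ⊛-identityʳ
      ; distrib = ⊛-distribˡ ,
          (λ f g h → ≈ₚ-trans (⊛-comm (g ⊞ h) f)
            (≈ₚ-trans (⊛-distribˡ f g h)
              (mk≈ₚ (λ m → cong₂ _+_ (at (⊛-comm f g) m) (at (⊛-comm f h) m)))))
      }
    ; *-comm = ⊛-comm
    }

powerSeriesRing : ℕ → CommutativeRing 0ℓ 0ℓ
powerSeriesRing d = record { isCommutativeRing = isCommutativeRing {d} }

-- Grouping a convolution by residues modulo p.

-- Cuts the range of i after its first n + 1 values. The offset by one is forced: a `σ` is never
-- empty.
σ-split : ∀ n x (f : ℕ → ℕ → ℚ) →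
          σ (suc n ℕ.+ x) f ≡ σ n (λ i k → f i (suc k ℕ.+ x)) + σ x (λ i j → f (suc n ℕ.+ i) j)
σ-split zero    x f = refl
σ-split (suc n) x f = trans (cong (f 0 (suc (suc n ℕ.+ x)) +_) (σ-split n x (λ i → f (suc i)))) (sym (+-assoc (f 0 (suc (suc n ℕ.+ x))) _ _))

module _ (p : ℕ) where

  blockSum : (ℕ → ℕ → ℚ) → ℕ → ℕ → ℕ → ℚ
  blockSum f a b y = σ y (λ i j → f (a ℕ.+ p ℕ.* i) (b ℕ.+ p ℕ.* j))

  -- Here c stands for p - 1 - r. When two residues add up to r + p, both exceed r; they are written
  -- `suc r + a` and `suc r + b` with a + b = c - 1, and the carry lowers y by one. No carry is
  -- possible for c = 0 (r = p - 1) or for y = 0.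
  carrySum : ℕ → ℕ → ℕ → (ℕ → ℕ → ℚ) → ℚ
  carrySum r (suc c) (suc y) f = σ c (λ a b → blockSum f (suc r ℕ.+ a) (suc r ℕ.+ b) y)
  carrySum r _       _       f = 0ℚ

  -- Residues (a , b) of (i , j) with i + j = r + p y satisfy a + b = r or a + b = r + p.
  σ-blocks : ∀ r c → p ≡ suc r ℕ.+ c → ∀ y (f : ℕ → ℕ → ℚ) →
             σ (r ℕ.+ p ℕ.* y) f ≡ σ r (λ a b → blockSum f a b y) + carrySum r c y f
  σ-blocks r c refl zero f = begin
    σ (r ℕ.+ p ℕ.* 0) f                      ≡⟨ cong (λ t → σ (r ℕ.+ t) f) (ℕP.*-zeroʳ p) ⟩
    σ (r ℕ.+ 0) f                            ≡⟨ cong (λ t → σ t f) (ℕP.+-identityʳ r) ⟩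
    σ r f                                    ≡⟨ σ-cong r (λ i j _ → cong₂ f (sym (lem i)) (sym (lem j))) ⟩
    σ r (λ a b → blockSum f a b 0)           ≡⟨ +-identityʳ _ ⟨
    σ r (λ a b → blockSum f a b 0) + 0ℚ      ≡⟨ cong (σ r (λ a b → blockSum f a b 0) +_) (carry₀ c) ⟨
    σ r (λ a b → blockSum f a b 0) + carrySum r c 0 f ∎
    where
    open ≡-Reasoning
    lem : ∀ i → i ℕ.+ p ℕ.* 0 ≡ i
    lem i = trans (cong (i ℕ.+_) (ℕP.*-zeroʳ p)) (ℕP.+-identityʳ i)
    carry₀ : ∀ c → carrySum r c 0 f ≡ 0ℚ
    carry₀ zero = refl
    carry₀ (suc c) = refl
  -- Induction on y, removing the first p values of i: the values 0, ..., r start the blocks without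
  -- carry, the next c values start those with carry, and what remains is the same sum for `f`
  -- shifted by p.
  σ-blocks r c p≡ (suc y) f = begin
    σ (r ℕ.+ p ℕ.* suc y) f
      ≡⟨ cong (λ t → σ t f) (e₁ p≡) ⟩
    σ (suc r ℕ.+ (c ℕ.+ (r ℕ.+ p ℕ.* y))) f
      ≡⟨ σ-split r _ f ⟩
    σ r (λ i k → f i (suc k ℕ.+ (c ℕ.+ (r ℕ.+ p ℕ.* y)))) + σ (c ℕ.+ (r ℕ.+ p ℕ.* y)) (λ i j → f (suc r ℕ.+ i) j)
      ≡⟨ cong₂ _+_ (σ-cong r λ i k i+k≡r → cong₂ f (sym (lem i)) (e₂ p≡ i k i+k≡r)) (rest c p≡) ⟩
    first + (tail + carry)
      ≡⟨ +-assoc first tail carry ⟨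
    first + tail + carry
      ≡⟨ cong (_+ carry) (trans (σ-cong r (λ a b _ → cong (f (a ℕ.+ p ℕ.* 0) (b ℕ.+ p ℕ.* suc y) +_)
                                    (σ-cong y (λ i j _ → cong (λ t → f t (b ℕ.+ p ℕ.* j)) (sym (shift a i))))))
                                (σ-+ r _ _)) ⟨
    σ r (λ a b → blockSum f a b (suc y)) + carry ∎
    where
    open ≡-Reasoning
    first tail carry : ℚ
    first = σ r (λ a b → f (a ℕ.+ p ℕ.* 0) (b ℕ.+ p ℕ.* suc y))
    tail  = σ r (λ a b → blockSum (λ i → f (p ℕ.+ i)) a b y)
    carry = carrySum r c (suc y) f
    lem : ∀ i → i ℕ.+ p ℕ.* 0 ≡ i
    lem i = trans (cong (i ℕ.+_) (ℕP.*-zeroʳ p)) (ℕP.+-identityʳ i)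
    shift : ∀ a i → p ℕ.+ (a ℕ.+ p ℕ.* i) ≡ a ℕ.+ p ℕ.* suc i
    shift a i = alg p a i
      where
      alg : ∀ p a i → p ℕ.+ (a ℕ.+ p ℕ.* i) ≡ a ℕ.+ p ℕ.* suc i
      alg = ℕSolver.solve-∀
    e₁ : p ≡ suc r ℕ.+ c → r ℕ.+ p ℕ.* suc y ≡ suc r ℕ.+ (c ℕ.+ (r ℕ.+ p ℕ.* y))
    e₁ e = trans (alg p r y) (trans (cong (ℕ._+ (r ℕ.+ p ℕ.* y)) e) (ℕP.+-assoc (suc r) c (r ℕ.+ p ℕ.* y)))
      where
      alg : ∀ p r y → r ℕ.+ p ℕ.* suc y ≡ p ℕ.+ (r ℕ.+ p ℕ.* y)
      alg = ℕSolver.solve-∀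
    e₂ : p ≡ suc r ℕ.+ c → ∀ i k → i ℕ.+ k ≡ r → suc k ℕ.+ (c ℕ.+ (r ℕ.+ p ℕ.* y)) ≡ k ℕ.+ p ℕ.* suc y
    e₂ e i k _ = trans (alg₁ k c r (p ℕ.* y)) (trans (cong (λ t → k ℕ.+ (t ℕ.+ p ℕ.* y)) (sym e)) (cong (k ℕ.+_) (sym (ℕP.*-suc p y))))
      where
      alg₁ : ∀ k c r z → suc k ℕ.+ (c ℕ.+ (r ℕ.+ z)) ≡ k ℕ.+ (suc r ℕ.+ c ℕ.+ z)
      alg₁ = ℕSolver.solve-∀
    rest : ∀ c → p ≡ suc r ℕ.+ c →
           σ (c ℕ.+ (r ℕ.+ p ℕ.* y)) (λ i j → f (suc r ℕ.+ i) j) ≡ tail + carrySum r c (suc y) f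
    rest zero e = trans
      (σ-cong (r ℕ.+ p ℕ.* y) (λ i j _ → cong (λ t → f (t ℕ.+ i) j) (sym (trans e (ℕP.+-identityʳ (suc r))))))
      (σ-blocks r 0 e y (λ i → f (p ℕ.+ i)))
    rest (suc c) e = begin
      σ (suc c ℕ.+ (r ℕ.+ p ℕ.* y)) (λ i j → f (suc r ℕ.+ i) j)
        ≡⟨ σ-split c (r ℕ.+ p ℕ.* y) (λ i j → f (suc r ℕ.+ i) j) ⟩
      σ c (λ a b → f (suc r ℕ.+ a) (suc b ℕ.+ (r ℕ.+ p ℕ.* y))) + σ (r ℕ.+ p ℕ.* y) (λ i j → f (suc r ℕ.+ (suc c ℕ.+ i)) j)
        ≡⟨ cong₂ _+_ (σ-cong c (λ a b _ → cong₂ f (sym (lem (suc r ℕ.+ a))) (alg r b (p ℕ.* y))))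
                     (σ-cong (r ℕ.+ p ℕ.* y) (λ i j _ → cong (λ t → f t j) (trans (sym (ℕP.+-assoc (suc r) (suc c) i)) (cong (ℕ._+ i) (sym e))))) ⟩
      σ c (λ a b → f (suc r ℕ.+ a ℕ.+ p ℕ.* 0) (suc r ℕ.+ b ℕ.+ p ℕ.* y)) + σ (r ℕ.+ p ℕ.* y) (λ i j → f (p ℕ.+ i) j)
        ≡⟨ cong (σ c (λ a b → f (suc r ℕ.+ a ℕ.+ p ℕ.* 0) (suc r ℕ.+ b ℕ.+ p ℕ.* y)) +_) (σ-blocks r (suc c) e y (λ i → f (p ℕ.+ i))) ⟩
      σ c (λ a b → f (suc r ℕ.+ a ℕ.+ p ℕ.* 0) (suc r ℕ.+ b ℕ.+ p ℕ.* y)) + (tail + carrySum r (suc c) y (λ i → f (p ℕ.+ i)))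
        ≡⟨ swap (σ c (λ a b → f (suc r ℕ.+ a ℕ.+ p ℕ.* 0) (suc r ℕ.+ b ℕ.+ p ℕ.* y))) tail (carrySum r (suc c) y (λ i → f (p ℕ.+ i))) ⟩
      tail + (σ c (λ a b → f (suc r ℕ.+ a ℕ.+ p ℕ.* 0) (suc r ℕ.+ b ℕ.+ p ℕ.* y)) + carrySum r (suc c) y (λ i → f (p ℕ.+ i)))
        ≡⟨ cong (tail +_) (merge y) ⟩
      tail + carrySum r (suc c) (suc y) f ∎
      where
      swap : ∀ u v w → u + (v + w) ≡ v + (u + w)
      swap = solve-∀ ℚ-ring
      alg : ∀ r b z → suc b ℕ.+ (r ℕ.+ z) ≡ suc r ℕ.+ b ℕ.+ z
      alg = ℕSolver.solve-∀
      merge : ∀ y → σ c (λ a b → f (suc r ℕ.+ a ℕ.+ p ℕ.* 0) (suc r ℕ.+ b ℕ.+ p ℕ.* y)) + carrySum r (suc c) y (λ i → f (p ℕ.+ i))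
                  ≡ carrySum r (suc c) (suc y) f
      merge zero = +-identityʳ _
      merge (suc y) = trans
        (cong (σ c (λ a b → f (suc r ℕ.+ a ℕ.+ p ℕ.* 0) (suc r ℕ.+ b ℕ.+ p ℕ.* suc y)) +_)
          (σ-cong c (λ a b _ → σ-cong y (λ i j _ → cong (λ t → f t (suc r ℕ.+ b ℕ.+ p ℕ.* j)) (shift (suc r ℕ.+ a) i)))))
        (sym (σ-+ c _ _))

module Residues (p : ℕ) {{_ : NonZero p}} where

  infixl 6 _⊹_
  _⊹_ : MultiIndex d → MultiIndex d → MultiIndex d
  _⊹_ = zipWith (λ a k → a ℕ.+ p ℕ.* k)

  Digits : MultiIndex d → Set
  Digits = All (ℕ._< p)

  module _ (P : ℚ → Set) (P0 : P 0ℚ) (P+ : ∀ {x y} → P x → P y → P (x + y)) where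

    -- Which residue pairs occur is forgotten: closure only asks that every block satisfy `P`, and
    -- the bound on y feeds the later inductions. `P 0ℚ` covers an empty carry part.
    σ-blocks-closed : ∀ x (f : ℕ → ℕ → ℚ) →
      (∀ a b y → a ℕ.< p → b ℕ.< p → p ℕ.* y ℕ.≤ x → P (σ y (λ i j → f (a ℕ.+ p ℕ.* i) (b ℕ.+ p ℕ.* j)))) → P (σ x f)
    σ-blocks-closed x f Pf = subst P (sym eq)
      (P+ (σ-closed P P+ r (λ a b e → Pf a b y (below a b e) (below b a (trans (ℕP.+-comm b a) e)) py≤x))
          (carry c y p≡ py≤x))
      where
      r = x % p
      y = x ℕ./ p
      c = p ∸ suc r
      p≡ : p ≡ suc r ℕ.+ c
      p≡ = sym (ℕP.m+[n∸m]≡n (m%n<n x p))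
      x≡ : x ≡ r ℕ.+ p ℕ.* y
      x≡ = trans (m≡m%n+[m/n]*n x p) (cong (r ℕ.+_) (ℕP.*-comm y p))
      py≤x : p ℕ.* y ℕ.≤ x
      py≤x = subst (p ℕ.* y ℕ.≤_) (sym x≡) (ℕP.m≤n+m (p ℕ.* y) r)
      eq : σ x f ≡ σ r (λ a b → blockSum p f a b y) + carrySum p r c y f
      eq = trans (cong (λ t → σ t f) x≡) (σ-blocks p r c p≡ y f)
      below : ∀ a b → a ℕ.+ b ≡ r → a ℕ.< p
      below a b e = ℕP.≤-<-trans (subst (a ℕ.≤_) e (ℕP.m≤m+n a b)) (m%n<n x p)
      carry : ∀ c y → p ≡ suc r ℕ.+ c → p ℕ.* y ℕ.≤ x → P (carrySum p r c y f)
      carry zero    y       e le = P0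
      carry (suc c) zero    e le = P0
      carry (suc c) (suc y) e le = σ-closed P P+ c (λ a b a+b≡c →
        Pf _ _ y (small a b a+b≡c) (small b a (trans (ℕP.+-comm b a) a+b≡c))
           (ℕP.≤-trans (ℕP.*-monoʳ-≤ p (ℕP.n≤1+n y)) le))
        where
        small : ∀ a b → a ℕ.+ b ≡ c → suc r ℕ.+ a ℕ.< p
        small a b refl = subst (suc r ℕ.+ a ℕ.<_) (sym e) (ℕP.+-monoʳ-< (suc r) (s≤s (ℕP.m≤m+n a b)))

    conv-blocks-closed : (K : MultiIndex d) (f : MultiIndex d → MultiIndex d → ℚ) →
      (∀ a b K′ → Digits a → Digits b → p ℕ.* ∣ K′ ∣ₘ ℕ.≤ ∣ K ∣ₘ → P (conv K′ (λ k l → f (a ⊹ k) (b ⊹ l)))) → P (conv K f)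
    conv-blocks-closed []      f Pf = Pf [] [] [] [] [] (ℕP.≤-reflexive (ℕP.*-zeroʳ p))
    conv-blocks-closed (x ∷ K) f Pf = σ-blocks-closed x _ (λ a b y a<p b<p py≤x →
      subst P (sym (conv-σ K y _)) (conv-blocks-closed K _ (λ as bs K′ das dbs le →
        subst P (conv-σ K′ y _) (Pf (a ∷ as) (b ∷ bs) (y ∷ K′) (a<p ∷ das) (b<p ∷ dbs)
          (subst (ℕ._≤ x ℕ.+ ∣ K ∣ₘ) (sym (ℕP.*-distribˡ-+ p y ∣ K′ ∣ₘ)) (ℕP.+-mono-≤ py≤x le))))))

-- Lipschitz weights and the induction on the antisymmetric sums.

scale : ℕ → MultiIndex d → MultiIndex d
scale c = Vec.map (c ℕ.*_)

module Lipschitz (p : ℕ) (isPrime : Prime p) where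
  open Local p isPrime
  open Residues p

  -- The parameter t counts spare factors p. Weights have t = 0; restriction to a residue class
  -- raises it to 1 (`Lip-⊹`), and division by p uses that factor up again (`Lip-quotient`).
  record Lip (t : ℕ) {d} (φ : MultiIndex d → ℚ) : Set where
    field
      int : ∀ m → Int (φ m)
      lip : ∀ s m n → φ (m ⊕ scale (p ℕ.^ s) n) ≈[ t ℕ.+ s ] φ m
  open Lip

  Lip-* : ∀ {t} {φ ψ : MultiIndex d → ℚ} → Lip t φ → Lip t ψ → Lip t (λ m → φ m * ψ m)
  Lip-* Lφ Lψ = record
    { int = λ m → Int-* (int Lφ m) (int Lψ m)
    ; lip = λ s m n → ≈-* (int Lψ _) (int Lφ m) (lip Lφ s m n) (lip Lψ s m n)
    }

  Lip-const : ∀ {t c} → Int c → Lip t {d} (λ _ → c)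
  Lip-const ic = record { int = λ _ → ic ; lip = λ _ _ _ → ≈-refl }

  ⊹-⊕ : (a m n : MultiIndex d) (q : ℕ) → a ⊹ (m ⊕ scale q n) ≡ (a ⊹ m) ⊕ scale (p ℕ.* q) n
  ⊹-⊕ []      []      []      q = refl
  ⊹-⊕ (a ∷ as) (m ∷ ms) (n ∷ ns) q = cong₂ _∷_ (alg p q a m n) (⊹-⊕ as ms ns q)
    where
    alg : ∀ p q a m n → a ℕ.+ p ℕ.* (m ℕ.+ q ℕ.* n) ≡ a ℕ.+ p ℕ.* m ℕ.+ p ℕ.* q ℕ.* n
    alg = ℕSolver.solve-∀

  Lip-⊹ : ∀ {φ : MultiIndex d → ℚ} a → Lip 0 φ → Lip 1 (λ k → φ (a ⊹ k))
  Lip-⊹ {φ = φ} a Lφ = record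
    { int = λ m → int Lφ _
    ; lip = λ s m n → subst (λ t → φ t ≈[ suc s ] φ (a ⊹ m)) (sym (⊹-⊕ a m n (p ℕ.^ s))) (lip Lφ (suc s) (a ⊹ m) n)
    }

  𝟎-⊕-scale₁ : (m : MultiIndex d) → 𝟎 ⊕ scale 1 m ≡ m
  𝟎-⊕-scale₁ []      = refl
  𝟎-⊕-scale₁ (x ∷ m) = cong₂ _∷_ (ℕP.+-identityʳ x) (𝟎-⊕-scale₁ m)

  Lip-quotient : ∀ {Φ : MultiIndex d → ℚ} → Lip 1 Φ → Lip 0 (λ m → inv p * (Φ m - Φ 𝟎))
  Lip-quotient {Φ = Φ} LΦ = record
    -- Integrality is the Lipschitz condition for s = 0: every m is a translate of `𝟎` by 1 * m.
    { int = λ m → Div₁⇒Int (subst (λ t → Div 1 (Φ t - Φ 𝟎)) (𝟎-⊕-scale₁ m) (≈⇒Div (lip LΦ 0 𝟎 m)))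
    ; lip = λ s m n → mk≈ (subst (Div s) (alg (inv p) (Φ (m ⊕ scale (p ℕ.^ s) n)) (Φ m) (Φ 𝟎)) (Div-pred (≈⇒Div (lip LΦ s m n))))
    }
    where
    alg : ∀ i x y z → i * (x - y) ≡ i * (x - z) - i * (y - z)
    alg = solve-∀ ℚ-ring

  -- An interface for the induction and the congruence: factorials and harmonic numbers enter them
  -- only through an instance of it.
  record DworkPair {d} (B H : MultiIndex d → ℚ) : Set where
    field
      Y     : MultiIndex d → MultiIndex d → ℚ
      Y-lip : ∀ {a} → Digits a → Lip 1 (Y a)
      B-rec : ∀ {a} → Digits a → ∀ k → B (a ⊹ k) ≡ B k * Y a k
      B-int : ∀ m → Int (B m)
      H-rec : ∀ {a} → Digits a → ∀ k → Int (B (a ⊹ k) * (H (a ⊹ k) - inv p * H k))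

  ⊕-small : (a b : MultiIndex d) → ∣ a ⊕ b ∣ₘ ≡ 0 → a ≡ b
  ⊕-small []      []      e = refl
  ⊕-small (x ∷ a) (y ∷ b) e with ℕP.m+n≡0⇒m≡0 (x ℕ.+ y) e
  ... | e′ = cong₂ _∷_ (trans (ℕP.m+n≡0⇒m≡0 x e′) (sym (ℕP.m+n≡0⇒n≡0 x e′))) (⊕-small a b (ℕP.m+n≡0⇒n≡0 (x ℕ.+ y) e))

  module _ {B H : MultiIndex d → ℚ} (D : DworkPair B H) where
    open DworkPair D

    term : (φ ψ : MultiIndex d → ℚ) → MultiIndex d → MultiIndex d → ℚ
    term φ ψ k l = B k * B l * (φ k * ψ l) * (H l - H k)

    S : (φ ψ : MultiIndex d → ℚ) → MultiIndex d → ℚ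
    S φ ψ K = conv K (term φ ψ)

    S-antisymmetric : ∀ K → S (λ _ → 1ℚ) (λ _ → 1ℚ) K ≡ 0ℚ
    S-antisymmetric K = begin
      conv K (term (λ _ → 1ℚ) (λ _ → 1ℚ))
        ≡⟨ conv-cong′ K (λ k l → alg (B k) (B l) (H k) (H l)) ⟩
      conv K (λ k l → B l * B k * H l + - 1ℚ * (B k * B l * H k))
        ≡⟨ conv-+ K _ _ ⟩
      conv K (λ k l → B l * B k * H l) + conv K (λ k l → - 1ℚ * (B k * B l * H k))
        ≡⟨ cong₂ _+_ (conv-comm K (λ k l → B l * B k * H l)) (conv-*ˡ K (- 1ℚ) _) ⟩
      X + - 1ℚ * X
        ≡⟨ alg₂ X ⟩
      0ℚ ∎
      where
      open ≡-Reasoning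
      X = conv K (λ k l → B k * B l * H k)
      alg : ∀ b b′ h h′ → b * b′ * (1ℚ * 1ℚ) * (h′ - h) ≡ b′ * b * h′ + - 1ℚ * (b * b′ * h)
      alg = solve-∀ ℚ-ring
      alg₂ : ∀ x → x + - 1ℚ * x ≡ 0ℚ
      alg₂ = solve-∀ ℚ-ring

    -- Write Φ = Φ 𝟎 + p φ₁ and Ψ = Ψ 𝟎 + p ψ₁; the constant parts cancel by antisymmetry.
    S-Lip₁ : ∀ K → (∀ {φ ψ} → Lip 0 φ → Lip 0 ψ → Int (S φ ψ K)) →
             ∀ {Φ Ψ} → Lip 1 Φ → Lip 1 Ψ → Int (inv p * S Φ Ψ K)
    S-Lip₁ K S-int {Φ} {Ψ} LΦ LΨ = subst Int (sym eq)
      (Int-+ (Int-+ (Int-+ Int-0 (Int-* (int LΨ 𝟎) (S-int Lφ₁ L1))) (Int-* (int LΦ 𝟎) (S-int L1 Lψ₁)))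
             (Int-* (Int-⟦⟧ p) (S-int Lφ₁ Lψ₁)))
      where
      open ≡-Reasoning
      c = Φ 𝟎
      e = Ψ 𝟎
      one φ₁ ψ₁ : MultiIndex d → ℚ
      one _ = 1ℚ
      φ₁ m = inv p * (Φ m - c)
      ψ₁ m = inv p * (Ψ m - e)
      L1 : Lip 0 one
      L1 = Lip-const Int-1
      Lφ₁ = Lip-quotient LΦ
      Lψ₁ = Lip-quotient LΨ
      -- To the ring solver `i` and `p` are independent variables, so the identity carries a defect
      -- p * i - 1, which vanishes once i = 1/p.
      alg : ∀ x h i p c e Φ Ψ →
        i * c * e * (x * (1ℚ * 1ℚ) * h) + e * (x * (i * (Φ - c) * 1ℚ) * h) + c * (x * (1ℚ * (i * (Ψ - e))) * h)
          + p * (x * (i * (Φ - c) * (i * (Ψ - e))) * h)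
        ≡ i * (x * (Φ * Ψ) * h) + (p * i - 1ℚ) * (x * (i * (Φ - c) * (Ψ - e)) * h)
      alg = solve-∀ ℚ-ring
      termwise : ∀ k l → inv p * term Φ Ψ k l ≡
        inv p * c * e * term one one k l + e * term φ₁ one k l + c * term one ψ₁ k l + ⟦ p ⟧ * term φ₁ ψ₁ k l
      termwise k l = sym (begin
        _ ≡⟨ alg (B k * B l) (H l - H k) (inv p) ⟦ p ⟧ c e (Φ k) (Ψ l) ⟩
        inv p * term Φ Ψ k l + (⟦ p ⟧ * inv p - 1ℚ) * R ≡⟨ cong (λ t → inv p * term Φ Ψ k l + (t - 1ℚ) * R) p*inv-p ⟩
        inv p * term Φ Ψ k l + (1ℚ - 1ℚ) * R ≡⟨ cong (inv p * term Φ Ψ k l +_) (*-zeroˡ R) ⟩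
        inv p * term Φ Ψ k l + 0ℚ ≡⟨ +-identityʳ _ ⟩
        inv p * term Φ Ψ k l ∎)
        where R = B k * B l * (inv p * (Φ k - c) * (Ψ l - e)) * (H l - H k)
      eq : inv p * S Φ Ψ K ≡ 0ℚ + e * S φ₁ one K + c * S one ψ₁ K + ⟦ p ⟧ * S φ₁ ψ₁ K
      eq = begin
        inv p * S Φ Ψ K                                ≡⟨ conv-*ˡ K (inv p) (term Φ Ψ) ⟨
        conv K (λ k l → inv p * term Φ Ψ k l)          ≡⟨ conv-cong′ K termwise ⟩
        conv K (λ k l → inv p * c * e * term one one k l + e * term φ₁ one k l + c * term one ψ₁ k l + ⟦ p ⟧ * term φ₁ ψ₁ k l)
          ≡⟨ trans (conv-+ K _ _) (cong₂ _+_ (trans (conv-+ K _ _) (cong₂ _+_ (conv-+ K _ _) refl)) refl) ⟩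
        conv K (λ k l → inv p * c * e * term one one k l) + conv K (λ k l → e * term φ₁ one k l)
          + conv K (λ k l → c * term one ψ₁ k l) + conv K (λ k l → ⟦ p ⟧ * term φ₁ ψ₁ k l)
          ≡⟨ cong₂ _+_ (cong₂ _+_ (cong₂ _+_ (trans (conv-*ˡ K (inv p * c * e) _) (trans (cong (inv p * c * e *_) (S-antisymmetric K)) (*-zeroʳ (inv p * c * e)))) (conv-*ˡ K e _)) (conv-*ˡ K c _)) (conv-*ˡ K ⟦ p ⟧ _) ⟩
        0ℚ + e * S φ₁ one K + c * S one ψ₁ K + ⟦ p ⟧ * S φ₁ ψ₁ K ∎

    S-int : ∀ n K → ∣ K ∣ₘ ℕ.≤ n → ∀ {φ ψ} → Lip 0 φ → Lip 0 ψ → Int (S φ ψ K)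
    S-int zero    K ∣K∣≤0 {φ} {ψ} Lφ Lψ = conv-closed Int Int-+ K (λ k l e → subst Int (zero-term k l e) Int-0)
      where
      zero-term : ∀ k l → k ⊕ l ≡ K → 0ℚ ≡ term φ ψ k l
      -- In degree 0 both indices coincide, so the factor `H l - H k` vanishes.
      zero-term k l e with ⊕-small k l (ℕP.n≤0⇒n≡0 (subst (λ t → ∣ t ∣ₘ ℕ.≤ 0) (sym e) ∣K∣≤0))
      ... | refl = sym (trans (cong (B k * B k * (φ k * ψ k) *_) (+-inverseʳ (H k))) (*-zeroʳ (B k * B k * (φ k * ψ k))))
    S-int (suc n) K ∣K∣≤ {φ} {ψ} Lφ Lψ = conv-blocks-closed Int Int-0 Int-+ K _ block
      where
      block : ∀ a b K′ → Digits a → Digits b → p ℕ.* ∣ K′ ∣ₘ ℕ.≤ ∣ K ∣ₘ → Int (conv K′ (λ k l → term φ ψ (a ⊹ k) (b ⊹ l)))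
      block a b K′ da db le = subst Int (sym eq) (Int-+
          (conv-closed Int Int-+ K′ (λ k l _ → Int-sub
            (Int-* (Int-* (B-int (a ⊹ k)) (Int-* (int Lφ (a ⊹ k)) (int Lψ (b ⊹ l)))) (H-rec db l))
            (Int-* (Int-* (B-int (b ⊹ l)) (Int-* (int Lφ (a ⊹ k)) (int Lψ (b ⊹ l)))) (H-rec da k))))
          (S-Lip₁ K′ (S-int n K′ (p*x≤1+n⇒x≤n ∣ K′ ∣ₘ (ℕP.≤-trans le ∣K∣≤))) LΦ LΨ))
        where
        Φ Ψ : MultiIndex d → ℚ
        Φ k = Y a k * φ (a ⊹ k)
        Ψ l = Y b l * ψ (b ⊹ l)
        LΦ : Lip 1 Φ
        LΦ = Lip-* (Y-lip da) (Lip-⊹ a Lφ)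
        LΨ : Lip 1 Ψ
        LΨ = Lip-* (Y-lip db) (Lip-⊹ b Lψ)
        -- The error of replacing each `H` by `inv p * H` at the quotient index. Each of the two
        -- differences becomes integral only together with the `B` of its own index, so the two
        -- summands spend different factors `B`.
        ρ-part : MultiIndex d → MultiIndex d → ℚ
        ρ-part k l =
          B (a ⊹ k) * (φ (a ⊹ k) * ψ (b ⊹ l)) * (B (b ⊹ l) * (H (b ⊹ l) - inv p * H l))
          - B (b ⊹ l) * (φ (a ⊹ k) * ψ (b ⊹ l)) * (B (a ⊹ k) * (H (a ⊹ k) - inv p * H k))
        alg : ∀ i h h′ H H′ b b′ y y′ f g →
          b * y * (b′ * y′) * (f * g) * (H′ - H) ≡
          (b * y * (f * g) * (b′ * y′ * (H′ - i * h′)) - b′ * y′ * (f * g) * (b * y * (H - i * h)))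
          + i * (b * b′ * (y * f * (y′ * g)) * (h′ - h))
        alg = solve-∀ ℚ-ring
        termwise : ∀ k l → term φ ψ (a ⊹ k) (b ⊹ l) ≡ ρ-part k l + inv p * term Φ Ψ k l
        termwise k l rewrite B-rec da k | B-rec db l =
          alg (inv p) (H k) (H l) (H (a ⊹ k)) (H (b ⊹ l)) (B k) (B l) (Y a k) (Y b l) (φ (a ⊹ k)) (ψ (b ⊹ l))
        eq : conv K′ (λ k l → term φ ψ (a ⊹ k) (b ⊹ l)) ≡ conv K′ ρ-part + inv p * S Φ Ψ K′
        eq = trans (conv-cong′ K′ termwise)
                   (trans (conv-+ K′ _ _) (cong (conv K′ ρ-part +_) (conv-*ˡ K′ (inv p) (term Φ Ψ))))

    S-Lip₁-int : ∀ K {Φ Ψ} → Lip 1 Φ → Lip 1 Ψ → Int (inv p * S Φ Ψ K)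
    S-Lip₁-int K = S-Lip₁ K (S-int ∣ K ∣ₘ K ℕP.≤-refl)

-- Powers, linear forms and factorial ratios.

powℚ-+ : ∀ x m n → powℚ x (m ℕ.+ n) ≡ powℚ x m * powℚ x n
powℚ-+ x zero    n = sym (*-identityˡ _)
powℚ-+ x (suc m) n = trans (cong (x *_) (powℚ-+ x m n)) (sym (*-assoc x (powℚ x m) (powℚ x n)))

powℚ-* : ∀ x m n → powℚ x (m ℕ.* n) ≡ powℚ (powℚ x n) m
powℚ-* x zero    n = refl
powℚ-* x (suc m) n = trans (powℚ-+ x n (m ℕ.* n)) (cong (powℚ x n *_) (powℚ-* x m n))

*-interchange : ∀ a b c e → (a * b) * (c * e) ≡ (a * c) * (b * e)
*-interchange = solve-∀ ℚ-ring

powℚ-distrib : ∀ x y n → powℚ (x * y) n ≡ powℚ x n * powℚ y n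
powℚ-distrib x y zero    = refl
powℚ-distrib x y (suc n) = trans (cong (x * y *_) (powℚ-distrib x y n)) (*-interchange x y (powℚ x n) (powℚ y n))

powℚ-1 : ∀ n → powℚ 1ℚ n ≡ 1ℚ
powℚ-1 zero    = refl
powℚ-1 (suc n) = trans (*-identityˡ _) (powℚ-1 n)

⟦^⟧ : ∀ m n → ⟦ m ℕ.^ n ⟧ ≡ powℚ ⟦ m ⟧ n
⟦^⟧ m zero    = ι-1
⟦^⟧ m (suc n) = trans (⟦⟧-* m (m ℕ.^ n)) (cong (⟦ m ⟧ *_) (⟦^⟧ m n))

inv-homo : ∀ m n .{{_ : NonZero m}} .{{_ : NonZero n}} → inv (m ℕ.* n) ≡ inv m * inv n
inv-homo m n = begin
  inv (m ℕ.* n)                                          ≡⟨ alg₁ (inv (m ℕ.* n)) ⟩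
  inv (m ℕ.* n) * (1ℚ * 1ℚ)                              ≡⟨ cong₂ (λ s t → inv (m ℕ.* n) * (s * t)) (inv-* m) (inv-* n) ⟨
  inv (m ℕ.* n) * (⟦ m ⟧ * inv m * (⟦ n ⟧ * inv n))      ≡⟨ alg₂ (inv (m ℕ.* n)) ⟦ m ⟧ (inv m) ⟦ n ⟧ (inv n) ⟩
  ⟦ m ⟧ * ⟦ n ⟧ * inv (m ℕ.* n) * (inv m * inv n)        ≡⟨ cong (λ t → t * inv (m ℕ.* n) * (inv m * inv n)) (⟦⟧-* m n) ⟨
  ⟦ m ℕ.* n ⟧ * inv (m ℕ.* n) * (inv m * inv n)          ≡⟨ cong (_* (inv m * inv n)) (inv-* (m ℕ.* n) {{ℕP.m*n≢0 m n}}) ⟩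
  1ℚ * (inv m * inv n)                                   ≡⟨ *-identityˡ _ ⟩
  inv m * inv n                                          ∎
  where
  open ≡-Reasoning
  alg₁ : ∀ x → x ≡ x * (1ℚ * 1ℚ)
  alg₁ = solve-∀ ℚ-ring
  alg₂ : ∀ x m i n j → x * (m * i * (n * j)) ≡ m * n * x * (i * j)
  alg₂ = solve-∀ ℚ-ring

invFact-inv : ∀ n → invFact n ≡ inv (n !)
invFact-inv n = sym (inv-def (n !) {{n ℕP.!≢0}})

invFact-0 : invFact 0 ≡ 1ℚ
invFact-0 = refl

factRatio-⟦⟧ : (v : Vec ℕ d) (m : MultiIndex d) → factRatio v m ≡ ⟦ dot v m ! ⟧ * invFactPow v m
factRatio-⟦⟧ v m = cong (_* invFactPow v m) (sym (ι-def (ℤ.+ (dot v m !))))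

dot-𝟎 : (v : Vec ℕ d) → dot v 𝟎 ≡ 0
dot-𝟎 []      = refl
dot-𝟎 (v ∷ vs) = cong₂ ℕ._+_ (ℕP.*-zeroʳ v) (dot-𝟎 vs)

invFactPow-𝟎 : (v : Vec ℕ d) → invFactPow v 𝟎 ≡ 1ℚ
invFactPow-𝟎 []       = refl
invFactPow-𝟎 (v ∷ vs) = cong₂ _*_ (powℚ-1 v) (invFactPow-𝟎 vs)

factRatio-𝟎 : (v : Vec ℕ d) → factRatio v 𝟎 ≡ 1ℚ
factRatio-𝟎 v = trans (factRatio-⟦⟧ v 𝟎) (trans (cong₂ (λ s t → ⟦ s ! ⟧ * t) (dot-𝟎 v) (invFactPow-𝟎 v)) (trans (cong (_* 1ℚ) ι-1) (*-identityˡ 1ℚ)))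

dot-⊕-scale : (v k n : Vec ℕ d) (q : ℕ) → dot v (k ⊕ scale q n) ≡ dot v k ℕ.+ q ℕ.* dot v n
dot-⊕-scale []      []      []      q = sym (ℕP.*-zeroʳ q)
dot-⊕-scale (v ∷ vs) (k ∷ ks) (n ∷ ns) q = trans (cong (v ℕ.* (k ℕ.+ q ℕ.* n) ℕ.+_) (dot-⊕-scale vs ks ns q)) (alg v k n q (dot vs ks) (dot vs ns))
  where
  alg : ∀ v k n q s t → v ℕ.* (k ℕ.+ q ℕ.* n) ℕ.+ (s ℕ.+ q ℕ.* t) ≡ v ℕ.* k ℕ.+ s ℕ.+ q ℕ.* (v ℕ.* n ℕ.+ t)
  alg = ℕSolver.solve-∀

dot-∸ : (L N m : Vec ℕ d) → Pointwise ℕ._≤_ L N → dot N m ≡ dot (zipWith _∸_ N L) m ℕ.+ dot L m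
dot-∸ []      []      []      []       = refl
dot-∸ (l ∷ L) (n ∷ N) (x ∷ m) (l≤n ∷ L≤N) =
  trans (cong₂ (λ s t → s ℕ.* x ℕ.+ t) (sym (ℕP.m∸n+n≡m l≤n)) (dot-∸ L N m L≤N))
        (alg (n ∸ l) l x (dot (zipWith _∸_ N L) m) (dot L m))
  where
  alg : ∀ e l x s t → (e ℕ.+ l) ℕ.* x ℕ.+ (s ℕ.+ t) ≡ e ℕ.* x ℕ.+ s ℕ.+ (l ℕ.* x ℕ.+ t)
  alg = ℕSolver.solve-∀

-- The product (x + 1) ... (x + v). It starts at x + 1, not at x, so that it equals (x + v)! / x!.
rising : ℕ → ℕ → ℕ
rising x zero    = 1
rising x (suc v) = rising x v ℕ.* (x ℕ.+ suc v)

!-rising : ∀ x v → (x ℕ.+ v) ! ≡ x ! ℕ.* rising x v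
!-rising x zero    = trans (cong _! (ℕP.+-identityʳ x)) (sym (ℕP.*-identityʳ (x !)))
!-rising x (suc v) = begin
  (x ℕ.+ suc v) !                          ≡⟨ cong _! (ℕP.+-suc x v) ⟩
  suc (x ℕ.+ v) ℕ.* (x ℕ.+ v) !            ≡⟨ cong₂ ℕ._*_ (sym (ℕP.+-suc x v)) (!-rising x v) ⟩
  (x ℕ.+ suc v) ℕ.* (x ! ℕ.* rising x v)   ≡⟨ alg (x ℕ.+ suc v) (x !) (rising x v) ⟩
  x ! ℕ.* (rising x v ℕ.* (x ℕ.+ suc v))   ∎
  where
  open ≡-Reasoning
  alg : ∀ a b c → a ℕ.* (b ℕ.* c) ≡ b ℕ.* (c ℕ.* a)
  alg = ℕSolver.solve-∀

-- Factorials modulo powers of p.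

module Factorials (p : ℕ) (isPrime : Prime p) where
  open Local p isPrime
  open Residues p
  open Lipschitz p isPrime

  Int-powℚ : ∀ {x} → Int x → ∀ n → Int (powℚ x n)
  Int-powℚ ix zero    = Int-1
  Int-powℚ ix (suc n) = Int-* ix (Int-powℚ ix n)

  ≈-powℚ : ∀ {s x y} → Int x → Int y → x ≈[ s ] y → ∀ n → powℚ x n ≈[ s ] powℚ y n
  ≈-powℚ ix iy e zero    = ≈-refl
  ≈-powℚ ix iy e (suc n) = ≈-* (Int-powℚ ix n) iy e (≈-powℚ ix iy e n)

  P : ℕ → ℕ
  P zero    = 1
  P (suc m) = P m ℕ.* rising (p ℕ.* m) (ℕ.pred p)

  -- The cofactor of p^m m! in (v + p m)!. It is prime to p for v < p, as in the denominators of
  -- `factRatio`; in the numerator v = N·a can reach p or more, where it need not be a unit.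
  u : ℕ → ℕ → ℕ
  u v m = P m ℕ.* rising (p ℕ.* m) v

  [pm]! : ∀ m → (p ℕ.* m) ! ≡ p ℕ.^ m ℕ.* m ! ℕ.* P m
  [pm]! zero    = cong _! (ℕP.*-zeroʳ p)
  [pm]! (suc m) = begin
    (p ℕ.* suc m) !
      ≡⟨ cong _! (trans (ℕP.*-suc p m) (trans (ℕP.+-comm p (p ℕ.* m)) (cong (p ℕ.* m ℕ.+_) (sym (ℕP.suc-pred p))))) ⟩
    (p ℕ.* m ℕ.+ suc (ℕ.pred p)) !
      ≡⟨ !-rising (p ℕ.* m) (suc (ℕ.pred p)) ⟩
    (p ℕ.* m) ! ℕ.* (r ℕ.* (p ℕ.* m ℕ.+ suc (ℕ.pred p)))
      ≡⟨ cong₂ (λ s t → s ℕ.* (r ℕ.* (p ℕ.* m ℕ.+ t))) ([pm]! m) (ℕP.suc-pred p) ⟩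
    p ℕ.^ m ℕ.* m ! ℕ.* P m ℕ.* (r ℕ.* (p ℕ.* m ℕ.+ p))
      ≡⟨ alg (p ℕ.^ m) (m !) (P m) r p m ⟩
    p ℕ.^ suc m ℕ.* suc m ! ℕ.* (P m ℕ.* r) ∎
    where
    open ≡-Reasoning
    r = rising (p ℕ.* m) (ℕ.pred p)
    alg : ∀ q f P r p m → q ℕ.* f ℕ.* P ℕ.* (r ℕ.* (p ℕ.* m ℕ.+ p)) ≡ p ℕ.* q ℕ.* (f ℕ.+ m ℕ.* f) ℕ.* (P ℕ.* r)
    alg = ℕSolver.solve-∀

  !-u : ∀ v m → (v ℕ.+ p ℕ.* m) ! ≡ p ℕ.^ m ℕ.* m ! ℕ.* u v m
  !-u v m = begin
    (v ℕ.+ p ℕ.* m) !                              ≡⟨ cong _! (ℕP.+-comm v (p ℕ.* m)) ⟩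
    (p ℕ.* m ℕ.+ v) !                              ≡⟨ !-rising (p ℕ.* m) v ⟩
    (p ℕ.* m) ! ℕ.* rising (p ℕ.* m) v             ≡⟨ cong (ℕ._* rising (p ℕ.* m) v) ([pm]! m) ⟩
    p ℕ.^ m ℕ.* m ! ℕ.* P m ℕ.* rising (p ℕ.* m) v ≡⟨ ℕP.*-assoc (p ℕ.^ m ℕ.* m !) (P m) _ ⟩
    p ℕ.^ m ℕ.* m ! ℕ.* u v m                      ∎
    where open ≡-Reasoning

  ⟦!-u⟧ : ∀ v m → ⟦ (v ℕ.+ p ℕ.* m) ! ⟧ ≡ powℚ ⟦ p ⟧ m * ⟦ m ! ⟧ * ⟦ u v m ⟧
  ⟦!-u⟧ v m = trans (cong ⟦_⟧ (!-u v m)) (trans (⟦⟧-* (p ℕ.^ m ℕ.* m !) (u v m)) (cong (_* ⟦ u v m ⟧)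
    (trans (⟦⟧-* (p ℕ.^ m) (m !)) (cong (_* ⟦ m ! ⟧) (⟦^⟧ p m)))))

  p∤rising : ∀ m v → v ℕ.< p → p ∤ rising (p ℕ.* m) v
  p∤rising m zero    v<p = ∤-1
  p∤rising m (suc v) v<p = ∤-* (p∤rising m v (ℕP.<-trans (ℕP.n<1+n v) v<p))
    (λ p∣ → ℕP.<⇒≱ v<p (ℕD.∣⇒≤ (ℕD.∣m+n∣m⇒∣n p∣ (ℕD.m∣m*n m))))

  p∤P : ∀ m → p ∤ P m
  p∤P zero    = ∤-1
  p∤P (suc m) = ∤-* (p∤P m) (p∤rising m (ℕ.pred p) (ℕP.≤-reflexive (ℕP.suc-pred p)))

  p∤u : ∀ {v} m → v ℕ.< p → p ∤ u v m
  p∤u {v} m v<p = ∤-* (p∤P m) (p∤rising m v v<p)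

  ⟦+p^*⟧-≈ : ∀ s x n → ⟦ x ℕ.+ p ℕ.^ s ℕ.* n ⟧ ≈[ s ] ⟦ x ⟧
  ⟦+p^*⟧-≈ s x n = mk≈ (mkDiv ⟦ n ⟧ (Int-⟦⟧ n) (trans (cong (_- ⟦ x ⟧) (trans (⟦⟧-+ x (p ℕ.^ s ℕ.* n)) (cong (⟦ x ⟧ +_) (⟦⟧-* (p ℕ.^ s) n)))) (alg ⟦ x ⟧ ⟦ p ℕ.^ s ⟧ ⟦ n ⟧)))
    where
    alg : ∀ x q n → x + q * n - x ≡ q * n
    alg = solve-∀ ℚ-ring

  rising-≈ : ∀ s x n v → ⟦ rising (x ℕ.+ p ℕ.^ s ℕ.* n) v ⟧ ≈[ s ] ⟦ rising x v ⟧
  rising-≈ s x n zero    = ≈-refl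
  rising-≈ s x n (suc v) =
    subst₂ (_≈[ s ]_) (sym (⟦⟧-* _ (x ℕ.+ p ℕ.^ s ℕ.* n ℕ.+ suc v))) (sym (⟦⟧-* (rising x v) (x ℕ.+ suc v)))
      (≈-* (Int-⟦⟧ _) (Int-⟦⟧ (rising x v)) (rising-≈ s x n v)
        (subst (λ t → ⟦ t ⟧ ≈[ s ] ⟦ x ℕ.+ suc v ⟧) (alg x (suc v) (p ℕ.^ s ℕ.* n)) (⟦+p^*⟧-≈ s (x ℕ.+ suc v) n)))
    where
    alg : ∀ x v t → x ℕ.+ v ℕ.+ t ≡ x ℕ.+ t ℕ.+ v
    alg = ℕSolver.solve-∀

  rising-p-≈ : ∀ s m n v → ⟦ rising (p ℕ.* (m ℕ.+ p ℕ.^ s ℕ.* n)) v ⟧ ≈[ suc s ] ⟦ rising (p ℕ.* m) v ⟧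
  rising-p-≈ s m n v = subst (λ t → ⟦ rising t v ⟧ ≈[ suc s ] ⟦ rising (p ℕ.* m) v ⟧) (alg p m (p ℕ.^ s) n) (rising-≈ (suc s) (p ℕ.* m) n v)
    where
    alg : ∀ p m q n → p ℕ.* m ℕ.+ p ℕ.* q ℕ.* n ≡ p ℕ.* (m ℕ.+ q ℕ.* n)
    alg = ℕSolver.solve-∀

  -- P m is the product of all j ≤ p m prime to p; shifting m by p^s multiplies it by a
  -- product over a full period modulo p^(s+1).
  P-≈ : ∀ s m → ⟦ P (m ℕ.+ p ℕ.^ s) ⟧ ≈[ suc s ] ⟦ P m ⟧ * ⟦ P (p ℕ.^ s) ⟧
  P-≈ s zero    = ≈-reflexive (trans (sym (*-identityˡ _)) (cong (_* ⟦ P (p ℕ.^ s) ⟧) (sym ι-1)))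
  P-≈ s (suc m) = subst₂ (_≈[ suc s ]_) (sym (⟦⟧-* (P (m ℕ.+ p ℕ.^ s)) _)) eq
    (≈-* (Int-⟦⟧ _) (Int-* (Int-⟦⟧ (P m)) (Int-⟦⟧ _)) (P-≈ s m)
      (subst (λ t → ⟦ rising (p ℕ.* (m ℕ.+ t)) (ℕ.pred p) ⟧ ≈[ suc s ] ⟦ r ⟧) (ℕP.*-identityʳ (p ℕ.^ s)) (rising-p-≈ s m 1 (ℕ.pred p))))
    where
    r = rising (p ℕ.* m) (ℕ.pred p)
    alg : ∀ a b c → a * b * c ≡ a * c * b
    alg = solve-∀ ℚ-ring
    eq : ⟦ P m ⟧ * ⟦ P (p ℕ.^ s) ⟧ * ⟦ r ⟧ ≡ ⟦ P m ℕ.* r ⟧ * ⟦ P (p ℕ.^ s) ⟧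
    eq = trans (alg ⟦ P m ⟧ ⟦ P (p ℕ.^ s) ⟧ ⟦ r ⟧) (cong (_* ⟦ P (p ℕ.^ s) ⟧) (sym (⟦⟧-* (P m) r)))

  P-≈-* : ∀ s m n → ⟦ P (m ℕ.+ p ℕ.^ s ℕ.* n) ⟧ ≈[ suc s ] ⟦ P m ⟧ * powℚ ⟦ P (p ℕ.^ s) ⟧ n
  P-≈-* s m zero    = ≈-reflexive (trans (cong (λ t → ⟦ P t ⟧) (trans (cong (m ℕ.+_) (ℕP.*-zeroʳ (p ℕ.^ s))) (ℕP.+-identityʳ m))) (sym (*-identityʳ ⟦ P m ⟧)))
  P-≈-* s m (suc n) = subst₂ (_≈[ suc s ]_) (cong (λ t → ⟦ P t ⟧) (alg m (p ℕ.^ s) n)) (alg₂ ⟦ P m ⟧ (powℚ ⟦ P (p ℕ.^ s) ⟧ n) ⟦ P (p ℕ.^ s) ⟧)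
    (≈-trans (P-≈ s (m ℕ.+ p ℕ.^ s ℕ.* n)) (≈-* (Int-⟦⟧ _) (Int-* (Int-⟦⟧ _) (Int-powℚ (Int-⟦⟧ _) n)) (P-≈-* s m n) ≈-refl))
    where
    alg : ∀ m q n → m ℕ.+ q ℕ.* n ℕ.+ q ≡ m ℕ.+ q ℕ.* suc n
    alg = ℕSolver.solve-∀
    alg₂ : ∀ a b c → a * b * c ≡ a * (c * b)
    alg₂ = solve-∀ ℚ-ring

  ω : ℕ → ℚ
  ω s = ⟦ P (p ℕ.^ s) ⟧

  u-≈ : ∀ s v m n → ⟦ u v (m ℕ.+ p ℕ.^ s ℕ.* n) ⟧ ≈[ suc s ] ⟦ u v m ⟧ * powℚ (ω s) n
  u-≈ s v m n = subst₂ (_≈[ suc s ]_) (sym (⟦⟧-* (P m′) (rising (p ℕ.* m′) v)))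
      (trans (alg ⟦ P m ⟧ (powℚ (ω s) n) ⟦ rising (p ℕ.* m) v ⟧) (cong (_* powℚ (ω s) n) (sym (⟦⟧-* (P m) (rising (p ℕ.* m) v)))))
      (≈-* (Int-⟦⟧ _) (Int-* (Int-⟦⟧ _) (Int-powℚ (Int-⟦⟧ _) n)) (P-≈-* s m n) (rising-p-≈ s m n v))
    where
    m′ = m ℕ.+ p ℕ.^ s ℕ.* n
    alg : ∀ a b c → a * b * c ≡ a * c * b
    alg = solve-∀ ℚ-ring

  -- Divide `u-≈` by both values of `u`. The power of `ω` stays on the left, so that it is never
  -- inverted; the numerator supplies it later.
  inv-u-≈ : ∀ s {v} m n → v ℕ.< p → inv (u v (m ℕ.+ p ℕ.^ s ℕ.* n)) * powℚ (ω s) n ≈[ suc s ] inv (u v m)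
  inv-u-≈ s {v} m n v<p = mk≈ (subst (Div (suc s)) eq
      (Div-*ˡ (Int-neg (Int-* (Int-inv (p∤u m′ v<p)) (Int-inv (p∤u m v<p)))) (≈⇒Div (u-≈ s v m n))))
    where
    open ≡-Reasoning
    m′ = m ℕ.+ p ℕ.^ s ℕ.* n
    I′ = inv (u v m′)
    I  = inv (u v m)
    W  = powℚ (ω s) n
    alg : ∀ i j x y w → - (i * j) * (x - y * w) ≡ (y * j) * (i * w) - (x * i) * j
    alg = solve-∀ ℚ-ring
    alg₂ : ∀ i j w → 1ℚ * (i * w) - 1ℚ * j ≡ i * w - j
    alg₂ = solve-∀ ℚ-ring
    eq : - (I′ * I) * (⟦ u v m′ ⟧ - ⟦ u v m ⟧ * W) ≡ I′ * W - I
    eq = begin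
      - (I′ * I) * (⟦ u v m′ ⟧ - ⟦ u v m ⟧ * W)       ≡⟨ alg I′ I ⟦ u v m′ ⟧ ⟦ u v m ⟧ W ⟩
      ⟦ u v m ⟧ * I * (I′ * W) - ⟦ u v m′ ⟧ * I′ * I  ≡⟨ cong₂ (λ s t → s * (I′ * W) - t * I) (inv-* (u v m) {{∤⇒≢0 (p∤u m v<p)}}) (inv-* (u v m′) {{∤⇒≢0 (p∤u m′ v<p)}}) ⟩
      1ℚ * (I′ * W) - 1ℚ * I                          ≡⟨ alg₂ I′ I W ⟩
      I′ * W - I                                      ∎

  invU : Vec ℕ d → MultiIndex d → MultiIndex d → ℚ
  invU []       []       []       = 1ℚ
  invU (v ∷ vs) (a ∷ as) (k ∷ ks) = powℚ (inv (u a k)) v * invU vs as ks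

  invU-int : (v : Vec ℕ d) {a : MultiIndex d} → Digits a → ∀ k → Int (invU v a k)
  invU-int []       []         []       = Int-1
  invU-int (v ∷ vs) (a<p ∷ da) (k ∷ ks) = Int-* (Int-powℚ (Int-inv (p∤u k a<p)) v) (invU-int vs da ks)

  invFact-⊹ : ∀ {a} k → a ℕ.< p → invFact (a ℕ.+ p ℕ.* k) * powℚ ⟦ p ⟧ k ≡ invFact k * inv (u a k)
  invFact-⊹ {a} k a<p = begin
    invFact (a ℕ.+ p ℕ.* k) * powℚ ⟦ p ⟧ k
      ≡⟨ cong₂ _*_ (trans (invFact-inv (a ℕ.+ p ℕ.* k)) (cong inv (!-u a k))) (sym (⟦^⟧ p k)) ⟩
    inv (p ℕ.^ k ℕ.* k ! ℕ.* u a k) * ⟦ p ℕ.^ k ⟧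
      ≡⟨ cong (_* ⟦ p ℕ.^ k ⟧) (trans (inv-homo (p ℕ.^ k ℕ.* k !) (u a k)) (cong (_* inv (u a k)) (inv-homo (p ℕ.^ k) (k !)))) ⟩
    inv (p ℕ.^ k) * inv (k !) * inv (u a k) * ⟦ p ℕ.^ k ⟧
      ≡⟨ alg (inv (p ℕ.^ k)) (inv (k !)) (inv (u a k)) ⟦ p ℕ.^ k ⟧ ⟩
    ⟦ p ℕ.^ k ⟧ * inv (p ℕ.^ k) * (inv (k !) * inv (u a k))
      ≡⟨ cong₂ (λ s t → s * (t * inv (u a k))) (inv-* (p ℕ.^ k)) (sym (invFact-inv k)) ⟩
    1ℚ * (invFact k * inv (u a k))
      ≡⟨ *-identityˡ _ ⟩
    invFact k * inv (u a k) ∎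
    where
    open ≡-Reasoning
    instance
      _ = ℕP.m^n≢0 p k
      _ = k ℕP.!≢0
      _ = ℕP.m*n≢0 (p ℕ.^ k) (k !) {{ℕP.m^n≢0 p k}} {{k ℕP.!≢0}}
      _ = ∤⇒≢0 (p∤u k a<p)
    alg : ∀ x y z t → x * y * z * t ≡ t * x * (y * z)
    alg = solve-∀ ℚ-ring

  -- The factors m_i!^(v_i) contain p^(v_i k_i) besides k_i!^(v_i) and units. Together this is
  -- p^(v·k), exactly the power released by the numerator (v·a + p v·k)!.
  invFactPow-⊹ : (v : Vec ℕ d) {a : MultiIndex d} → Digits a → ∀ k →
                 invFactPow v (a ⊹ k) * powℚ ⟦ p ⟧ (dot v k) ≡ invFactPow v k * invU v a k
  invFactPow-⊹ []       []                     []       = refl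
  invFactPow-⊹ (v ∷ vs) {a ∷ as} (a<p ∷ da) (k ∷ ks) = begin
    powℚ x v * X * powℚ ⟦ p ⟧ (v ℕ.* k ℕ.+ dot vs ks)
      ≡⟨ cong (powℚ x v * X *_) (trans (powℚ-+ ⟦ p ⟧ (v ℕ.* k) (dot vs ks)) (cong (_* powℚ ⟦ p ⟧ (dot vs ks)) (powℚ-* ⟦ p ⟧ v k))) ⟩
    powℚ x v * X * (powℚ (powℚ ⟦ p ⟧ k) v * powℚ ⟦ p ⟧ (dot vs ks))
      ≡⟨ *-interchange (powℚ x v) X (powℚ (powℚ ⟦ p ⟧ k) v) (powℚ ⟦ p ⟧ (dot vs ks)) ⟩
    powℚ x v * powℚ (powℚ ⟦ p ⟧ k) v * (X * powℚ ⟦ p ⟧ (dot vs ks))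
      ≡⟨ cong₂ _*_ (trans (sym (powℚ-distrib x (powℚ ⟦ p ⟧ k) v)) (trans (cong (λ t → powℚ t v) (invFact-⊹ k a<p)) (powℚ-distrib (invFact k) (inv (u a k)) v))) (invFactPow-⊹ vs da ks) ⟩
    powℚ (invFact k) v * powℚ (inv (u a k)) v * (invFactPow vs ks * invU vs as ks)
      ≡⟨ *-interchange (powℚ (invFact k) v) (powℚ (inv (u a k)) v) (invFactPow vs ks) (invU vs as ks) ⟩
    powℚ (invFact k) v * invFactPow vs ks * (powℚ (inv (u a k)) v * invU vs as ks) ∎
    where
    open ≡-Reasoning
    x = invFact (a ℕ.+ p ℕ.* k)
    X = invFactPow vs (as ⊹ ks)

  invU-≈ : ∀ s (v : Vec ℕ d) {a : MultiIndex d} → Digits a → ∀ k n →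
           invU v a (k ⊕ scale (p ℕ.^ s) n) * powℚ (ω s) (dot v n) ≈[ suc s ] invU v a k
  invU-≈ s []       []         []       []       = ≈-refl
  invU-≈ s (v ∷ vs) {a ∷ as} (a<p ∷ da) (k ∷ ks) (n ∷ ns) = subst (_≈[ suc s ] _) (sym eq)
    (≈-* (Int-* (invU-int vs da (ks ⊕ scale (p ℕ.^ s) ns)) (Int-powℚ (Int-⟦⟧ _) (dot vs ns))) (Int-powℚ (Int-inv (p∤u k a<p)) v)
         (≈-powℚ (Int-* (Int-inv (p∤u (k ℕ.+ p ℕ.^ s ℕ.* n) a<p)) (Int-powℚ (Int-⟦⟧ _) n)) (Int-inv (p∤u k a<p)) (inv-u-≈ s k n a<p) v)
         (invU-≈ s vs da ks ns))
    where
    open ≡-Reasoning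
    x = inv (u a (k ℕ.+ p ℕ.^ s ℕ.* n))
    X = invU vs as (ks ⊕ scale (p ℕ.^ s) ns)
    W = powℚ (ω s) (dot vs ns)
    eq : powℚ x v * X * powℚ (ω s) (v ℕ.* n ℕ.+ dot vs ns) ≡ powℚ (x * powℚ (ω s) n) v * (X * W)
    eq = begin
      powℚ x v * X * powℚ (ω s) (v ℕ.* n ℕ.+ dot vs ns)
        ≡⟨ cong (powℚ x v * X *_) (trans (powℚ-+ (ω s) (v ℕ.* n) (dot vs ns)) (cong (_* W) (powℚ-* (ω s) v n))) ⟩
      powℚ x v * X * (powℚ (powℚ (ω s) n) v * W)
        ≡⟨ *-interchange (powℚ x v) X (powℚ (powℚ (ω s) n) v) W ⟩
      powℚ x v * powℚ (powℚ (ω s) n) v * (X * W)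
        ≡⟨ cong (_* (X * W)) (powℚ-distrib x (powℚ (ω s) n) v) ⟨
      powℚ (x * powℚ (ω s) n) v * (X * W) ∎

  dot-⊹ : (v a k : Vec ℕ d) → dot v (a ⊹ k) ≡ dot v a ℕ.+ p ℕ.* dot v k
  dot-⊹ []      []      []      = sym (ℕP.*-zeroʳ p)
  dot-⊹ (v ∷ vs) (a ∷ as) (k ∷ ks) = trans (cong (v ℕ.* (a ℕ.+ p ℕ.* k) ℕ.+_) (dot-⊹ vs as ks)) (alg v a k p (dot vs as) (dot vs ks))
    where
    alg : ∀ v a k p s t → v ℕ.* (a ℕ.+ p ℕ.* k) ℕ.+ (s ℕ.+ p ℕ.* t) ≡ v ℕ.* a ℕ.+ s ℕ.+ p ℕ.* (v ℕ.* k ℕ.+ t)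
    alg = ℕSolver.solve-∀

  -- The multiplicative half of `DworkPair`: it passes to products, so it can be checked on one
  -- `factRatio` at a time. The value at `𝟎` is the base case from which integrality follows.
  record Dwork {d} (B : MultiIndex d → ℚ) : Set where
    field
      Y     : MultiIndex d → MultiIndex d → ℚ
      Y-lip : ∀ {a} → Digits a → Lip 1 (Y a)
      B-rec : ∀ {a} → Digits a → ∀ k → B (a ⊹ k) ≡ B k * Y a k
      B-𝟎   : B 𝟎 ≡ 1ℚ

  factRatio-Dwork : (v : Vec ℕ d) → Dwork (factRatio v)
  factRatio-Dwork v = record
    { Y = λ a k → ⟦ u (dot v a) (dot v k) ⟧ * invU v a k
    ; Y-lip = λ {a} da → record
      { int = λ k → Int-* (Int-⟦⟧ _) (invU-int v da k)
      ; lip = λ s k n → lipschitz da s k n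
      }
    ; B-rec = rec
    ; B-𝟎 = factRatio-𝟎 v
    }
    where
    lipschitz : ∀ {a} → Digits a → ∀ s k n →
      ⟦ u (dot v a) (dot v (k ⊕ scale (p ℕ.^ s) n)) ⟧ * invU v a (k ⊕ scale (p ℕ.^ s) n)
      ≈[ suc s ] ⟦ u (dot v a) (dot v k) ⟧ * invU v a k
    lipschitz {a} da s k n = ≈-trans
      (≈-* (invU-int v da k′) (Int-* (Int-⟦⟧ (u (dot v a) (dot v k))) (Int-powℚ (Int-⟦⟧ _) (dot v n)))
        (subst (λ t → ⟦ u (dot v a) t ⟧ ≈[ suc s ] U * W) (sym (dot-⊕-scale v k n (p ℕ.^ s))) (u-≈ s (dot v a) (dot v k) (dot v n)))
        ≈-refl)
      (subst (_≈[ suc s ] U * invU v a k) (sym (alg U W (invU v a k′)))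
        (≈-* (Int-* (invU-int v da k′) (Int-powℚ (Int-⟦⟧ _) (dot v n))) (Int-⟦⟧ _) ≈-refl (invU-≈ s v da k n)))
      where
      k′ = k ⊕ scale (p ℕ.^ s) n
      U = ⟦ u (dot v a) (dot v k) ⟧
      W = powℚ (ω s) (dot v n)
      alg : ∀ u w i → u * w * i ≡ u * (i * w)
      alg = solve-∀ ℚ-ring
    rec : ∀ {a} → Digits a → ∀ k → factRatio v (a ⊹ k) ≡ factRatio v k * (⟦ u (dot v a) (dot v k) ⟧ * invU v a k)
    rec {a} da k = begin
      factRatio v (a ⊹ k)
        ≡⟨ factRatio-⟦⟧ v (a ⊹ k) ⟩
      ⟦ dot v (a ⊹ k) ! ⟧ * X
        ≡⟨ cong (_* X) (trans (cong (λ t → ⟦ t ! ⟧) (dot-⊹ v a k)) (⟦!-u⟧ (dot v a) (dot v k))) ⟩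
      powℚ ⟦ p ⟧ (dot v k) * ⟦ dot v k ! ⟧ * U * X
        ≡⟨ alg₁ (powℚ ⟦ p ⟧ (dot v k)) ⟦ dot v k ! ⟧ U X ⟩
      ⟦ dot v k ! ⟧ * U * (X * powℚ ⟦ p ⟧ (dot v k))
        ≡⟨ cong (⟦ dot v k ! ⟧ * U *_) (invFactPow-⊹ v da k) ⟩
      ⟦ dot v k ! ⟧ * U * (invFactPow v k * invU v a k)
        ≡⟨ *-interchange ⟦ dot v k ! ⟧ U (invFactPow v k) (invU v a k) ⟩
      ⟦ dot v k ! ⟧ * invFactPow v k * (U * invU v a k)
        ≡⟨ cong (_* (U * invU v a k)) (factRatio-⟦⟧ v k) ⟨
      factRatio v k * (U * invU v a k) ∎
      where
      open ≡-Reasoning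
      X = invFactPow v (a ⊹ k)
      U = ⟦ u (dot v a) (dot v k) ⟧
      alg₁ : ∀ q f u x → q * f * u * x ≡ f * u * (x * q)
      alg₁ = solve-∀ ℚ-ring

  Dwork-* : {B B′ : MultiIndex d → ℚ} → Dwork B → Dwork B′ → Dwork (λ m → B m * B′ m)
  Dwork-* {B = B} {B′} D D′ = record
    { Y = λ a k → W.Y a k * W′.Y a k
    ; Y-lip = λ da → Lip-* (W.Y-lip da) (W′.Y-lip da)
    ; B-rec = λ {a} da k → trans (cong₂ _*_ (W.B-rec da k) (W′.B-rec da k)) (*-interchange (B k) (W.Y a k) (B′ k) (W′.Y a k))
    ; B-𝟎 = trans (cong₂ _*_ W.B-𝟎 W′.B-𝟎) (*-identityˡ 1ℚ)
    }
    where
    module W = Dwork D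
    module W′ = Dwork D′

  Dwork-1 : Dwork {d} (λ _ → 1ℚ)
  Dwork-1 = record { Y = λ _ _ → 1ℚ ; Y-lip = λ _ → Lip-const Int-1 ; B-rec = λ _ _ → sym (*-identityˡ 1ℚ) ; B-𝟎 = refl }

  prodℚ-Dwork : {I : Set} (N : I → Vec ℕ d) (js : List I) → Dwork (λ m → prodℚ (List.map (λ j → factRatio (N j) m) js))
  prodℚ-Dwork N []       = Dwork-1
  prodℚ-Dwork N (j ∷ js) = Dwork-* (factRatio-Dwork (N j)) (prodℚ-Dwork N js)

-- Integrality of the coefficients and the harmonic differences.

harmonic-suc : ∀ n → harmonic (suc n) ≡ harmonic n + inv (suc n)
harmonic-suc n = cong (harmonic n +_) (sym (inv-def (suc n)))

module Coefficients (p : ℕ) (isPrime : Prime p) where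
  open Local p isPrime
  open Residues p
  open Lipschitz p isPrime
  open Factorials p isPrime

  _mod _div : MultiIndex d → MultiIndex d
  _mod = Vec.map (_% p)
  _div = Vec.map (ℕ._/ p)

  mod⊹div : (m : MultiIndex d) → m mod ⊹ m div ≡ m
  mod⊹div []      = refl
  mod⊹div (x ∷ m) = cong₂ _∷_ (trans (cong (x % p ℕ.+_) (ℕP.*-comm p (x ℕ./ p))) (sym (m≡m%n+[m/n]*n x p))) (mod⊹div m)

  mod-digits : (m : MultiIndex d) → Digits (m mod)
  mod-digits []      = []
  mod-digits (x ∷ m) = m%n<n x p ∷ mod-digits m

  ⊹-div : {a : MultiIndex d} → Digits a → ∀ k → (a ⊹ k) div ≡ k
  ⊹-div []                   []       = refl
  ⊹-div {a = a ∷ _} (a<p ∷ da) (k ∷ ks) = cong₂ _∷_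
    (trans (+-distrib-/-∣ʳ a (ℕD.m∣m*n k))
           (cong₂ ℕ._+_ (m<n⇒m/n≡0 a<p) (trans (cong (ℕ._/ p) (ℕP.*-comm p k)) (m*n/n≡m k p))))
    (⊹-div da ks)

  p∣div∣≤ : (m : MultiIndex d) → p ℕ.* ∣ m div ∣ₘ ℕ.≤ ∣ m ∣ₘ
  p∣div∣≤ []      = ℕP.≤-reflexive (ℕP.*-zeroʳ p)
  p∣div∣≤ (x ∷ m) = subst (ℕ._≤ x ℕ.+ ∣ m ∣ₘ) (sym (ℕP.*-distribˡ-+ p (x ℕ./ p) ∣ m div ∣ₘ))
    (ℕP.+-mono-≤ (subst (p ℕ.* (x ℕ./ p) ℕ.≤_) (sym (trans (m≡m%n+[m/n]*n x p) (cong (x % p ℕ.+_) (ℕP.*-comm (x ℕ./ p) p)))) (ℕP.m≤n+m _ (x % p)))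
                 (p∣div∣≤ m))

  ∣∣≡0⇒𝟎 : (m : MultiIndex d) → ∣ m ∣ₘ ≡ 0 → m ≡ 𝟎
  ∣∣≡0⇒𝟎 []      e = refl
  ∣∣≡0⇒𝟎 (x ∷ m) e = cong₂ _∷_ (ℕP.m+n≡0⇒m≡0 x e) (∣∣≡0⇒𝟎 m (ℕP.m+n≡0⇒n≡0 x e))

  -- Removing base-p digits one after the other writes `B m` as a product of integral values of `Y`
  -- and of B 𝟎 = 1.
  Dwork⇒Int : {B : MultiIndex d → ℚ} → Dwork B → ∀ m → Int (B m)
  Dwork⇒Int {d} {B} D m = go ∣ m ∣ₘ m ℕP.≤-refl
    where
    open Dwork D
    go : ∀ n m → ∣ m ∣ₘ ℕ.≤ n → Int (B m)
    go zero    m le = subst Int (sym (trans (cong B (∣∣≡0⇒𝟎 m (ℕP.n≤0⇒n≡0 le))) B-𝟎)) Int-1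
    go (suc n) m le = subst (λ t → Int (B t)) (mod⊹div m) (subst Int (sym (B-rec (mod-digits m) (m div)))
      (Int-* (go n (m div) (p*x≤1+n⇒x≤n ∣ m div ∣ₘ (ℕP.≤-trans (p∣div∣≤ m) le))) (Lip.int (Y-lip (mod-digits m)) (m div))))

  multinomial-int : (N M : Vec ℕ d) {n : ℕ} → dot N M ℕ.≤ n → Int (⟦ n ! ⟧ * invFactPow N M)
  multinomial-int N M {n} le = subst Int (sym eq) (Int-* (Dwork⇒Int (factRatio-Dwork N) M) (Int-⟦⟧ (rising (dot N M) (n ∸ dot N M))))
    where
    open ≡-Reasoning
    r = rising (dot N M) (n ∸ dot N M)
    alg : ∀ a b c → a * b * c ≡ a * c * b
    alg = solve-∀ ℚ-ring
    eq : ⟦ n ! ⟧ * invFactPow N M ≡ factRatio N M * ⟦ r ⟧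
    eq = begin
      ⟦ n ! ⟧ * invFactPow N M                    ≡⟨ cong (λ t → ⟦ t ! ⟧ * invFactPow N M) (ℕP.m+[n∸m]≡n le) ⟨
      ⟦ (dot N M ℕ.+ (n ∸ dot N M)) ! ⟧ * invFactPow N M ≡⟨ cong (_* invFactPow N M) (trans (cong ⟦_⟧ (!-rising (dot N M) (n ∸ dot N M))) (⟦⟧-* (dot N M !) r)) ⟩
      ⟦ dot N M ! ⟧ * ⟦ r ⟧ * invFactPow N M      ≡⟨ alg ⟦ dot N M ! ⟧ ⟦ r ⟧ (invFactPow N M) ⟩
      ⟦ dot N M ! ⟧ * invFactPow N M * ⟦ r ⟧      ≡⟨ cong (_* ⟦ r ⟧) (factRatio-⟦⟧ N M) ⟨
      factRatio N M * ⟦ r ⟧                       ∎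

  dot-div : (v m : Vec ℕ d) → dot v m ≡ dot v (m mod) ℕ.+ p ℕ.* dot v (m div)
  dot-div v m = trans (cong (dot v) (sym (mod⊹div m))) (dot-⊹ v (m mod) (m div))

  harmonic-range : ∀ x e y → (∀ j → x ℕ.< j → j ℕ.≤ x ℕ.+ e → Int (y * inv j)) → Int (y * (harmonic (x ℕ.+ e) - harmonic x))
  harmonic-range x zero    y y/j = subst Int (sym (trans (cong (λ t → y * (harmonic t - harmonic x)) (ℕP.+-identityʳ x)) (trans (cong (y *_) (+-inverseʳ (harmonic x))) (*-zeroʳ y)))) Int-0
  harmonic-range x (suc e) y y/j = subst Int (sym eq) (Int-+
      (harmonic-range x e y (λ j lo hi → y/j j lo (ℕP.≤-trans hi (ℕP.+-monoʳ-≤ x (ℕP.n≤1+n e)))))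
      (y/j (suc (x ℕ.+ e)) (s≤s (ℕP.m≤m+n x e)) (ℕP.≤-reflexive (sym (ℕP.+-suc x e)))))
    where
    alg : ∀ y h i k → y * (h + i - k) ≡ y * (h - k) + y * i
    alg = solve-∀ ℚ-ring
    eq : y * (harmonic (x ℕ.+ suc e) - harmonic x) ≡ y * (harmonic (x ℕ.+ e) - harmonic x) + y * inv (suc (x ℕ.+ e))
    eq = trans (cong (λ t → y * (t - harmonic x)) (trans (cong harmonic (ℕP.+-suc x e)) (harmonic-suc (x ℕ.+ e))))
               (alg y (harmonic (x ℕ.+ e)) (inv (suc (x ℕ.+ e))) (harmonic x))

  -- The terms 1/(p i) of H_{pm} add up to H_m / p; every other term 1/j has j prime to p.
  harmonic-p* : ∀ m → Int (harmonic (p ℕ.* m) - inv p * harmonic m)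
  harmonic-p* zero    = subst Int (sym (trans (cong (λ t → harmonic t - inv p * 0ℚ) (ℕP.*-zeroʳ p)) (alg (inv p)))) Int-0
    where
    alg : ∀ i → 0ℚ - i * 0ℚ ≡ 0ℚ
    alg = solve-∀ ℚ-ring
  harmonic-p* (suc m) = subst Int (sym eq) (Int-+ (harmonic-p* m)
      (harmonic-range (p ℕ.* m) (ℕ.pred p) 1ℚ (λ j lo hi → Int-* Int-1 (Int-inv (p∤ j lo hi)))))
    where
    open ≡-Reasoning
    x = p ℕ.* m
    e = ℕ.pred p
    p∤ : ∀ j → x ℕ.< j → j ℕ.≤ x ℕ.+ e → p ∤ j
    -- A multiple c p in this range would give m < c < m + 1.
    p∤ j lo hi (divides c refl) = ℕP.<⇒≱ (ℕP.*-cancelˡ-< p m c (subst (x ℕ.<_) (ℕP.*-comm c p) lo))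
      (ℕP.≤-pred (ℕP.*-cancelˡ-< p c (suc m) (subst₂ ℕ._<_ (ℕP.*-comm c p) (trans (cong (x ℕ.+_) (ℕP.suc-pred p)) (trans (ℕP.+-comm x p) (sym (ℕP.*-suc p m))))
        (ℕP.≤-<-trans hi (ℕP.+-monoʳ-< x (ℕP.n<1+n e))))))
    p[1+m] : p ℕ.* suc m ≡ suc (x ℕ.+ e)
    p[1+m] = trans (ℕP.*-suc p m) (trans (ℕP.+-comm p x) (trans (cong (x ℕ.+_) (sym (ℕP.suc-pred p))) (ℕP.+-suc x e)))
    alg : ∀ a b i j h → a + i * j - i * (h + j) ≡ (b - i * h) + 1ℚ * (a - b)
    alg = solve-∀ ℚ-ring
    eq : harmonic (p ℕ.* suc m) - inv p * harmonic (suc m) ≡ (harmonic x - inv p * harmonic m) + 1ℚ * (harmonic (x ℕ.+ e) - harmonic x)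
    eq = begin
      harmonic (p ℕ.* suc m) - inv p * harmonic (suc m)
        ≡⟨ cong₂ (λ s t → s - inv p * t) (trans (cong harmonic p[1+m]) (harmonic-suc (x ℕ.+ e))) (harmonic-suc m) ⟩
      harmonic (x ℕ.+ e) + inv (suc (x ℕ.+ e)) - inv p * (harmonic m + inv (suc m))
        ≡⟨ cong (λ t → harmonic (x ℕ.+ e) + t - inv p * (harmonic m + inv (suc m))) (trans (cong inv (sym p[1+m])) (inv-homo p (suc m))) ⟩
      harmonic (x ℕ.+ e) + inv p * inv (suc m) - inv p * (harmonic m + inv (suc m))
        ≡⟨ alg (harmonic (x ℕ.+ e)) (harmonic x) (inv p) (inv (suc m)) (harmonic m) ⟩
      (harmonic x - inv p * harmonic m) + 1ℚ * (harmonic (x ℕ.+ e) - harmonic x) ∎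

  module _ (L N : Vec ℕ d) (L≤N : Pointwise ℕ._≤_ L N) where

    D : Vec ℕ d
    D = zipWith _∸_ N L

    -- Each factor p of J is matched by a carry: dividing n and M by p loses at least one factor p.
    multinomial/J-int : ∀ f J n M → J ℕ.≤ f → dot N M ℕ.≤ n → dot D M ℕ.+ J ℕ.≤ n → p ℕ.* dot L (M div) ℕ.< J →
                        Int (⟦ n ! ⟧ * invFactPow N M * inv J)
    multinomial/J-int zero    zero n M J≤f NM≤n DM+J≤n ()
    multinomial/J-int (suc f) J    n M J≤f NM≤n DM+J≤n Lk<J with p ∣? J
    ... | no p∤J = Int-* (multinomial-int N M NM≤n) (Int-inv p∤J)
    ... | yes (divides J₁ refl) = subst Int (sym eq)
      (Int-* (multinomial/J-int f J₁ n₁ k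
               (p*x≤1+n⇒x≤n J₁ (subst (ℕ._≤ suc f) (ℕP.*-comm J₁ p) J≤f))
               (ℕP.<⇒≤ Nk<n₁) Dk+J₁≤n₁
               (ℕP.≤-<-trans (subst (p ℕ.* dot L (k div) ℕ.≤_) (sym (dot-div L k)) (ℕP.m≤n+m _ (dot L (k mod)))) Lk<J₁))
             (Int-* (Int-* (Int-⟦⟧ (u n₀ n₁)) (invU-int N (mod-digits M) k)) (Int-powℚ (Int-⟦⟧ p) e)))
      where
      open ≡-Reasoning
      a = M mod
      k = M div
      n₀ = n % p
      n₁ = n ℕ./ p
      n≡ : n ≡ n₀ ℕ.+ p ℕ.* n₁
      n≡ = trans (m≡m%n+[m/n]*n n p) (cong (n₀ ℕ.+_) (ℕP.*-comm n₁ p))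
      Lk<J₁ : dot L k ℕ.< J₁
      Lk<J₁ = ℕP.*-cancelˡ-< p (dot L k) J₁ (subst (p ℕ.* dot L k ℕ.<_) (ℕP.*-comm J₁ p) Lk<J)
      Dk+J₁≤n₁ : dot D k ℕ.+ J₁ ℕ.≤ n₁
      Dk+J₁≤n₁ = subst (ℕ._≤ n₁) (m*n/n≡m (dot D k ℕ.+ J₁) p) (/-mono-≤ {o = p} (ℕP.≤-trans
        (subst₂ ℕ._≤_ (alg₀ p (dot D k) J₁) (cong (ℕ._+ J₁ ℕ.* p) (sym (dot-div D M))) (ℕP.+-monoˡ-≤ (J₁ ℕ.* p) (ℕP.m≤n+m (p ℕ.* dot D k) (dot D a)))) DM+J≤n) ℕP.≤-refl)
        where
        alg₀ : ∀ p x j → p ℕ.* x ℕ.+ j ℕ.* p ≡ (x ℕ.+ j) ℕ.* p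
        alg₀ = ℕSolver.solve-∀
      -- N·k = D·k + L·k < D·k + J₁ ≤ n₁; the first equality is where L ≤ N enters. Strictness is
      -- the gain: n! contains p^(n₁), the denominators use only p^(N·k), and one more p is left to
      -- cancel the factor p of J = J₁ p.
      Nk<n₁ : suc (dot N k) ℕ.≤ n₁
      Nk<n₁ = ℕP.≤-trans (subst₂ ℕ._≤_ (trans (ℕP.+-suc (dot D k) (dot L k)) (cong suc (sym (dot-∸ L N k L≤N)))) refl (ℕP.+-monoʳ-≤ (dot D k) Lk<J₁)) Dk+J₁≤n₁
      e = n₁ ∸ suc (dot N k)
      X = invFactPow N M
      Q = powℚ ⟦ p ⟧ (dot N k)
      Q′ = powℚ ⟦ p ⟧ e
      U = ⟦ u n₀ n₁ ⟧
      J₁≢0 : NonZero J₁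
      J₁≢0 = ℕ.>-nonZero (ℕP.≤-trans (s≤s z≤n) Lk<J₁)
      alg : ∀ P q q′ f U X j i → P * q * q′ * f * U * X * (j * i) ≡ f * U * q′ * j * (X * q) * (P * i)
      alg = solve-∀ ℚ-ring
      alg₂ : ∀ f U q′ j Z V → f * U * q′ * j * (Z * V) * 1ℚ ≡ f * Z * j * (U * V * q′)
      alg₂ = solve-∀ ℚ-ring
      eq : ⟦ n ! ⟧ * X * inv (J₁ ℕ.* p) ≡ ⟦ n₁ ! ⟧ * invFactPow N k * inv J₁ * (U * invU N a k * Q′)
      eq = begin
        ⟦ n ! ⟧ * X * inv (J₁ ℕ.* p)
          ≡⟨ cong₂ (λ s t → s * X * t) (trans (cong (λ t → ⟦ t ! ⟧) n≡) (⟦!-u⟧ n₀ n₁)) (inv-homo J₁ p {{J₁≢0}}) ⟩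
        powℚ ⟦ p ⟧ n₁ * ⟦ n₁ ! ⟧ * U * X * (inv J₁ * inv p)
          ≡⟨ cong (λ t → t * ⟦ n₁ ! ⟧ * U * X * (inv J₁ * inv p)) (trans (cong (powℚ ⟦ p ⟧) (sym (ℕP.m+[n∸m]≡n Nk<n₁))) (powℚ-+ ⟦ p ⟧ (suc (dot N k)) e)) ⟩
        ⟦ p ⟧ * Q * Q′ * ⟦ n₁ ! ⟧ * U * X * (inv J₁ * inv p)
          ≡⟨ alg ⟦ p ⟧ Q Q′ ⟦ n₁ ! ⟧ U X (inv J₁) (inv p) ⟩
        ⟦ n₁ ! ⟧ * U * Q′ * inv J₁ * (X * Q) * (⟦ p ⟧ * inv p)
          ≡⟨ cong₂ (λ s t → ⟦ n₁ ! ⟧ * U * Q′ * inv J₁ * s * t) (trans (cong (λ t → invFactPow N t * Q) (sym (mod⊹div M))) (invFactPow-⊹ N (mod-digits M) k)) p*inv-p ⟩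
        ⟦ n₁ ! ⟧ * U * Q′ * inv J₁ * (invFactPow N k * invU N a k) * 1ℚ
          ≡⟨ alg₂ ⟦ n₁ ! ⟧ U Q′ (inv J₁) (invFactPow N k) (invU N a k) ⟩
        ⟦ n₁ ! ⟧ * invFactPow N k * inv J₁ * (U * invU N a k * Q′) ∎

    -- The case n = N·m with m = a ⊹ k, where j ≤ L·m turns into D·m + j ≤ N·m. The general lemma
    -- leaves n free because after one division by p the new n already exceeds N·(m div p).
    factRatio/j-int : ∀ {a} → Digits a → ∀ k j → p ℕ.* dot L k ℕ.< j → j ℕ.≤ dot L (a ⊹ k) → Int (factRatio N (a ⊹ k) * inv j)
    factRatio/j-int {a} da k j lo hi = subst (λ t → Int (t * inv j)) (sym (factRatio-⟦⟧ N (a ⊹ k)))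
      (multinomial/J-int j j (dot N (a ⊹ k)) (a ⊹ k) ℕP.≤-refl ℕP.≤-refl
        (subst (dot D (a ⊹ k) ℕ.+ j ℕ.≤_) (sym (dot-∸ L N (a ⊹ k) L≤N)) (ℕP.+-monoʳ-≤ (dot D (a ⊹ k)) hi))
        (subst (λ t → p ℕ.* dot L t ℕ.< j) (sym (⊹-div da k)) lo))

    -- Insert H at p L·k. Below this point `harmonic-p*` compares with H_{L·k} / p; above it the
    -- terms 1/j are treated one by one, each multiplied by the factorial ratio.
    factRatio-H-rec : ∀ {a} → Digits a → ∀ k → Int (factRatio N (a ⊹ k) * (harmonic (dot L (a ⊹ k)) - inv p * harmonic (dot L k)))
    factRatio-H-rec {a} da k = subst Int (sym (alg y (harmonic (dot L (a ⊹ k))) (harmonic (p ℕ.* dot L k)) (inv p * harmonic (dot L k))))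
      (Int-+ (subst (λ t → Int (y * (harmonic t - harmonic (p ℕ.* dot L k)))) (sym La+pLk)
               (harmonic-range (p ℕ.* dot L k) (dot L a) y (λ j lo hi → factRatio/j-int da k j lo (subst (j ℕ.≤_) (sym La+pLk) hi))))
             (Int-* (Dwork⇒Int (factRatio-Dwork N) (a ⊹ k)) (harmonic-p* (dot L k))))
      where
      y = factRatio N (a ⊹ k)
      La+pLk : dot L (a ⊹ k) ≡ p ℕ.* dot L k ℕ.+ dot L a
      La+pLk = trans (dot-⊹ L a k) (ℕP.+-comm (dot L a) (p ℕ.* dot L k))
      alg : ∀ y h g i → y * (h - i) ≡ y * (h - g) + y * (g - i)
      alg = solve-∀ ℚ-ring

  coeffA-DworkPair : ∀ {d k} (k>0 : 0 ℕ.< k) (L : Vec ℕ d) (N : Fin k → Vec ℕ d) → Pointwise ℕ._≤_ L (N (fromℕ< k>0)) →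
                     DworkPair (coeffA N) (λ m → harmonic (dot L m))
  coeffA-DworkPair {d} {suc k} (s≤s _) L N L≤N = record
    { Y = Dwork.Y W
    ; Y-lip = Dwork.Y-lip W
    ; B-rec = Dwork.B-rec W
    ; B-int = Dwork⇒Int W
    -- The first factor, the one bounded below by `L`, absorbs the harmonic difference; the others
    -- contribute an integral multiplier.
    ; H-rec = λ {a} da m → subst Int (alg (factRatio (N Fin.zero) (a ⊹ m)) (rest (a ⊹ m)) (harmonic (dot L (a ⊹ m)) - inv p * harmonic (dot L m)))
        (Int-* (Dwork⇒Int W₁ (a ⊹ m)) (factRatio-H-rec L (N Fin.zero) L≤N da m))
    }
    where
    js = List.tabulate {n = k} Fin.suc
    rest : MultiIndex d → ℚ
    rest m = prodℚ (List.map (λ j → factRatio (N j) m) js)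
    W₁ : Dwork rest
    W₁ = prodℚ-Dwork N js
    W : Dwork (coeffA N)
    W = Dwork-* (factRatio-Dwork (N Fin.zero)) W₁
    alg : ∀ x y z → y * (x * z) ≡ x * y * z
    alg = solve-∀ ℚ-ring

  coeffA-𝟎 : ∀ {d k} (N : Fin k → Vec ℕ d) → coeffA N 𝟎 ≡ 1ℚ
  coeffA-𝟎 {k = k} N = Dwork.B-𝟎 (prodℚ-Dwork N (List.allFin k))

-- Inverse and exponential through truncated sums.

module R {d} = CommutativeRing (powerSeriesRing d)
open module Powers {d} = Exp (R.semiring {d}) using (_^_) public
module ≈ₚ-Reasoning {d} = SetoidReasoning (R.setoid {d})

𝟎-or-+ : (m : MultiIndex d) → m ≡ 𝟎 ⊎ 0 ℕ.< ∣ m ∣ₘ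
𝟎-or-+ []          = inj₁ refl
𝟎-or-+ (suc x ∷ m) = inj₂ (s≤s z≤n)
𝟎-or-+ (zero ∷ m) with 𝟎-or-+ m
... | inj₁ refl = inj₁ refl
... | inj₂ pos  = inj₂ pos

const : ℚ → PowerSeries d
const c m = c * oneₚ m

const-⊛-at : ∀ c (f : PowerSeries d) m → (const c ⊛ f) m ≡ c * f m
const-⊛-at c f m = begin
  (const c ⊛ f) m                        ≡⟨ ⊛-at (const c) f m ⟩
  conv m (λ a b → c * oneₚ a * f b)      ≡⟨ conv-cong′ m (λ a b → *-assoc c (oneₚ a) (f b)) ⟩
  conv m (λ a b → c * (oneₚ a * f b))    ≡⟨ conv-*ˡ m c _ ⟩
  c * conv m (λ a b → oneₚ a * f b)      ≡⟨ cong (c *_) (⊛-at oneₚ f m) ⟨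
  c * (oneₚ ⊛ f) m                       ≡⟨ cong (c *_) (at (R.*-identityˡ f) m) ⟩
  c * f m                                ∎
  where open ≡-Reasoning

⊛-local : (m : MultiIndex d) {f f′ : PowerSeries d} (g : PowerSeries d) →
          (∀ a → ∣ a ∣ₘ ℕ.≤ ∣ m ∣ₘ → f a ≡ f′ a) → (f ⊛ g) m ≡ (f′ ⊛ g) m
⊛-local m {f} {f′} g f≗f′ = begin
  (f ⊛ g) m                     ≡⟨ ⊛-at f g m ⟩
  conv m (λ a b → f a * g b)    ≡⟨ conv-cong m (λ a b e → cong (_* g b) (f≗f′ a (subst (λ t → ∣ a ∣ₘ ℕ.≤ ∣ t ∣ₘ) e (subst (∣ a ∣ₘ ℕ.≤_) (sym (∣⊕∣ a b)) (ℕP.m≤m+n ∣ a ∣ₘ ∣ b ∣ₘ))))) ⟩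
  conv m (λ a b → f′ a * g b)   ≡⟨ ⊛-at f′ g m ⟨
  (f′ ⊛ g) m                    ∎
  where open ≡-Reasoning

⊛-𝟎 : (f g : PowerSeries d) → (f ⊛ g) 𝟎 ≡ f 𝟎 * g 𝟎
⊛-𝟎 {d} f g = trans (⊛-at f g 𝟎) (conv-last (𝟎 {d}) (λ a b → f a * g b) λ a b e pos →
  ⊥-elim (ℕP.<⇒≱ pos (ℕP.≤-trans (ℕP.m≤n+m ∣ b ∣ₘ ∣ a ∣ₘ) (ℕP.≤-reflexive (trans (sym (∣⊕∣ a b)) (trans (cong ∣_∣ₘ e) (∣𝟎∣ d)))))))

^-𝟎 : (f : PowerSeries d) → f 𝟎 ≡ 1ℚ → ∀ n → (f ^ n) 𝟎 ≡ 1ℚ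
^-𝟎 {d} f f0 zero    = oneₚ-𝟎 d
^-𝟎 {d} f f0 (suc n) = trans (⊛-𝟎 f (f ^ n)) (trans (cong₂ _*_ f0 (^-𝟎 f f0 n)) (*-identityˡ 1ℚ))

^-order : (h : PowerSeries d) → h 𝟎 ≡ 0ℚ → ∀ n m → ∣ m ∣ₘ ℕ.< n → (h ^ n) m ≡ 0ℚ
^-order h h0 (suc n) m (s≤s ∣m∣≤n) = trans (⊛-at h (h ^ n) m) (conv-zero m term)
  where
  term : ∀ a b → a ⊕ b ≡ m → h a * (h ^ n) b ≡ 0ℚ
  term a b e with 𝟎-or-+ a
  ... | inj₁ refl = trans (cong (_* (h ^ n) b) h0) (*-zeroˡ ((h ^ n) b))
  ... | inj₂ pos  = trans (cong (h a *_) (^-order h h0 n b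
    (ℕP.≤-trans (subst (∣ b ∣ₘ ℕ.<_) (trans (ℕP.+-comm ∣ b ∣ₘ ∣ a ∣ₘ) (trans (sym (∣⊕∣ a b)) (cong ∣_∣ₘ e))) (ℕP.m<m+n ∣ b ∣ₘ pos)) ∣m∣≤n))) (*-zeroʳ (h a))

-- A truncation at a fixed order, hence a polynomial in `h` to which ring laws apply. In `expₚ` and
-- `invₚ` the order ∣ m ∣ₘ varies with the coefficient; `psum-stable` mediates.
psum : (ℕ → ℚ) → PowerSeries d → ℕ → PowerSeries d
psum c h zero    = const (c 0) ⊛ h ^ 0
psum c h (suc n) = psum c h n ⊞ const (c (suc n)) ⊛ h ^ suc n

psum-stable : ∀ c (h : PowerSeries d) → h 𝟎 ≡ 0ℚ → ∀ m N → ∣ m ∣ₘ ℕ.≤ N → psum c h N m ≡ psum c h ∣ m ∣ₘ m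
psum-stable c h h0 m N le = trans (cong (λ t → psum c h t m) (sym (trans (ℕP.+-comm e ∣ m ∣ₘ) (ℕP.m+[n∸m]≡n le)))) (go e)
  where
  open ≡-Reasoning
  e = N ∸ ∣ m ∣ₘ
  go : ∀ e → psum c h (e ℕ.+ ∣ m ∣ₘ) m ≡ psum c h ∣ m ∣ₘ m
  go zero    = refl
  go (suc e) = begin
    psum c h (suc e ℕ.+ ∣ m ∣ₘ) m
      ≡⟨ ⊞-at (psum c h (e ℕ.+ ∣ m ∣ₘ)) _ m ⟩
    psum c h (e ℕ.+ ∣ m ∣ₘ) m + (const (c n) ⊛ h ^ n) m
      ≡⟨ cong₂ _+_ (go e) (trans (const-⊛-at (c n) (h ^ n) m) (trans (cong (c n *_) (^-order h h0 n m (s≤s (ℕP.m≤n+m ∣ m ∣ₘ e)))) (*-zeroʳ (c n)))) ⟩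
    psum c h ∣ m ∣ₘ m + 0ℚ
      ≡⟨ +-identityʳ _ ⟩
    psum c h ∣ m ∣ₘ m ∎
    where n = suc e ℕ.+ ∣ m ∣ₘ

sumTo-suc : ∀ N (f : ℕ → ℚ) → sumTo (suc N) f ≡ sumTo N f + f (suc N)
sumTo-suc N f = begin
  sumℚ (List.map f (upTo (suc (suc N))))                      ≡⟨ cong (λ t → sumℚ (List.map f t)) (ListP.applyUpTo-∷ʳ (λ i → i) (suc N)) ⟨
  sumℚ (List.map f (upTo (suc N) ++ suc N ∷ []))              ≡⟨ cong sumℚ (ListP.map-++ f (upTo (suc N)) (suc N ∷ [])) ⟩
  sumℚ (List.map f (upTo (suc N)) ++ f (suc N) ∷ [])          ≡⟨ sumℚ-++ (List.map f (upTo (suc N))) (f (suc N) ∷ []) ⟩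
  sumTo N f + (f (suc N) + 0ℚ)                                ≡⟨ cong (sumTo N f +_) (+-identityʳ (f (suc N))) ⟩
  sumTo N f + f (suc N)                                       ∎
  where open ≡-Reasoning

sumTo-psum : ∀ c (h : PowerSeries d) m N {f : ℕ → ℚ} → (∀ n → f n ≡ c n * (h ^ n) m) → sumTo N f ≡ psum c h N m
sumTo-psum c h m zero    {f} e = trans (+-identityʳ (f 0)) (trans (e 0) (sym (const-⊛-at (c 0) (h ^ 0) m)))
sumTo-psum c h m (suc N) {f} e = trans (sumTo-suc N f) (trans (cong₂ _+_ (sumTo-psum c h m N e) (trans (e (suc N)) (sym (const-⊛-at (c (suc N)) (h ^ suc N) m))))
                                      (sym (⊞-at (psum c h N) (const (c (suc N)) ⊛ h ^ suc N) m)))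

^ₚ-^ : (f : PowerSeries d) (n : ℕ) → f ^ₚ n ≈ₚ f ^ n
^ₚ-^ f zero    = ≈ₚ-refl
^ₚ-^ f (suc n) = subst (_≈ₚ f ⊛ f ^ n) (⊛-def f (f ^ₚ n)) (⊛-cong ≈ₚ-refl (^ₚ-^ f n))

expₚ-psum : (h : PowerSeries d) (m : MultiIndex d) → expₚ h m ≡ psum invFact h ∣ m ∣ₘ m
expₚ-psum h m = sumTo-psum invFact h m ∣ m ∣ₘ (λ n → trans (*-comm _ (invFact n)) (cong (invFact n *_) (at (^ₚ-^ h n) m)))

invₚ-psum : (f : PowerSeries d) (m : MultiIndex d) → invₚ f m ≡ psum (λ _ → 1ℚ) (oneₚ -ₚ f) ∣ m ∣ₘ m
invₚ-psum f m = sumTo-psum (λ _ → 1ℚ) (oneₚ -ₚ f) m ∣ m ∣ₘ (λ n → trans (at (^ₚ-^ (oneₚ -ₚ f) n) m) (sym (*-identityˡ _)))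

const-1 : const {d} 1ℚ ≈ₚ oneₚ
const-1 = mk≈ₚ (λ m → *-identityˡ (oneₚ m))

-- Telescoping geometric series: with g = 1 - f, the truncation times f plus g^(N+1) is 1, and
-- g^(N+1) has no terms of degree N or less.
⊛-invₚ : (f : PowerSeries d) → f 𝟎 ≡ 1ℚ → f ⊛ invₚ f ≈ₚ oneₚ
⊛-invₚ {d} f f0 = mk≈ₚ λ m → let N = ∣ m ∣ₘ in begin
  (f ⊛ invₚ f) m          ≡⟨ at (⊛-comm f (invₚ f)) m ⟩
  (invₚ f ⊛ f) m          ≡⟨ ⊛-local m f (λ a le → trans (invₚ-psum f a) (sym (psum-stable c g g0 a N le))) ⟩
  (psum c g N ⊛ f) m      ≡⟨ +-identityʳ _ ⟨
  (psum c g N ⊛ f) m + 0ℚ ≡⟨ cong ((psum c g N ⊛ f) m +_) (^-order g g0 (suc N) m ℕP.≤-refl) ⟨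
  (psum c g N ⊛ f) m + (g ^ suc N) m ≡⟨ ⊞-at (psum c g N ⊛ f) (g ^ suc N) m ⟨
  (psum c g N ⊛ f ⊞ g ^ suc N) m ≡⟨ at (telescope N) m ⟩
  oneₚ m                  ∎
  where
  open ≡-Reasoning
  c : ℕ → ℚ
  c _ = 1ℚ
  g : PowerSeries d
  g = oneₚ -ₚ f
  g0 : g 𝟎 ≡ 0ℚ
  g0 = trans (cong₂ _-_ (oneₚ-𝟎 d) f0) (+-inverseʳ 1ℚ)
  f⊞g : f ⊞ g ≈ₚ oneₚ
  f⊞g = mk≈ₚ (λ m → trans (⊞-at f g m) (alg (f m) (oneₚ m)))
    where
    alg : ∀ x y → x + (y - x) ≡ y
    alg = solve-∀ ℚ-ring
  c⊛ : ∀ h → const 1ℚ ⊛ h ≈ₚ h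
  c⊛ h = R.trans (⊛-cong const-1 ≈ₚ-refl) (R.*-identityˡ h)
  telescope : ∀ N → psum c g N ⊛ f ⊞ g ^ suc N ≈ₚ oneₚ
  telescope zero = R.trans (R.+-cong (R.trans (⊛-cong (c⊛ oneₚ) ≈ₚ-refl) (R.*-identityˡ f)) (R.*-identityʳ g)) f⊞g
  telescope (suc N) = S.begin
    (psum c g N ⊞ const 1ℚ ⊛ gᴺ) ⊛ f ⊞ g ⊛ gᴺ   S.≈⟨ R.+-cong (R.trans (R.distribʳ f (psum c g N) (const 1ℚ ⊛ gᴺ)) (R.+-congˡ (⊛-cong (c⊛ gᴺ) ≈ₚ-refl))) (⊛-comm g gᴺ) ⟩
    psum c g N ⊛ f ⊞ gᴺ ⊛ f ⊞ gᴺ ⊛ g            S.≈⟨ R.+-assoc (psum c g N ⊛ f) (gᴺ ⊛ f) (gᴺ ⊛ g) ⟩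
    psum c g N ⊛ f ⊞ (gᴺ ⊛ f ⊞ gᴺ ⊛ g)          S.≈⟨ R.+-congˡ (R.distribˡ gᴺ f g) ⟨
    psum c g N ⊛ f ⊞ gᴺ ⊛ (f ⊞ g)              S.≈⟨ R.+-congˡ (R.trans (⊛-cong ≈ₚ-refl f⊞g) (R.*-identityʳ gᴺ)) ⟩
    psum c g N ⊛ f ⊞ gᴺ                        S.≈⟨ telescope N ⟩
    oneₚ                                      S.∎
    where
    module S = ≈ₚ-Reasoning
    gᴺ = g ^ suc N

-- Differential equation of the exponential.

-- The Euler operator, the sum of z_i ∂/∂z_i. A single derivation serves any number of variables
-- because its kernel consists of the constants.
θ : PowerSeries d → PowerSeries d
θ f m = ⟦ ∣ m ∣ₘ ⟧ * f m

θ-cong : {f g : PowerSeries d} → f ≈ₚ g → θ f ≈ₚ θ g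
θ-cong e = mk≈ₚ (λ m → cong (⟦ ∣ m ∣ₘ ⟧ *_) (at e m))

θ-⊞ : (f g : PowerSeries d) → θ (f ⊞ g) ≈ₚ θ f ⊞ θ g
θ-⊞ f g = mk≈ₚ (λ m → trans (cong (⟦ ∣ m ∣ₘ ⟧ *_) (⊞-at f g m)) (trans (*-distribˡ-+ ⟦ ∣ m ∣ₘ ⟧ (f m) (g m)) (sym (⊞-at (θ f) (θ g) m))))

θ-const-⊛ : ∀ c (f : PowerSeries d) → θ (const c ⊛ f) ≈ₚ const c ⊛ θ f
θ-const-⊛ c f = mk≈ₚ (λ m → trans (cong (⟦ ∣ m ∣ₘ ⟧ *_) (const-⊛-at c f m)) (trans (alg ⟦ ∣ m ∣ₘ ⟧ c (f m)) (sym (const-⊛-at c (θ f) m))))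
  where
  alg : ∀ x y z → x * (y * z) ≡ y * (x * z)
  alg = solve-∀ ℚ-ring

θ-⊛ : (f g : PowerSeries d) → θ (f ⊛ g) ≈ₚ θ f ⊛ g ⊞ f ⊛ θ g
θ-⊛ f g = mk≈ₚ (λ m → begin
  ⟦ ∣ m ∣ₘ ⟧ * (f ⊛ g) m
    ≡⟨ cong (⟦ ∣ m ∣ₘ ⟧ *_) (⊛-at f g m) ⟩
  ⟦ ∣ m ∣ₘ ⟧ * conv m (λ a b → f a * g b)
    ≡⟨ conv-*ˡ m ⟦ ∣ m ∣ₘ ⟧ _ ⟨
  conv m (λ a b → ⟦ ∣ m ∣ₘ ⟧ * (f a * g b))
    ≡⟨ conv-cong m (λ a b e → trans (cong (λ t → t * (f a * g b)) (trans (cong (λ t → ⟦ ∣ t ∣ₘ ⟧) (sym e)) (trans (cong ⟦_⟧ (∣⊕∣ a b)) (⟦⟧-+ ∣ a ∣ₘ ∣ b ∣ₘ))))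
                                    (alg ⟦ ∣ a ∣ₘ ⟧ ⟦ ∣ b ∣ₘ ⟧ (f a) (g b))) ⟩
  conv m (λ a b → θ f a * g b + f a * θ g b)
    ≡⟨ conv-+ m _ _ ⟩
  conv m (λ a b → θ f a * g b) + conv m (λ a b → f a * θ g b)
    ≡⟨ cong₂ _+_ (⊛-at (θ f) g m) (⊛-at f (θ g) m) ⟨
  (θ f ⊛ g) m + (f ⊛ θ g) m
    ≡⟨ ⊞-at (θ f ⊛ g) (f ⊛ θ g) m ⟨
  (θ f ⊛ g ⊞ f ⊛ θ g) m ∎)
  where
  open ≡-Reasoning
  alg : ∀ x y f g → (x + y) * (f * g) ≡ x * f * g + f * (y * g)
  alg = solve-∀ ℚ-ring

θ-one : θ (oneₚ {d}) ≈ₚ 0ₚ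
θ-one {d} = mk≈ₚ term
  where
  term : ∀ m → ⟦ ∣ m ∣ₘ ⟧ * oneₚ m ≡ 0ₚ m
  term m with 𝟎-or-+ m
  ... | inj₁ refl = trans (cong (_* oneₚ m) (trans (cong ⟦_⟧ (∣𝟎∣ d)) ι-0)) (trans (*-zeroˡ (oneₚ m)) (sym (0ₚ-at m)))
  ... | inj₂ pos  = trans (cong (⟦ ∣ m ∣ₘ ⟧ *_) (oneₚ-+ m pos)) (trans (*-zeroʳ ⟦ ∣ m ∣ₘ ⟧) (sym (0ₚ-at m)))

const-+ : ∀ a b → const {d} (a + b) ≈ₚ const a ⊞ const b
const-+ a b = mk≈ₚ (λ m → trans (*-distribʳ-+ (oneₚ m) a b) (sym (⊞-at (const a) (const b) m)))

const-* : ∀ a b (f : PowerSeries d) → const a ⊛ (const b ⊛ f) ≈ₚ const (a * b) ⊛ f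
const-* a b f = mk≈ₚ (λ m → trans (const-⊛-at a (const b ⊛ f) m) (trans (cong (a *_) (const-⊛-at b f m)) (trans (sym (*-assoc a b (f m))) (sym (const-⊛-at (a * b) f m)))))

const-cong : ∀ {a b} → a ≡ b → const {d} a ≈ₚ const b
const-cong refl = ≈ₚ-refl

θ-^-suc : (f : PowerSeries d) (n : ℕ) → θ (f ^ suc n) ≈ₚ const ⟦ suc n ⟧ ⊛ (f ^ n ⊛ θ f)
θ-^-suc f zero = begin
  θ (f ⊛ oneₚ)                        ≈⟨ θ-cong (⊛-identityʳ f) ⟩
  θ f                                 ≈⟨ R.*-identityˡ (θ f) ⟨
  oneₚ ⊛ θ f                          ≈⟨ R.*-identityˡ _ ⟨
  oneₚ ⊛ (oneₚ ⊛ θ f)                 ≈⟨ ⊛-cong (R.trans (const-cong ι-1) const-1) ≈ₚ-refl ⟨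
  const ⟦ 1 ⟧ ⊛ (oneₚ ⊛ θ f)          ∎
  where open ≈ₚ-Reasoning
θ-^-suc f (suc n) = begin
  θ (f ⊛ f ^ suc n)
    ≈⟨ θ-⊛ f (f ^ suc n) ⟩
  θ f ⊛ f ^ suc n ⊞ f ⊛ θ (f ^ suc n)
    ≈⟨ R.+-cong (⊛-comm (θ f) (f ^ suc n)) (⊛-cong ≈ₚ-refl (θ-^-suc f n)) ⟩
  X ⊞ f ⊛ (const ⟦ suc n ⟧ ⊛ (f ^ n ⊛ θ f))
    ≈⟨ R.+-congˡ (R.trans (R.sym (⊛-assoc f _ _)) (R.trans (⊛-cong (⊛-comm f (const ⟦ suc n ⟧)) ≈ₚ-refl) (R.trans (⊛-assoc _ f _) (⊛-cong ≈ₚ-refl (R.sym (⊛-assoc f (f ^ n) (θ f))))))) ⟩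
  X ⊞ const ⟦ suc n ⟧ ⊛ X
    ≈⟨ R.+-congʳ (R.trans (⊛-cong (R.trans (const-cong ι-1) const-1) ≈ₚ-refl) (R.*-identityˡ X)) ⟨
  const ⟦ 1 ⟧ ⊛ X ⊞ const ⟦ suc n ⟧ ⊛ X
    ≈⟨ R.distribʳ X _ _ ⟨
  (const ⟦ 1 ⟧ ⊞ const ⟦ suc n ⟧) ⊛ X
    ≈⟨ ⊛-cong (R.trans (const-cong (⟦⟧-+ 1 (suc n))) (const-+ ⟦ 1 ⟧ ⟦ suc n ⟧)) ≈ₚ-refl ⟨
  const ⟦ suc (suc n) ⟧ ⊛ X ∎
  where
  open ≈ₚ-Reasoning
  X = f ^ suc n ⊛ θ f

invFact-suc : ∀ n → invFact (suc n) * ⟦ suc n ⟧ ≡ invFact n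
invFact-suc n = begin
  invFact (suc n) * ⟦ suc n ⟧              ≡⟨ cong (_* ⟦ suc n ⟧) (trans (invFact-inv (suc n)) (inv-homo (suc n) (n !) {{_}} {{n ℕP.!≢0}})) ⟩
  inv (suc n) * inv (n !) * ⟦ suc n ⟧      ≡⟨ alg (inv (suc n)) (inv (n !)) ⟦ suc n ⟧ ⟩
  ⟦ suc n ⟧ * inv (suc n) * inv (n !)      ≡⟨ cong₂ _*_ (inv-* (suc n)) (sym (invFact-inv n)) ⟩
  1ℚ * invFact n                           ≡⟨ *-identityˡ _ ⟩
  invFact n                                ∎
  where
  open ≡-Reasoning
  alg : ∀ x y z → x * y * z ≡ z * x * y
  alg = solve-∀ ℚ-ring

-- The term h^(n+1) / (n+1)! goes to (h^n / n!) θ h and the constant term dies, so the order of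
-- truncation drops by one.
θ-psum : (h : PowerSeries d) (N : ℕ) → θ (psum invFact h (suc N)) ≈ₚ psum invFact h N ⊛ θ h
θ-psum h N = R.trans (θ-⊞ (psum invFact h N) _) (R.trans (R.+-congˡ step) (go N))
  where
  last : ∀ n → θ (const (invFact (suc n)) ⊛ h ^ suc n) ≈ₚ const (invFact n) ⊛ h ^ n ⊛ θ h
  last n = R.trans (θ-const-⊛ (invFact (suc n)) (h ^ suc n)) (R.trans (⊛-cong ≈ₚ-refl (θ-^-suc h n))
    (R.trans (const-* (invFact (suc n)) ⟦ suc n ⟧ _) (R.trans (⊛-cong (const-cong (invFact-suc n)) ≈ₚ-refl) (R.sym (⊛-assoc _ (h ^ n) (θ h))))))
  step = last N
  go : ∀ N → θ (psum invFact h N) ⊞ const (invFact N) ⊛ h ^ N ⊛ θ h ≈ₚ psum invFact h N ⊛ θ h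
  go zero    = R.trans (R.+-congʳ (R.trans (θ-const-⊛ (invFact 0) oneₚ) (R.trans (⊛-cong ≈ₚ-refl θ-one) (R.zeroʳ _)))) (R.+-identityˡ _)
  go (suc N) = R.trans (R.+-congʳ (θ-psum h N)) (R.sym (R.distribʳ (θ h) (psum invFact h N) _))

θ-expₚ : (h : PowerSeries d) → h 𝟎 ≡ 0ℚ → θ (expₚ h) ≈ₚ expₚ h ⊛ θ h
θ-expₚ h h0 = mk≈ₚ (λ m → let N = ∣ m ∣ₘ in begin
  -- The order is raised to `suc N` so that it is `N` again after `θ`.
  ⟦ N ⟧ * expₚ h m                          ≡⟨ cong (⟦ N ⟧ *_) (trans (expₚ-psum h m) (sym (psum-stable invFact h h0 m (suc N) (ℕP.n≤1+n N)))) ⟩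
  θ (psum invFact h (suc N)) m              ≡⟨ at (θ-psum h N) m ⟩
  (psum invFact h N ⊛ θ h) m                ≡⟨ ⊛-local m (θ h) (λ a le → trans (psum-stable invFact h h0 a N le) (sym (expₚ-psum h a))) ⟩
  (expₚ h ⊛ θ h) m                          ∎)
  where open ≡-Reasoning

expₚ-𝟎 : (h : PowerSeries d) → expₚ h 𝟎 ≡ 1ℚ
expₚ-𝟎 {d} h = trans (expₚ-psum h 𝟎) (trans (cong (λ t → psum invFact h t 𝟎) (∣𝟎∣ d)) (trans (const-⊛-at (invFact 0) oneₚ 𝟎) (trans (*-identityˡ (oneₚ {d} 𝟎)) (oneₚ-𝟎 d))))

-- Since g has no constant term, the equation expresses ∣m∣ times the coefficient at m through
-- coefficients of lower degree, and ∣m∣ is invertible for m other than `𝟎`.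
θ-unique : (A A′ g : PowerSeries d) → g 𝟎 ≡ 0ℚ → θ A ≈ₚ A ⊛ g → θ A′ ≈ₚ A′ ⊛ g → A 𝟎 ≡ A′ 𝟎 → A ≈ₚ A′
θ-unique A A′ g g0 e e′ A0 = mk≈ₚ (λ m → go ∣ m ∣ₘ m ℕP.≤-refl)
  where
  open ≡-Reasoning
  go : ∀ n m → ∣ m ∣ₘ ℕ.≤ n → A m ≡ A′ m
  go n m le with 𝟎-or-+ m
  go n m le | inj₁ refl = A0
  go zero m le | inj₂ pos with () ← ℕP.≤-trans pos le
  go (suc n) m le | inj₂ pos = begin
    A m                              ≡⟨ cancel (A m) ⟨
    inv N * (⟦ N ⟧ * A m)            ≡⟨ cong (inv N *_) main ⟩
    inv N * (⟦ N ⟧ * A′ m)           ≡⟨ cancel (A′ m) ⟩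
    A′ m                             ∎
    where
    N = ∣ m ∣ₘ
    cancel : ∀ x → inv N * (⟦ N ⟧ * x) ≡ x
    cancel x = trans (sym (*-assoc (inv N) ⟦ N ⟧ x)) (trans (cong (_* x) (trans (*-comm (inv N) ⟦ N ⟧) (inv-* N {{ℕ.>-nonZero pos}}))) (*-identityˡ x))
    term : ∀ a b → a ⊕ b ≡ m → A a * g b ≡ A′ a * g b
    term a b e with 𝟎-or-+ b
    ... | inj₁ refl = trans (cong (A a *_) g0) (trans (*-zeroʳ (A a)) (sym (trans (cong (A′ a *_) g0) (*-zeroʳ (A′ a)))))
    ... | inj₂ pos′ = cong (_* g b) (go n a (ℕP.≤-pred (ℕP.≤-trans (subst (∣ a ∣ₘ ℕ.<_) (trans (sym (∣⊕∣ a b)) (cong ∣_∣ₘ e)) (ℕP.m<m+n ∣ a ∣ₘ pos′)) le)))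
    main : ⟦ N ⟧ * A m ≡ ⟦ N ⟧ * A′ m
    main = begin
      ⟦ N ⟧ * A m                    ≡⟨ at e m ⟩
      (A ⊛ g) m                      ≡⟨ ⊛-at A g m ⟩
      conv m (λ a b → A a * g b)     ≡⟨ conv-cong m term ⟩
      conv m (λ a b → A′ a * g b)    ≡⟨ ⊛-at A′ g m ⟨
      (A′ ⊛ g) m                     ≡⟨ at e′ m ⟨
      ⟦ N ⟧ * A′ m                   ∎

-- The substitution of p-th powers of the variables.

module Frobenius (p : ℕ) {{_ : NonZero p}} where
  open Residues p

  -- The coefficient of z^x in g(z^p), for a one-variable series with coefficients `g`.
  sel : ℕ → (ℕ → ℚ) → ℚ
  sel x g with p ∣? x
  ... | yes (divides y _) = g y
  ... | no _              = 0ℚ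

  sel-* : ∀ y g → sel (p ℕ.* y) g ≡ g y
  sel-* y g with p ∣? (p ℕ.* y)
  ... | yes (divides y′ e) = cong g (ℕP.*-cancelˡ-≡ y′ y p (trans (ℕP.*-comm p y′) (sym e)))
  ... | no p∤              = ⊥-elim (p∤ (ℕD.m∣m*n y))

  sel-∤ : ∀ {x} → p ∤ x → ∀ g → sel x g ≡ 0ℚ
  sel-∤ {x} p∤x g with p ∣? x
  ... | yes p∣x = ⊥-elim (p∤x p∣x)
  ... | no _    = refl

  sel-cong : ∀ x {f g} → (∀ y → p ℕ.* y ≡ x → f y ≡ g y) → sel x f ≡ sel x g
  sel-cong x e with p ∣? x
  ... | yes (divides y x≡) = e y (trans (ℕP.*-comm p y) (sym x≡))
  ... | no _               = refl

  sel-+ : ∀ x f g → sel x (λ y → f y + g y) ≡ sel x f + sel x g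
  sel-+ x f g with p ∣? x
  ... | yes (divides y _) = refl
  ... | no _              = refl

  sel-*ˡ : ∀ x c f → sel x (λ y → c * f y) ≡ c * sel x f
  sel-*ˡ x c f with p ∣? x
  ... | yes (divides y _) = refl
  ... | no _              = sym (*-zeroʳ c)

  sel-0 : ∀ x → sel x (λ _ → 0ℚ) ≡ 0ℚ
  sel-0 x with p ∣? x
  ... | yes (divides y _) = refl
  ... | no _              = refl

  p∤residue : ∀ {a} → 0 ℕ.< a → a ℕ.< p → ∀ i → p ∤ a ℕ.+ p ℕ.* i
  p∤residue {suc a} _ a<p i p∣ = ℕP.<⇒≱ a<p (ℕD.∣⇒≤ (ℕD.∣m+n∣m⇒∣n (subst (p ∣_) (ℕP.+-comm (suc a) (p ℕ.* i)) p∣) (ℕD.m∣m*n i)))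

  sel-σ : ∀ x (f : ℕ → ℕ → ℚ) → σ x (λ i j → sel i (λ i′ → sel j (λ j′ → f i′ j′))) ≡ sel x (λ y → σ y f)
  sel-σ x f with p ∣? x
  ... | no p∤x = σ-closed (_≡ 0ℚ) (λ { refl refl → refl }) x term
    where
    term : ∀ i j → i ℕ.+ j ≡ x → sel i (λ i′ → sel j (λ j′ → f i′ j′)) ≡ 0ℚ
    term i j e with p ∣? i
    ... | no _ = refl
    ... | yes (divides i′ i≡) = sel-∤ {j} (λ p∣j → p∤x (subst (p ∣_) e (ℕD.∣m∣n⇒∣m+n (divides i′ i≡) p∣j))) _
  ... | yes (divides y x≡) = begin
    σ x g                                     ≡⟨ cong (λ t → σ t g) (trans x≡ (ℕP.*-comm y p)) ⟩
    -- For r = 0 the only block without carry is (0 , 0); in every block with carry i has a positive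
    -- residue, so `sel` vanishes there.
    σ (p ℕ.* y) g                             ≡⟨ σ-blocks p 0 (ℕ.pred p) (sym (ℕP.suc-pred p)) y g ⟩
    blockSum p g 0 0 y + carrySum p 0 (ℕ.pred p) y g ≡⟨ cong₂ _+_ (σ-cong y (λ i j _ → trans (sel-* i _) (sel-* j _))) (carry (ℕ.pred p) y (ℕP.≤-reflexive (ℕP.suc-pred p))) ⟩
    σ y f + 0ℚ                                ≡⟨ +-identityʳ _ ⟩
    σ y f                                     ∎
    where
    open ≡-Reasoning
    g : ℕ → ℕ → ℚ
    g i j = sel i (λ i′ → sel j (λ j′ → f i′ j′))
    carry : ∀ c y → c ℕ.< p → carrySum p 0 c y g ≡ 0ℚ
    carry zero    y       _   = refl
    carry (suc c) zero    _   = refl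
    carry (suc c) (suc y) c<p = σ-closed (_≡ 0ℚ) (λ { refl refl → refl }) c (λ a b a+b≡c →
      σ-closed (_≡ 0ℚ) (λ { refl refl → refl }) y (λ i j _ →
        sel-∤ (p∤residue (s≤s z≤n) (ℕP.≤-<-trans (s≤s (subst (a ℕ.≤_) a+b≡c (ℕP.m≤m+n a b))) c<p) i) _))

  ψ : PowerSeries d → PowerSeries d
  ψ f []      = f []
  ψ f (x ∷ m) = sel x (λ y → ψ (λ m′ → f (y ∷ m′)) m)

  ψ-cong : (m : MultiIndex d) {f g : PowerSeries d} → (∀ a → p ℕ.* ∣ a ∣ₘ ≡ ∣ m ∣ₘ → f a ≡ g a) → ψ f m ≡ ψ g m
  ψ-cong []      e = e [] (ℕP.*-zeroʳ p)
  ψ-cong (x ∷ m) e = sel-cong x (λ y y≡ → ψ-cong m (λ a a≡ → e (y ∷ a) (trans (ℕP.*-distribˡ-+ p y ∣ a ∣ₘ) (cong₂ ℕ._+_ y≡ a≡))))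

  ψ-cong′ : (m : MultiIndex d) {f g : PowerSeries d} → (∀ a → f a ≡ g a) → ψ f m ≡ ψ g m
  ψ-cong′ m e = ψ-cong m (λ a _ → e a)

  ψ-≈ₚ : {f g : PowerSeries d} → f ≈ₚ g → ψ f ≈ₚ ψ g
  ψ-≈ₚ e = mk≈ₚ (λ m → ψ-cong′ m (at e))

  ψ-+ : (f g : PowerSeries d) (m : MultiIndex d) → ψ (λ a → f a + g a) m ≡ ψ f m + ψ g m
  ψ-+ f g []      = refl
  ψ-+ f g (x ∷ m) = trans (sel-cong x (λ y _ → ψ-+ _ _ m)) (sel-+ x _ _)

  ψ-*ˡ : (c : ℚ) (f : PowerSeries d) (m : MultiIndex d) → ψ (λ a → c * f a) m ≡ c * ψ f m
  ψ-*ˡ c f []      = refl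
  ψ-*ˡ c f (x ∷ m) = trans (sel-cong x (λ y _ → ψ-*ˡ c _ m)) (sel-*ˡ x c _)

  ψ-0 : (m : MultiIndex d) → ψ (λ _ → 0ℚ) m ≡ 0ℚ
  ψ-0 []      = refl
  ψ-0 (x ∷ m) = trans (sel-cong x (λ y _ → ψ-0 m)) (sel-0 x)

  ψ-closed : (P : ℚ → Set) → P 0ℚ → {f : PowerSeries d} → (∀ m → P (f m)) → ∀ m → P (ψ f m)
  ψ-closed P P0 Pf []      = Pf []
  ψ-closed P P0 Pf (x ∷ m) with p ∣? x
  ... | yes (divides y _) = ψ-closed P P0 (λ m′ → Pf (y ∷ m′)) m
  ... | no _              = P0

  ψ-𝟎 : (f : PowerSeries d) → ψ f 𝟎 ≡ f 𝟎
  ψ-𝟎 {zero}  f = refl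
  ψ-𝟎 {suc d} f = trans (cong (λ t → sel t (λ y → ψ (λ m′ → f (y ∷ m′)) (𝟎 {d}))) (sym (ℕP.*-zeroʳ p))) (trans (sel-* 0 _) (ψ-𝟎 (λ m′ → f (0 ∷ m′))))

  ψ-one : ψ (oneₚ {d}) ≈ₚ oneₚ
  ψ-one {d} = mk≈ₚ term
    where
    term : ∀ m → ψ oneₚ m ≡ oneₚ m
    term m with 𝟎-or-+ m
    ... | inj₁ refl = ψ-𝟎 {d} oneₚ
    ... | inj₂ pos  = trans (trans (ψ-cong m (λ a e → oneₚ-+ a (positive a e))) (ψ-0 m)) (sym (oneₚ-+ m pos))
      where
      positive : ∀ a → p ℕ.* ∣ a ∣ₘ ≡ ∣ m ∣ₘ → 0 ℕ.< ∣ a ∣ₘ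
      positive a e with 𝟎-or-+ a
      ... | inj₂ pos′ = pos′
      ... | inj₁ refl = ⊥-elim (ℕP.<⇒≢ pos (trans (sym (trans (cong (p ℕ.*_) (∣𝟎∣ d)) (ℕP.*-zeroʳ p))) e))

  ψ-sel : (m : MultiIndex d) (j : ℕ) (k : MultiIndex d → ℕ → ℚ) → ψ (λ a → sel j (k a)) m ≡ sel j (λ j′ → ψ (λ a → k a j′) m)
  ψ-sel m j k with p ∣? j
  ... | yes (divides y _) = refl
  ... | no _              = ψ-0 m

  conv-sel : (m : MultiIndex d) (j : ℕ) (k : MultiIndex d → MultiIndex d → ℕ → ℚ) → conv m (λ a b → sel j (k a b)) ≡ sel j (λ j′ → conv m (λ a b → k a b j′))
  conv-sel m j k with p ∣? j
  ... | yes (divides y _) = refl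
  ... | no _              = conv-zero m (λ _ _ _ → refl)

  ψ-σ : (m : MultiIndex d) (y : ℕ) (k : ℕ → ℕ → MultiIndex d → ℚ) → ψ (λ a → σ y (λ i j → k i j a)) m ≡ σ y (λ i j → ψ (k i j) m)
  ψ-σ m zero    k = refl
  ψ-σ m (suc y) k = trans (ψ-+ _ _ m) (cong (ψ (k 0 (suc y)) m +_) (ψ-σ m y (λ i → k (suc i))))

  ψ-conv : (m : MultiIndex d) (h : MultiIndex d → MultiIndex d → ℚ) →
           conv m (λ a b → ψ (λ a′ → ψ (h a′) b) a) ≡ ψ (λ m′ → conv m′ h) m
  ψ-conv []      h = refl
  ψ-conv (x ∷ m) h = begin
    σ x (λ i j → conv m (λ a b → sel i (λ i′ → ψ (λ a′ → sel j (λ j′ → ψ (λ b′ → h (i′ ∷ a′) (j′ ∷ b′)) b)) a)))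
      ≡⟨ σ-cong x (λ i j _ → conv-sel m i _) ⟩
    σ x (λ i j → sel i (λ i′ → conv m (λ a b → ψ (λ a′ → sel j (λ j′ → ψ (λ b′ → h (i′ ∷ a′) (j′ ∷ b′)) b)) a)))
      ≡⟨ σ-cong x (λ i j _ → sel-cong i (λ i′ _ → trans (conv-cong′ m (λ a b → ψ-sel a j _)) (conv-sel m j _))) ⟩
    σ x (λ i j → sel i (λ i′ → sel j (λ j′ → conv m (λ a b → ψ (λ a′ → ψ (λ b′ → h (i′ ∷ a′) (j′ ∷ b′)) b) a))))
      ≡⟨ sel-σ x (λ i′ j′ → conv m (λ a b → ψ (λ a′ → ψ (λ b′ → h (i′ ∷ a′) (j′ ∷ b′)) b) a)) ⟩
    sel x (λ y → σ y (λ i j → conv m (λ a b → ψ (λ a′ → ψ (λ b′ → h (i ∷ a′) (j ∷ b′)) b) a)))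
      ≡⟨ sel-cong x (λ y _ → trans (σ-cong y (λ i j _ → ψ-conv m (λ a′ b′ → h (i ∷ a′) (j ∷ b′)))) (sym (ψ-σ m y _))) ⟩
    sel x (λ y → ψ (λ m′ → σ y (λ i j → conv m′ (λ a b → h (i ∷ a) (j ∷ b)))) m) ∎
    where open ≡-Reasoning

  ψ-⊛ : (f g : PowerSeries d) → ψ (f ⊛ g) ≈ₚ ψ f ⊛ ψ g
  ψ-⊛ f g = mk≈ₚ (λ m → begin
    ψ (f ⊛ g) m                                           ≡⟨ ψ-cong′ m (⊛-at f g) ⟩
    ψ (λ m′ → conv m′ (λ a b → f a * g b)) m              ≡⟨ ψ-conv m (λ a b → f a * g b) ⟨
    conv m (λ a b → ψ (λ a′ → ψ (λ b′ → f a′ * g b′) b) a) ≡⟨ conv-cong′ m (λ a b → trans (ψ-cong′ a (λ a′ → trans (ψ-*ˡ (f a′) g b) (*-comm (f a′) (ψ g b)))) (trans (ψ-*ˡ (ψ g b) f a) (*-comm (ψ g b) (ψ f a)))) ⟩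
    conv m (λ a b → ψ f a * ψ g b)                        ≡⟨ ⊛-at (ψ f) (ψ g) m ⟨
    (ψ f ⊛ ψ g) m                                         ∎)
    where open ≡-Reasoning

  θ-ψ : (f : PowerSeries d) → θ (ψ f) ≈ₚ const ⟦ p ⟧ ⊛ ψ (θ f)
  θ-ψ f = mk≈ₚ (λ m → trans (sym (ψ-*ˡ ⟦ ∣ m ∣ₘ ⟧ f m)) (trans
    (ψ-cong m (λ a e → trans (cong (_* f a) (trans (cong ⟦_⟧ (sym e)) (⟦⟧-* p ∣ a ∣ₘ))) (*-assoc ⟦ p ⟧ ⟦ ∣ a ∣ₘ ⟧ (f a))))
    (trans (ψ-*ˡ ⟦ p ⟧ (θ f) m) (sym (const-⊛-at ⟦ p ⟧ (ψ (θ f)) m)))))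

  -- Whether b = 𝟎 decides the alternative, uniformly in `f` and `l`, so a whole block of a
  -- convolution can be treated at once.
  ψ-digits : (b : MultiIndex d) → Digits b →
             (∀ (f : PowerSeries d) l → ψ f (b ⊹ l) ≡ f l) ⊎ (∀ (f : PowerSeries d) l → ψ f (b ⊹ l) ≡ 0ℚ)
  ψ-digits []          []           = inj₁ (λ { f [] → refl })
  ψ-digits (suc b ∷ bs) (b<p ∷ _)   = inj₂ (λ { f (l ∷ ls) → sel-∤ (p∤residue (s≤s z≤n) b<p l) _ })
  ψ-digits (zero ∷ bs) (_ ∷ dbs) with ψ-digits bs dbs
  ... | inj₁ e = inj₁ (λ { f (l ∷ ls) → trans (sel-* l _) (e _ ls) })
  ... | inj₂ e = inj₂ (λ { f (l ∷ ls) → trans (sel-* l _) (e _ ls) })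

-- The congruence between F ψ(G) and p G ψ(F).

module Congruence (p : ℕ) (isPrime : Prime p) where
  open Local p isPrime
  open Residues p
  open Lipschitz p isPrime
  open Frobenius p

  module _ {B H : PowerSeries d} (W : DworkPair B H) where
    open DworkPair W

    BH : PowerSeries d
    BH m = H m * B m

    -- Only blocks with b = 𝟎 survive. There the difference is p times integral terms from `H-rec`
    -- plus the sum `S` with weights `Y a` and 1; both weights lie in `Lip 1`, which makes `S`
    -- divisible by p and not merely integral.
    Dwork-congruence : ∀ m → Div 1 ((B ⊛ ψ BH) m - ⟦ p ⟧ * (BH ⊛ ψ B) m)
    Dwork-congruence m = subst (Div 1) (sym eq) (conv-blocks-closed (Div 1) Div-zero Div-+ m _ block)
      where
      open ≡-Reasoning
      t : MultiIndex d → MultiIndex d → ℚ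
      t k l = B k * ψ BH l + - ⟦ p ⟧ * (BH k * ψ B l)
      eq : (B ⊛ ψ BH) m - ⟦ p ⟧ * (BH ⊛ ψ B) m ≡ conv m t
      eq = begin
        (B ⊛ ψ BH) m - ⟦ p ⟧ * (BH ⊛ ψ B) m
          ≡⟨ cong₂ (λ s t → s - ⟦ p ⟧ * t) (⊛-at B (ψ BH) m) (⊛-at BH (ψ B) m) ⟩
        conv m (λ k l → B k * ψ BH l) - ⟦ p ⟧ * conv m (λ k l → BH k * ψ B l)
          ≡⟨ cong (conv m (λ k l → B k * ψ BH l) +_) (neg-distribˡ-* ⟦ p ⟧ (conv m (λ k l → BH k * ψ B l))) ⟩
        conv m (λ k l → B k * ψ BH l) + - ⟦ p ⟧ * conv m (λ k l → BH k * ψ B l)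
          ≡⟨ cong (conv m (λ k l → B k * ψ BH l) +_) (conv-*ˡ m (- ⟦ p ⟧) _) ⟨
        conv m (λ k l → B k * ψ BH l) + conv m (λ k l → - ⟦ p ⟧ * (BH k * ψ B l))
          ≡⟨ conv-+ m _ _ ⟨
        conv m t ∎
      block : ∀ a b K → Digits a → Digits b → p ℕ.* ∣ K ∣ₘ ℕ.≤ ∣ m ∣ₘ → Div 1 (conv K (λ k l → t (a ⊹ k) (b ⊹ l)))
      block a b K da db _ with ψ-digits b db
      ... | inj₂ ψ≡0 = subst (Div 1) (sym (conv-zero K (λ k l _ → trans
              (cong₂ (λ x y → B (a ⊹ k) * x + - ⟦ p ⟧ * (BH (a ⊹ k) * y)) (ψ≡0 BH l) (ψ≡0 B l))
              (alg (B (a ⊹ k)) ⟦ p ⟧ (BH (a ⊹ k)))))) Div-zero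
        where
        alg : ∀ x y z → x * 0ℚ + - y * (z * 0ℚ) ≡ 0ℚ
        alg = solve-∀ ℚ-ring
      ... | inj₁ ψ≡ = subst (Div 1) (sym blockEq) (Div-p* (Int-+
              (conv-closed Int Int-+ K (λ k l _ → Int-neg (Int-* (B-int l) (H-rec da k))))
              (S-Lip₁-int W K (Y-lip da) (Lip-const Int-1))))
        where
        ρ : MultiIndex d → MultiIndex d → ℚ
        ρ k l = - (B l * (B (a ⊹ k) * (H (a ⊹ k) - inv p * H k)))
        alg : ∀ P i b b′ y h h′ H →
          b * y * (h′ * b′) + - P * (H * (b * y) * b′) ≡
          P * (- (b′ * (b * y * (H - i * h))) + i * (b * b′ * (y * 1ℚ) * (h′ - h))) + (1ℚ - P * i) * (b * y * (h′ * b′))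
        alg = solve-∀ ℚ-ring
        termwise : ∀ k l → t (a ⊹ k) (b ⊹ l) ≡ ⟦ p ⟧ * (ρ k l + inv p * term W (Y a) (λ _ → 1ℚ) k l)
        termwise k l rewrite ψ≡ BH l | ψ≡ B l | B-rec da k = begin
          B k * Y a k * (H l * B l) + - ⟦ p ⟧ * (H (a ⊹ k) * (B k * Y a k) * B l)
            ≡⟨ alg ⟦ p ⟧ (inv p) (B k) (B l) (Y a k) (H k) (H l) (H (a ⊹ k)) ⟩
          Z + (1ℚ - ⟦ p ⟧ * inv p) * X
            ≡⟨ cong (λ s → Z + (1ℚ - s) * X) p*inv-p ⟩
          Z + (1ℚ - 1ℚ) * X
            ≡⟨ cong (Z +_) (*-zeroˡ X) ⟩
          Z + 0ℚ
            ≡⟨ +-identityʳ Z ⟩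
          Z ∎
          where
          X = B k * Y a k * (H l * B l)
          Z = ⟦ p ⟧ * (- (B l * (B k * Y a k * (H (a ⊹ k) - inv p * H k))) + inv p * (B k * B l * (Y a k * 1ℚ) * (H l - H k)))
        blockEq : conv K (λ k l → t (a ⊹ k) (b ⊹ l)) ≡ ⟦ p ⟧ * (conv K ρ + inv p * S W (Y a) (λ _ → 1ℚ) K)
        blockEq = begin
          conv K (λ k l → t (a ⊹ k) (b ⊹ l))   ≡⟨ conv-cong′ K termwise ⟩
          conv K (λ k l → ⟦ p ⟧ * (ρ k l + inv p * term W (Y a) (λ _ → 1ℚ) k l)) ≡⟨ conv-*ˡ K ⟦ p ⟧ _ ⟩
          ⟦ p ⟧ * conv K (λ k l → ρ k l + inv p * term W (Y a) (λ _ → 1ℚ) k l)   ≡⟨ cong (⟦ p ⟧ *_) (trans (conv-+ K _ _) (cong (conv K ρ +_) (conv-*ˡ K (inv p) _))) ⟩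
          ⟦ p ⟧ * (conv K ρ + inv p * S W (Y a) (λ _ → 1ℚ) K) ∎

-- Identities in the ring of series, and separation of the first variable.

module SemiringIdentities {c ℓ} (S : CommutativeSemiring c ℓ) where
  open CommutativeSemiring S using (_≈_) renaming (refl to S-refl; _+_ to infixl 6 _∔_; _*_ to infixl 7 _∙_)
  open SemiringSolver S using (solve; _:=_; _:+_; _:*_)

  x*y*[z*w] : ∀ x y z w → (x ∙ y) ∙ (z ∙ w) ≈ x ∙ ((y ∙ z) ∙ w)
  x*y*[z*w] = solve 4 (λ x y z w → (x :* y) :* (z :* w) := x :* ((y :* z) :* w)) S-refl

  x*[y*z] : ∀ x y z → x ∙ (y ∙ z) ≈ y ∙ (x ∙ z)
  x*[y*z] = solve 3 (λ x y z → x :* (y :* z) := y :* (x :* z)) S-refl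

  x*[y*[z*w]] : ∀ x y z w → x ∙ (y ∙ (z ∙ w)) ≈ (z ∙ y) ∙ (x ∙ w)
  x*[y*[z*w]] = solve 4 (λ x y z w → x :* (y :* (z :* w)) := (z :* y) :* (x :* w)) S-refl

  leibniz : ∀ c e t v s → (c ∙ (e ∙ t)) ∙ v ∔ e ∙ (v ∙ s) ≈ (e ∙ v) ∙ (s ∔ c ∙ t)
  leibniz = solve 5 (λ c e t v s → ((c :* (e :* t)) :* v) :+ (e :* (v :* s)) := (e :* v) :* (s :+ c :* t)) S-refl

  cancel : ∀ u b b′ i i′ → (u ∙ (b ∙ b′)) ∙ (i ∙ i′) ≈ u ∙ ((b ∙ i) ∙ (b′ ∙ i′))
  cancel = solve 5 (λ u b b′ i i′ → (u :* (b :* b′)) :* (i :* i′) := u :* ((b :* i) :* (b′ :* i′))) S-refl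

  expand : ∀ t r a q → (t ∔ r) ∙ (a ∔ r ∙ q) ≈ t ∙ a ∔ r ∙ (a ∔ (t ∔ r) ∙ q)
  expand = solve 4 (λ t r a q → (t :+ r) :* (a :+ r :* q) := t :* a :+ r :* (a :+ (t :+ r) :* q)) S-refl

module Id {d} = SemiringIdentities (R.commutativeSemiring {d})
module M {d} = Mult (R.semiring {d})
module Su {d} = Sum (R.semiring {d})

×-at : ∀ n (f : PowerSeries d) m → (n M.× f) m ≡ ⟦ n ⟧ * f m
×-at zero    f m = trans (0ₚ-at m) (sym (trans (cong (_* f m) ι-0) (*-zeroˡ (f m))))
×-at (suc n) f m = trans (⊞-at f (n M.× f) m) (trans (cong (f m +_) (×-at n f m)) (trans (alg (f m) ⟦ n ⟧)
  (cong (_* f m) (sym (trans (⟦⟧-+ 1 n) (cong (_+ ⟦ n ⟧) ι-1))))))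
  where
  alg : ∀ x y → x + y * x ≡ (1ℚ + y) * x
  alg = solve-∀ ℚ-ring

lift : PowerSeries d → PowerSeries (suc d)
lift f (zero ∷ m)  = f m
lift f (suc x ∷ m) = 0ℚ

-- Multiplication by the first variable. Together with `lift`, which makes a series constant in a
-- new first variable, it allows induction on the exponent of that variable.
shift : PowerSeries (suc d) → PowerSeries (suc d)
shift f (zero ∷ m)  = 0ℚ
shift f (suc x ∷ m) = f (x ∷ m)

shiftN : ℕ → PowerSeries (suc d) → PowerSeries (suc d)
shiftN zero    f = f
shiftN (suc n) f = shift (shiftN n f)

shift-cong : {f g : PowerSeries (suc d)} → f ≈ₚ g → shift f ≈ₚ shift g
shift-cong e = mk≈ₚ (λ { (zero ∷ m) → refl ; (suc x ∷ m) → at e (x ∷ m) })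

shift-⊛ : (f g : PowerSeries (suc d)) → shift f ⊛ g ≈ₚ shift (f ⊛ g)
shift-⊛ f g = mk≈ₚ λ where
  (zero ∷ m)  → trans (⊛-at (shift f) g (zero ∷ m)) (conv-zero m (λ a b _ → *-zeroˡ (g (0 ∷ b))))
  (suc x ∷ m) → trans (⊛-at (shift f) g (suc x ∷ m)) (trans (cong₂ _+_ (conv-zero m (λ a b _ → *-zeroˡ (g (suc x ∷ b)))) (sym (⊛-at f g (x ∷ m)))) (+-identityˡ _))

lift-⊛ : (f g : PowerSeries d) → lift f ⊛ lift g ≈ₚ lift (f ⊛ g)
lift-⊛ f g = mk≈ₚ λ where
  (zero ∷ m)  → trans (⊛-at (lift f) (lift g) (zero ∷ m)) (sym (⊛-at f g m))
  (suc x ∷ m) → trans (⊛-at (lift f) (lift g) (suc x ∷ m)) (trans (cong₂ _+_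
     (conv-zero m (λ a b _ → *-zeroʳ (f a)))
     (σ-closed (_≡ 0ℚ) (λ { refl refl → refl }) x (λ i j _ → conv-zero m (λ a b _ → *-zeroˡ (lift g (j ∷ b)))))) (+-identityˡ 0ℚ))

lift-one : lift (oneₚ {d}) ≈ₚ oneₚ
lift-one {d} = mk≈ₚ term
  where
  term : ∀ m → lift oneₚ m ≡ oneₚ m
  term (suc x ∷ m) = refl
  term (zero ∷ m) with 𝟎-or-+ m
  ... | inj₁ refl = trans (oneₚ-𝟎 d) (sym (oneₚ-𝟎 (suc d)))
  ... | inj₂ pos  = trans (oneₚ-+ m pos) (sym (oneₚ-+ (0 ∷ m) pos))

lift-^ : (f : PowerSeries d) (n : ℕ) → lift f ^ n ≈ₚ lift (f ^ n)
lift-^ f zero    = ≈ₚ-sym lift-one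
lift-^ f (suc n) = R.trans (⊛-cong ≈ₚ-refl (lift-^ f n)) (lift-⊛ f (f ^ n))

⊛-shiftN : (f g : PowerSeries (suc d)) (n : ℕ) → f ⊛ shiftN n g ≈ₚ shiftN n (f ⊛ g)
⊛-shiftN f g zero    = ≈ₚ-refl
⊛-shiftN f g (suc n) = R.trans (⊛-comm f (shift (shiftN n g))) (R.trans (shift-⊛ (shiftN n g) f)
  (shift-cong (R.trans (⊛-comm (shiftN n g) f) (⊛-shiftN f g n))))

shift-^ : (f : PowerSeries (suc d)) (n : ℕ) → shift f ^ n ≈ₚ shiftN n (f ^ n)
shift-^ f zero    = ≈ₚ-refl
shift-^ f (suc n) = R.trans (⊛-cong ≈ₚ-refl (shift-^ f n)) (R.trans (shift-⊛ f (shiftN n (f ^ n))) (shift-cong (⊛-shiftN f (f ^ n) n)))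

shiftN-+ : ∀ n x (f : PowerSeries (suc d)) m → shiftN n f (n ℕ.+ x ∷ m) ≡ f (x ∷ m)
shiftN-+ zero    x f m = refl
shiftN-+ (suc n) x f m = shiftN-+ n x f m

shiftN-< : ∀ n x (f : PowerSeries (suc d)) m → x ℕ.< n → shiftN n f (x ∷ m) ≡ 0ℚ
shiftN-< (suc n) zero    f m _         = refl
shiftN-< (suc n) (suc x) f m (s≤s x<n) = shiftN-< n x f m x<n

^-[] : (f : PowerSeries 0) (n : ℕ) → (f ^ n) [] ≡ powℚ (f []) n
^-[] f zero    = refl
^-[] f (suc n) = trans (⊛-at f (f ^ n) []) (cong (f [] *_) (^-[] f n))

-- The Frobenius congruence for p-th powers.

module Exponential (p : ℕ) (isPrime : Prime p) where
  open Local p isPrime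
  open Factorials p isPrime
  open Frobenius p

  IntS : PowerSeries d → Set
  IntS f = ∀ m → Int (f m)

  IntS-⊛ : {f g : PowerSeries d} → IntS f → IntS g → IntS (f ⊛ g)
  IntS-⊛ {f = f} {g} If Ig m = subst Int (sym (⊛-at f g m)) (conv-closed Int Int-+ m (λ a b _ → Int-* (If a) (Ig b)))

  IntS-one : IntS (oneₚ {d})
  IntS-one m with 𝟎-or-+ m
  IntS-one {d} m | inj₁ refl = subst Int (sym (oneₚ-𝟎 d)) Int-1
  ... | inj₂ pos  = subst Int (sym (oneₚ-+ m pos)) Int-0

  IntS-^ : {f : PowerSeries d} → IntS f → ∀ n → IntS (f ^ n)
  IntS-^ If zero    = IntS-one
  IntS-^ If (suc n) = IntS-⊛ If (IntS-^ If n)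

  p∤k! : ∀ k → k ℕ.< p → p ∤ k !
  p∤k! zero    _   = ∤-1
  p∤k! (suc k) k<p = ∤-* (λ p∣k → ℕP.<⇒≱ k<p (ℕD.∣⇒≤ p∣k)) (p∤k! k (ℕP.<-trans (ℕP.n<1+n k) k<p))

  p∣pCk : ∀ {k} → 0 ℕ.< k → k ℕ.< p → p ∣ p C k
  p∣pCk {k} 0<k k<p with euclidsLemma (p C k) (k ! ℕ.* (p ∸ k) !) isPrime (subst (p ∣_) (sym product) p∣p!)
    where
    instance
      _ = k ℕP.!* (p ∸ k) !≢0
    product : (p C k) ℕ.* (k ! ℕ.* (p ∸ k) !) ≡ p !
    product = trans (cong (ℕ._* (k ! ℕ.* (p ∸ k) !)) (nCk≡n!/k![n-k]! (ℕP.<⇒≤ k<p))) (m/n*n≡m (k![n∸k]!∣n! (ℕP.<⇒≤ k<p)))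
    p∣p! : p ∣ p !
    p∣p! = subst (λ t → p ∣ t !) (ℕP.suc-pred p) (subst (_∣ suc (ℕ.pred p) !) (ℕP.suc-pred p) (ℕD.m∣m*n (ℕ.pred p !)))
  ... | inj₁ p∣C  = p∣C
  ... | inj₂ p∣k! = ⊥-elim (∤-* (p∤k! k k<p) (p∤k! (p ∸ k) (ℕP.∸-monoʳ-< 0<k (ℕP.<⇒≤ k<p))) p∣k!)

  sum-Div : ∀ {n} (t : Fin n → PowerSeries d) m → (∀ i → Div 1 (t i m)) → Div 1 (Su.sum t m)
  sum-Div {n = zero}  t m Dt = subst (Div 1) (sym (0ₚ-at m)) Div-zero
  sum-Div {n = suc n} t m Dt = subst (Div 1) (sym (⊞-at (t Fin.zero) _ m)) (Div-+ (Dt Fin.zero) (sum-Div (λ i → t (Fin.suc i)) m (λ i → Dt (Fin.suc i))))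

  -- The exponent has the form `suc n` so that the binomial sum splits definitionally into a first
  -- term and a rest; all inner coefficients are multiples of p.
  freshman′ : ∀ n → suc n ≡ p → {x y : PowerSeries d} → IntS x → IntS y → ∀ m →
              ((x ⊞ y) ^ suc n) m ≈[ 1 ] (x ^ suc n) m + (y ^ suc n) m
  freshman′ {d} n refl {x} {y} Ix Iy m = subst (_≈[ 1 ] X + Y) (sym expansion) (mk≈ (subst (Div 1) (alg Y mid X) (sum-Div inner m inner-Div)))
    where
    open ≡-Reasoning
    module Bin = Binomial (R.commutativeSemiring {d})
    X = (x ^ suc n) m
    Y = (y ^ suc n) m
    t : Fin (suc (suc n)) → PowerSeries d
    t = Bin.binomialTerm x y (suc n)
    inner : Fin n → PowerSeries d
    inner k = t (Fin.suc (inject₁ k))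
    mid = Su.sum inner m
    alg : ∀ y s x → s ≡ y + (s + x) - (x + y)
    alg = solve-∀ ℚ-ring
    first : t Fin.zero m ≡ Y
    first = trans (×-at 1 (oneₚ ⊛ y ^ suc n) m) (trans (cong₂ _*_ ι-1 (at (R.*-identityˡ (y ^ suc n)) m)) (*-identityˡ Y))
    final : t (fromℕ (suc n)) m ≡ X
    final = trans (cong (λ k → ((suc n C k) M.× (x ^ k ⊛ y ^ (suc n ∸ k))) m) (FinP.toℕ-fromℕ (suc n)))
      (trans (cong₂ (λ c e → (c M.× (x ^ suc n ⊛ y ^ e)) m) (nCn≡1 (suc n)) (ℕP.n∸n≡0 (suc n)))
      (trans (×-at 1 (x ^ suc n ⊛ oneₚ) m) (trans (cong₂ _*_ ι-1 (at (⊛-identityʳ (x ^ suc n)) m)) (*-identityˡ X))))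
    expansion : ((x ⊞ y) ^ suc n) m ≡ Y + (mid + X)
    expansion = begin
      ((x ⊞ y) ^ suc n) m                              ≡⟨ at (Bin.theorem (suc n) x y) m ⟩
      Su.sum t m                                       ≡⟨ ⊞-at (t Fin.zero) (Su.sum (λ i → t (Fin.suc i))) m ⟩
      t Fin.zero m + Su.sum (λ i → t (Fin.suc i)) m    ≡⟨ cong₂ _+_ first (at (Su.sum-init-last (λ i → t (Fin.suc i))) m) ⟩
      Y + (Su.sum inner ⊞ t (fromℕ (suc n))) m         ≡⟨ cong (Y +_) (trans (⊞-at (Su.sum inner) (t (fromℕ (suc n))) m) (cong (mid +_) final)) ⟩
      Y + (mid + X)                                    ∎
    inner-Div : ∀ i → Div 1 (inner i m)
    inner-Div i with p∣pCk {suc (toℕ (inject₁ i))} (s≤s z≤n) (s≤s (subst (ℕ._< n) (sym (FinP.toℕ-inject₁ i)) (FinP.toℕ<n i)))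
    ... | divides c e = subst (Div 1) (sym eq) (Div-p* (Int-* (Int-⟦⟧ c) (IntS-⊛ (IntS-^ Ix k) (IntS-^ Iy (suc n ∸ k)) m)))
      where
      k = suc (toℕ (inject₁ i))
      Z = (x ^ k ⊛ y ^ (suc n ∸ k)) m
      eq : inner i m ≡ ⟦ p ⟧ * (⟦ c ⟧ * Z)
      eq = trans (×-at (suc n C k) _ m) (trans (cong (λ s → ⟦ s ⟧ * Z) (trans e (ℕP.*-comm c p))) (trans (cong (_* Z) (⟦⟧-* p c)) (*-assoc ⟦ p ⟧ ⟦ c ⟧ Z)))

  freshman : {x y : PowerSeries d} → IntS x → IntS y → ∀ m → ((x ⊞ y) ^ p) m ≈[ 1 ] (x ^ p) m + (y ^ p) m
  freshman {x = x} {y} Ix Iy m = subst (λ n → ((x ⊞ y) ^ n) m ≈[ 1 ] (x ^ n) m + (y ^ n) m) (ℕP.suc-pred p)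
    (freshman′ (ℕ.pred p) (ℕP.suc-pred p) Ix Iy m)

  -- Numbers are power series in no variables.
  freshman-ℚ : ∀ {x y} → Int x → Int y → powℚ (x + y) p ≈[ 1 ] powℚ x p + powℚ y p
  freshman-ℚ {x} {y} ix iy = subst₂ (_≈[ 1 ]_) (trans (^-[] _ p) (cong (λ t → powℚ t p) (⊞-at (λ _ → x) (λ _ → y) []))) (cong₂ _+_ (^-[] (λ _ → x) p) (^-[] (λ _ → y) p))
    (freshman {x = λ _ → x} {y = λ _ → y} (λ _ → ix) (λ _ → iy) [])

  powℚ-0 : powℚ 0ℚ p ≡ 0ℚ
  powℚ-0 = subst (λ n → powℚ 0ℚ n ≡ 0ℚ) (ℕP.suc-pred p) (*-zeroˡ (powℚ 0ℚ (ℕ.pred p)))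

  fermat-ℕ : ∀ n → powℚ ⟦ n ⟧ p ≈[ 1 ] ⟦ n ⟧
  fermat-ℕ zero    = ≈-reflexive (trans (cong (λ t → powℚ t p) ι-0) (trans powℚ-0 (sym ι-0)))
  fermat-ℕ (suc n) = subst (λ t → powℚ t p ≈[ 1 ] t) (sym (trans (⟦⟧-+ 1 n) (cong (_+ ⟦ n ⟧) ι-1)))
    (≈-trans (freshman-ℚ Int-1 (Int-⟦⟧ n)) (≈-+ (≈-reflexive (powℚ-1 p)) (fermat-ℕ n)))

  fermat-ℤ : ∀ c → powℚ (ι c) p ≈[ 1 ] ι c
  fermat-ℤ (ℤ.+ n)      = fermat-ℕ n
  -- Applying `freshman-ℚ` to - N + N = 0 gives the power of - N without a case distinction on the
  -- parity of p.
  fermat-ℤ ℤ.-[1+ n ]   = subst (λ t → powℚ t p ≈[ 1 ] t) (sym (ι-neg (ℤ.+ suc n)))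
    (mk≈ (subst (Div 1) (alg (powℚ (- N) p) (powℚ N p) N)
      (Div-sub (Div-neg (≈⇒Div (subst (_≈[ 1 ] powℚ (- N) p + powℚ N p) (trans (cong (λ t → powℚ t p) (+-inverseˡ N)) powℚ-0) (freshman-ℚ (Int-neg (Int-⟦⟧ (suc n))) (Int-⟦⟧ (suc n))))))
               (≈⇒Div (fermat-ℕ (suc n))))))
    where
    N = ⟦ suc n ⟧
    alg : ∀ x y n → - (0ℚ - (x + y)) - (y - n) ≡ x - - n
    alg = solve-∀ ℚ-ring

  -- For x = c / b, modulo p: x^p b ≡ x^p b^p = c^p ≡ c = x b, and b can be cancelled.
  fermat : ∀ {x} → Int x → powℚ x p ≈[ 1 ] x
  fermat {x} ix@(mkInt b c p∤b xb≡c) = mk≈ (subst (Div 1) eq (Div-*ʳ (≈⇒Div chain) (Int-inv p∤b)))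
    where
    b′ = ⟦ b ⟧
    alg : ∀ x y b i → (y * b - x * b) * i ≡ (b * i) * (y - x)
    alg = solve-∀ ℚ-ring
    chain : powℚ x p * b′ ≈[ 1 ] x * b′
    chain = ≈-trans (≈-* (Int-⟦⟧ b) (Int-powℚ ix p) ≈-refl (≈-sym (fermat-ℕ b)))
      (subst₂ (_≈[ 1 ]_) (trans (cong (λ t → powℚ t p) (sym xb≡c)) (powℚ-distrib x b′ p)) (sym xb≡c) (fermat-ℤ c))
    eq : (powℚ x p * b′ - x * b′) * inv b ≡ powℚ x p - x
    eq = trans (alg x (powℚ x p) b′ (inv b)) (trans (cong (_* (powℚ x p - x)) (inv-* b {{∤⇒≢0 p∤b}})) (*-identityˡ _))

  tail₁ : PowerSeries (suc d) → PowerSeries (suc d)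
  tail₁ f (x ∷ m) = f (suc x ∷ m)

  -- Induction on the exponent of the first variable, via f = f₀ + x₁ f₁.
  frobenius : (f : PowerSeries d) → IntS f → ∀ m → (f ^ p) m ≈[ 1 ] ψ f m
  frobenius f If []      = subst (_≈[ 1 ] f []) (sym (^-[] f p)) (fermat (If []))
  frobenius {suc d} f If (x ∷ m) = go x f If x ℕP.≤-refl
    where
    go : ∀ n (f : PowerSeries (suc d)) → IntS f → ∀ x → x ℕ.≤ n → (f ^ p) (x ∷ m) ≈[ 1 ] ψ f (x ∷ m)
    go n f If x x≤n = subst (_≈[ 1 ] ψ f (x ∷ m)) (sym (at (Powers.^-congˡ p split) (x ∷ m)))
      (≈-trans (freshman If₀ If₁ (x ∷ m)) (subst (λ s → s ≈[ 1 ] ψ f (x ∷ m)) (cong₂ _+_ (sym (at (lift-^ f₀ p) (x ∷ m))) (sym (at (shift-^ f₁ p) (x ∷ m)))) (cases x x≤n)))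
      where
      f₀ : PowerSeries d
      f₀ a = f (0 ∷ a)
      f₁ = tail₁ f
      split : f ≈ₚ lift f₀ ⊞ shift f₁
      split = mk≈ₚ λ where
        (zero ∷ a)  → sym (trans (⊞-at (lift f₀) (shift f₁) (zero ∷ a)) (+-identityʳ (f (0 ∷ a))))
        (suc y ∷ a) → sym (trans (⊞-at (lift f₀) (shift f₁) (suc y ∷ a)) (+-identityˡ (f (suc y ∷ a))))
      If₀ : IntS (lift f₀)
      If₀ (zero ∷ a)  = If (0 ∷ a)
      If₀ (suc y ∷ a) = Int-0
      If₁ : IntS (shift f₁)
      If₁ (zero ∷ a)  = Int-0
      If₁ (suc y ∷ a) = If (suc y ∷ a)
      -- The counterpart for `ψ` of multiplying by the p-th power of the first variable, which is
      -- what `shift f₁` contributes.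
      sel-p+ : ∀ y (g : ℕ → ℚ) → sel (p ℕ.+ y) g ≡ sel y (λ z → g (suc z))
      sel-p+ y g with p ∣? y
      ... | yes (divides z refl) = trans (cong (λ t → sel t g) (trans (cong (p ℕ.+_) (ℕP.*-comm z p)) (sym (ℕP.*-suc p z)))) (sel-* (suc z) g)
      ... | no p∤y = sel-∤ (λ p∣ → p∤y (ℕD.∣m+n∣m⇒∣n p∣ ℕD.∣-refl)) g
      cases : ∀ x → x ℕ.≤ n → lift (f₀ ^ p) (x ∷ m) + shiftN p (f₁ ^ p) (x ∷ m) ≈[ 1 ] ψ f (x ∷ m)
      cases zero _ = subst₂ (_≈[ 1 ]_)
        (trans (sym (+-identityʳ _)) (cong ((f₀ ^ p) m +_) (sym (shiftN-< p 0 (f₁ ^ p) m (ℕP.<-trans (s≤s z≤n) p>1)))))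
        (trans (sym (sel-* 0 (λ y → ψ (λ a → f (y ∷ a)) m))) (cong (λ t → sel t (λ y → ψ (λ a → f (y ∷ a)) m)) (ℕP.*-zeroʳ p)))
        (frobenius f₀ (λ a → If (0 ∷ a)) m)
      cases (suc x) x≤n with p ℕ.≤? suc x
      ... | no p≰ = ≈-reflexive (trans (+-identityˡ _) (trans (shiftN-< p (suc x) (f₁ ^ p) m (ℕP.≰⇒> p≰))
              (sym (sel-∤ (λ p∣ → p≰ (ℕD.∣⇒≤ p∣)) _))))
      ... | yes p≤ = subst₂ (_≈[ 1 ]_)
              (trans (sym (trans (cong (λ t → shiftN p (f₁ ^ p) (t ∷ m)) x≡) (shiftN-+ p y (f₁ ^ p) m))) (sym (+-identityˡ _)))
              (sym (trans (cong (λ t → ψ f (t ∷ m)) x≡) (sel-p+ y _)))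
              (descend n x≤n)
        where
        y = suc x ∸ p
        x≡ : suc x ≡ p ℕ.+ y
        x≡ = sym (ℕP.m+[n∸m]≡n p≤)
        descend : ∀ n → suc x ℕ.≤ n → (f₁ ^ p) (y ∷ m) ≈[ 1 ] ψ f₁ (y ∷ m)
        descend (suc n) (s≤s x≤n) = go n f₁ (λ { (z ∷ a) → If (suc z ∷ a) }) y (ℕP.≤-trans (ℕP.≤-pred (ℕP.∸-monoʳ-< {suc x} {p} {0} (ℕP.<-trans (s≤s z≤n) p>1) p≤)) x≤n)

-- The Dieudonné-Dwork lemma.

-- Expansion to first order in R. It will be applied at the lowest degree of R, where only the
-- constant term j of Q contributes.
^-⊞ : (T R : PowerSeries d) → T 𝟎 ≡ 1ℚ → R 𝟎 ≡ 0ℚ → ∀ j →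
      ∃ λ Q → (T ⊞ R) ^ j ≈ₚ T ^ j ⊞ R ⊛ Q × Q 𝟎 ≡ ⟦ j ⟧
^-⊞ T R T0 R0 zero = 0ₚ , R.sym (R.trans (R.+-congˡ (R.zeroʳ R)) (R.+-identityʳ oneₚ)) , trans (0ₚ-at 𝟎) (sym ι-0)
^-⊞ T R T0 R0 (suc j) with ^-⊞ T R T0 R0 j
... | Q , e , Q0 = T ^ j ⊞ (T ⊞ R) ⊛ Q , R.trans (⊛-cong ≈ₚ-refl e) (Id.expand T R (T ^ j) Q) , (begin
    (T ^ j ⊞ (T ⊞ R) ⊛ Q) 𝟎          ≡⟨ ⊞-at (T ^ j) ((T ⊞ R) ⊛ Q) 𝟎 ⟩
    (T ^ j) 𝟎 + ((T ⊞ R) ⊛ Q) 𝟎      ≡⟨ cong₂ _+_ (^-𝟎 T T0 j) (trans (⊛-𝟎 (T ⊞ R) Q) (cong₂ _*_ (trans (⊞-at T R 𝟎) (cong₂ _+_ T0 R0)) Q0)) ⟩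
    1ℚ + (1ℚ + 0ℚ) * ⟦ j ⟧           ≡⟨ cong₂ _+_ (sym ι-1) (trans (cong (_* ⟦ j ⟧) (+-identityʳ 1ℚ)) (*-identityˡ ⟦ j ⟧)) ⟩
    ⟦ 1 ⟧ + ⟦ j ⟧                    ≡⟨ ⟦⟧-+ 1 j ⟨
    ⟦ suc j ⟧                        ∎)
    where open ≡-Reasoning

module DieudonnéDwork (p : ℕ) (isPrime : Prime p) where
  open Local p isPrime
  open Lipschitz p isPrime
  open Factorials p isPrime
  open Frobenius p
  open Congruence p isPrime
  open Exponential p isPrime

  -- The exponent of p in n! is less than n, for p = 2 as well. With n₁ the quotient of n by p, n!
  -- is p^(n₁) n₁! times a unit, and induction handles n₁!.
  p^n/n!-Div : ∀ n → 0 ℕ.< n → Div 1 (powℚ ⟦ p ⟧ n * invFact n)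
  p^n/n!-Div n = go n n ℕP.≤-refl
    where
    go : ∀ f n → n ℕ.≤ f → 0 ℕ.< n → Div 1 (powℚ ⟦ p ⟧ n * invFact n)
    go zero    zero le ()
    go (suc f) n le pos = cases (n ℕ./ p) n≡
      where
      n₀ = n % p
      n≡ : n ≡ n₀ ℕ.+ p ℕ.* (n ℕ./ p)
      n≡ = trans (m≡m%n+[m/n]*n n p) (cong (n₀ ℕ.+_) (ℕP.*-comm (n ℕ./ p) p))
      key : ∀ n₁ → n ≡ n₀ ℕ.+ p ℕ.* n₁ → invFact n * powℚ ⟦ p ⟧ n₁ ≡ invFact n₁ * inv (u n₀ n₁)
      key n₁ e = trans (cong (λ t → invFact t * powℚ ⟦ p ⟧ n₁) e) (invFact-⊹ n₁ (m%n<n n p))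
      cases : ∀ n₁ → n ≡ n₀ ℕ.+ p ℕ.* n₁ → Div 1 (powℚ ⟦ p ⟧ n * invFact n)
      cases zero e = Div-*ʳ (subst (λ t → Div 1 (powℚ ⟦ p ⟧ t)) (ℕP.suc-pred n {{ℕ.>-nonZero pos}}) (Div-p* (Int-powℚ (Int-⟦⟧ p) (ℕ.pred n))))
        (subst Int (trans (sym (key 0 e)) (*-identityʳ (invFact n))) (Int-* (subst Int (sym invFact-0) Int-1) (Int-inv (p∤u 0 (m%n<n n p)))))
      cases n₁@(suc n₁′) e = subst (Div 1) (sym eq) (Div-*ʳ
          (go f n₁ (p*x≤1+n⇒x≤n n₁ (ℕP.≤-trans pn₁≤n le)) (s≤s z≤n)) (Int-* (Int-inv (p∤u n₁ (m%n<n n p))) (Int-powℚ (Int-⟦⟧ p) e′)))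
        where
        open ≡-Reasoning
        pn₁≤n : p ℕ.* n₁ ℕ.≤ n
        pn₁≤n = subst (p ℕ.* n₁ ℕ.≤_) (sym e) (ℕP.m≤n+m (p ℕ.* n₁) n₀)
        -- From p ≥ 2: one copy of p^(n₁) cancels the power of p split off from n!, the other goes
        -- with n₁! into the induction hypothesis.
        2n₁≤n : n₁ ℕ.+ n₁ ℕ.≤ n
        2n₁≤n = ℕP.≤-trans (subst (ℕ._≤ p ℕ.* n₁) (cong (n₁ ℕ.+_) (ℕP.+-identityʳ n₁)) (ℕP.*-monoˡ-≤ n₁ p>1)) pn₁≤n
        e′ = n ∸ (n₁ ℕ.+ n₁)
        Q = powℚ ⟦ p ⟧ n₁
        I = inv (u n₀ n₁)
        alg : ∀ q e x → q * q * e * x ≡ q * e * (x * q)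
        alg = solve-∀ ℚ-ring
        alg₂ : ∀ q e f i → q * e * (f * i) ≡ q * f * (i * e)
        alg₂ = solve-∀ ℚ-ring
        eq : powℚ ⟦ p ⟧ n * invFact n ≡ Q * invFact n₁ * (I * powℚ ⟦ p ⟧ e′)
        eq = begin
          powℚ ⟦ p ⟧ n * invFact n
            ≡⟨ cong (_* invFact n) (trans (cong (powℚ ⟦ p ⟧) (sym (ℕP.m+[n∸m]≡n 2n₁≤n))) (trans (powℚ-+ ⟦ p ⟧ (n₁ ℕ.+ n₁) e′) (cong (_* powℚ ⟦ p ⟧ e′) (powℚ-+ ⟦ p ⟧ n₁ n₁)))) ⟩
          Q * Q * powℚ ⟦ p ⟧ e′ * invFact n           ≡⟨ alg Q (powℚ ⟦ p ⟧ e′) (invFact n) ⟩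
          Q * powℚ ⟦ p ⟧ e′ * (invFact n * Q)         ≡⟨ cong (Q * powℚ ⟦ p ⟧ e′ *_) (key n₁ e) ⟩
          Q * powℚ ⟦ p ⟧ e′ * (invFact n₁ * I)        ≡⟨ alg₂ Q (powℚ ⟦ p ⟧ e′) (invFact n₁) I ⟩
          Q * invFact n₁ * (I * powℚ ⟦ p ⟧ e′)        ∎

  ^-p*-at : (w : PowerSeries d) {U : PowerSeries d} → U ≈ₚ const ⟦ p ⟧ ⊛ w → ∀ n m → (U ^ n) m ≡ powℚ ⟦ p ⟧ n * (w ^ n) m
  ^-p*-at w {U} e n m = trans (at (go n) m) (const-⊛-at (powℚ ⟦ p ⟧ n) (w ^ n) m)
    where
    go : ∀ n → U ^ n ≈ₚ const (powℚ ⟦ p ⟧ n) ⊛ w ^ n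
    go zero    = R.sym (R.trans (⊛-cong const-1 ≈ₚ-refl) (R.*-identityˡ oneₚ))
    go (suc n) = R.trans (⊛-cong e (go n)) (R.trans (Id.x*y*[z*w] (const ⟦ p ⟧) w (const (powℚ ⟦ p ⟧ n)) (w ^ n))
      (R.trans (⊛-cong ≈ₚ-refl (R.trans (⊛-cong (⊛-comm w _) ≈ₚ-refl) (⊛-assoc _ w (w ^ n)))) (const-* ⟦ p ⟧ (powℚ ⟦ p ⟧ n) (w ⊛ w ^ n))))

  -- With U = p w, the term of index n is (p^n / n!) w^n, divisible by p for n > 0.
  expₚ-Div : (U : PowerSeries d) → (∀ m → Div 1 (U m)) → ∀ m → expₚ U m ≈[ 1 ] oneₚ m
  expₚ-Div {d} U DU m = subst (_≈[ 1 ] oneₚ m) (sym (expₚ-psum U m)) (go ∣ m ∣ₘ)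
    where
    w : PowerSeries d
    w a = inv p * U a
    U≈ : U ≈ₚ const ⟦ p ⟧ ⊛ w
    U≈ = mk≈ₚ (λ a → sym (trans (const-⊛-at ⟦ p ⟧ w a) (trans (sym (*-assoc ⟦ p ⟧ (inv p) (U a))) (trans (cong (_* U a) p*inv-p) (*-identityˡ (U a))))))
    alg : ∀ s x y → s - x + y ≡ s + y - x
    alg = solve-∀ ℚ-ring
    alg₂ : ∀ f q x → q * f * x ≡ f * (q * x)
    alg₂ = solve-∀ ℚ-ring
    go : ∀ N → psum invFact U N m ≈[ 1 ] oneₚ m
    go zero    = ≈-reflexive (trans (const-⊛-at (invFact 0) oneₚ m) (trans (cong (_* oneₚ m) invFact-0) (*-identityˡ (oneₚ m))))
    go (suc N) = mk≈ (subst (Div 1) (trans (alg (psum invFact U N m) (oneₚ m) _) (cong (_- oneₚ m) (sym (⊞-at (psum invFact U N) _ m))))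
      (Div-+ (≈⇒Div (go N)) (subst (Div 1) (sym eq) (Div-*ʳ (p^n/n!-Div (suc N) (s≤s z≤n)) (IntS-^ {f = w} (λ a → Div₁⇒Int (DU a)) (suc N) m)))))
      where
      eq : (const (invFact (suc N)) ⊛ U ^ suc N) m ≡ powℚ ⟦ p ⟧ (suc N) * invFact (suc N) * (w ^ suc N) m
      eq = trans (const-⊛-at (invFact (suc N)) (U ^ suc N) m) (trans (cong (invFact (suc N) *_) (^-p*-at w U≈ (suc N) m))
             (sym (alg₂ (invFact (suc N)) (powℚ ⟦ p ⟧ (suc N)) ((w ^ suc N) m))))

  -- Induction on the degree N of m, with T the part of E below degree N. At m, E^p is T^p plus p
  -- E(m), while ψ(E) V is ψ(T) V, congruent to ψ(T). As T is integral, T^p ≡ ψ(T) modulo p. So p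
  -- divides p E(m), which means that E(m) is integral.
  E^p-integral : (E V : PowerSeries d) → E 𝟎 ≡ 1ℚ → E ^ p ≈ₚ ψ E ⊛ V → (∀ m → V m ≈[ 1 ] oneₚ m) → IntS E
  E^p-integral {d} E V E0 E^p≈ V≈1 m = go ∣ m ∣ₘ m ℕP.≤-refl
    where
    go : ∀ n m → ∣ m ∣ₘ ℕ.≤ n → Int (E m)
    go n m le with 𝟎-or-+ m
    go n       m le | inj₁ refl = subst Int (sym E0) Int-1
    go zero    m le | inj₂ pos with () ← ℕP.≤-trans pos le
    go (suc n) m le | inj₂ pos = subst Int cancel-p (Div₁⇒Int (subst (Div 1) diff (Div-sub (≈⇒Div rhs) (≈⇒Div (frobenius T IntT m)))))
      where
      N = ∣ m ∣ₘ
      T Rest : PowerSeries d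
      T a with ∣ a ∣ₘ ℕ.<? N
      ... | yes _ = E a
      ... | no _  = 0ℚ
      Rest a = E a - T a
      T-below : ∀ a → ∣ a ∣ₘ ℕ.< N → E a ≡ T a
      T-below a lt with ∣ a ∣ₘ ℕ.<? N
      ... | yes _ = refl
      ... | no ≮  = ⊥-elim (≮ lt)
      T-m : T m ≡ 0ℚ
      T-m with N ℕ.<? N
      ... | yes lt = ⊥-elim (ℕP.<-irrefl refl lt)
      ... | no _   = refl
      IntT : IntS T
      IntT a with ∣ a ∣ₘ ℕ.<? N
      ... | yes lt = go n a (ℕP.≤-pred (ℕP.≤-trans lt le))
      ... | no _   = Int-0
      0<N : ∣ 𝟎 {d} ∣ₘ ℕ.< N
      0<N = subst (ℕ._< N) (sym (∣𝟎∣ d)) pos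
      T0 : T 𝟎 ≡ 1ℚ
      T0 = trans (sym (T-below 𝟎 0<N)) E0
      Rest-below : ∀ a → ∣ a ∣ₘ ℕ.< N → Rest a ≡ 0ℚ
      Rest-below a lt = trans (cong (λ t → E a - t) (sym (T-below a lt))) (+-inverseʳ (E a))
      split : E ≈ₚ T ⊞ Rest
      split = mk≈ₚ (λ a → sym (trans (⊞-at T Rest a) (alg (T a) (E a))))
        where
        alg : ∀ t e → t + (e - t) ≡ e
        alg = solve-∀ ℚ-ring
      power = ^-⊞ T Rest T0 (Rest-below 𝟎 0<N) p
      Q = proj₁ power
      E^p-m : (E ^ p) m ≡ (T ^ p) m + E m * ⟦ p ⟧
      E^p-m = begin
        (E ^ p) m                        ≡⟨ at (R.trans (Powers.^-congˡ p split) (proj₁ (proj₂ power))) m ⟩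
        (T ^ p ⊞ Rest ⊛ Q) m             ≡⟨ ⊞-at (T ^ p) (Rest ⊛ Q) m ⟩
        (T ^ p) m + (Rest ⊛ Q) m         ≡⟨ cong ((T ^ p) m +_) (trans (⊛-at Rest Q m) (conv-last m _ (λ a b e pos′ →
             trans (cong (_* Q b) (Rest-below a (subst (∣ a ∣ₘ ℕ.<_) (trans (sym (∣⊕∣ a b)) (cong ∣_∣ₘ e)) (ℕP.m<m+n ∣ a ∣ₘ pos′)))) (*-zeroˡ (Q b))))) ⟩
        (T ^ p) m + Rest m * Q 𝟎         ≡⟨ cong₂ (λ s t → (T ^ p) m + s * t) (trans (cong (λ t → E m - t) T-m) (+-identityʳ (E m))) (proj₂ (proj₂ power)) ⟩
        (T ^ p) m + E m * ⟦ p ⟧          ∎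
        where open ≡-Reasoning
      -- Up to degree N, ψ(E) involves only coefficients of E of degree below N, so E may be
      -- replaced by T there.
      smaller : ∀ a b → ∣ a ∣ₘ ℕ.≤ N → p ℕ.* ∣ b ∣ₘ ≡ ∣ a ∣ₘ → ∣ b ∣ₘ ℕ.< N
      smaller a b le′ e = lem N pos ∣ b ∣ₘ (ℕP.≤-trans (ℕP.≤-reflexive e) le′)
        where
        lem : ∀ N → 0 ℕ.< N → ∀ x → p ℕ.* x ℕ.≤ N → x ℕ.< N
        lem (suc N) _ x le″ = s≤s (p*x≤1+n⇒x≤n x le″)
      E^p-m′ : (E ^ p) m ≡ (ψ T ⊛ V) m
      E^p-m′ = trans (at E^p≈ m) (⊛-local m V (λ a le′ → ψ-cong a (λ b e → T-below b (smaller a b le′ e))))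
      rhs : (ψ T ⊛ V) m ≈[ 1 ] ψ T m
      rhs = subst₂ (_≈[ 1 ]_) (sym (⊛-at (ψ T) V m)) (trans (sym (⊛-at (ψ T) oneₚ m)) (at (⊛-identityʳ (ψ T)) m))
        (mk≈ (subst (Div 1) convEq (conv-closed (Div 1) Div-+ m (λ a b _ → Div-*ˡ (ψ-closed Int Int-0 IntT a) (≈⇒Div (V≈1 b))))))
        where
        open ≡-Reasoning
        alg : ∀ x v o → x * (v - o) ≡ x * v + - 1ℚ * (x * o)
        alg = solve-∀ ℚ-ring
        alg₂ : ∀ x y → x + - 1ℚ * y ≡ x - y
        alg₂ = solve-∀ ℚ-ring
        convEq : conv m (λ a b → ψ T a * (V b - oneₚ b)) ≡ conv m (λ a b → ψ T a * V b) - conv m (λ a b → ψ T a * oneₚ b)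
        convEq = begin
          conv m (λ a b → ψ T a * (V b - oneₚ b))
            ≡⟨ conv-cong′ m (λ a b → alg (ψ T a) (V b) (oneₚ b)) ⟩
          conv m (λ a b → ψ T a * V b + - 1ℚ * (ψ T a * oneₚ b))
            ≡⟨ trans (conv-+ m _ _) (cong (conv m (λ a b → ψ T a * V b) +_) (conv-*ˡ m (- 1ℚ) _)) ⟩
          conv m (λ a b → ψ T a * V b) + - 1ℚ * conv m (λ a b → ψ T a * oneₚ b)
            ≡⟨ alg₂ (conv m (λ a b → ψ T a * V b)) (conv m (λ a b → ψ T a * oneₚ b)) ⟩
          conv m (λ a b → ψ T a * V b) - conv m (λ a b → ψ T a * oneₚ b) ∎
      diff : (ψ T ⊛ V) m - ψ T m - ((T ^ p) m - ψ T m) ≡ ⟦ p ⟧ * E m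
      diff = trans (cong (λ t → t - ψ T m - ((T ^ p) m - ψ T m)) (trans (sym E^p-m′) E^p-m)) (alg ((T ^ p) m) (E m) ⟦ p ⟧ (ψ T m))
        where
        alg : ∀ t e p s → t + e * p - s - (t - s) ≡ p * e
        alg = solve-∀ ℚ-ring
      cancel-p : inv p * (⟦ p ⟧ * E m) ≡ E m
      cancel-p = trans (sym (*-assoc (inv p) ⟦ p ⟧ (E m))) (trans (cong (_* E m) (trans (*-comm (inv p) ⟦ p ⟧) p*inv-p)) (*-identityˡ (E m)))

  -- E ^ p and ψ E ⊛ exp (p h - ψ h) solve the same differential equation for θ.
  expₚ-integral : (h : PowerSeries d) → h 𝟎 ≡ 0ℚ → (∀ m → Div 1 (⟦ p ⟧ * h m - ψ h m)) → IntS (expₚ h)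
  expₚ-integral {d} h h0 DU = E^p-integral E V (expₚ-𝟎 h)
      (θ-unique (E ^ p) (ψ E ⊛ V) (c ⊛ θ h) g0 left right (trans (^-𝟎 E (expₚ-𝟎 h) p) (sym (trans (⊛-𝟎 (ψ E) V)
         (trans (cong₂ _*_ (trans (ψ-𝟎 E) (expₚ-𝟎 h)) (expₚ-𝟎 U)) (*-identityˡ 1ℚ))))))
      (expₚ-Div U DU)
    where
    U E V c : PowerSeries d
    U m = ⟦ p ⟧ * h m - ψ h m
    E = expₚ h
    V = expₚ U
    c = const ⟦ p ⟧
    U0 : U 𝟎 ≡ 0ℚ
    U0 = trans (cong₂ (λ s t → ⟦ p ⟧ * s - t) h0 (trans (ψ-𝟎 h) h0)) (alg ⟦ p ⟧)
      where
      alg : ∀ x → x * 0ℚ - 0ℚ ≡ 0ℚ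
      alg = solve-∀ ℚ-ring
    g0 : (c ⊛ θ h) 𝟎 ≡ 0ℚ
    g0 = trans (const-⊛-at ⟦ p ⟧ (θ h) 𝟎) (trans (cong (λ t → ⟦ p ⟧ * (⟦ ∣ 𝟎 {d} ∣ₘ ⟧ * t)) h0) (alg ⟦ p ⟧ ⟦ ∣ 𝟎 {d} ∣ₘ ⟧))
      where
      alg : ∀ x y → x * (y * 0ℚ) ≡ 0ℚ
      alg = solve-∀ ℚ-ring
    left′ : ∀ n → suc n ≡ p → θ (E ^ suc n) ≈ₚ E ^ suc n ⊛ (c ⊛ θ h)
    left′ n e = R.trans (θ-^-suc E n) (R.trans (⊛-cong (const-cong (cong ⟦_⟧ e)) (⊛-cong ≈ₚ-refl (θ-expₚ h h0)))
      (Id.x*[y*[z*w]] c (E ^ n) E (θ h)))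
    left : θ (E ^ p) ≈ₚ E ^ p ⊛ (c ⊛ θ h)
    left = subst (λ n → θ (E ^ n) ≈ₚ E ^ n ⊛ (c ⊛ θ h)) (ℕP.suc-pred p) (left′ (ℕ.pred p) (ℕP.suc-pred p))
    θU : θ U ⊞ c ⊛ ψ (θ h) ≈ₚ c ⊛ θ h
    θU = mk≈ₚ (λ m → trans (⊞-at (θ U) (c ⊛ ψ (θ h)) m) (trans (cong (θ U m +_) (sym (at (θ-ψ h) m)))
      (trans (alg ⟦ ∣ m ∣ₘ ⟧ ⟦ p ⟧ (h m) (ψ h m)) (sym (const-⊛-at ⟦ p ⟧ (θ h) m)))))
      where
      alg : ∀ n p h s → n * (p * h - s) + n * s ≡ p * (n * h)
      alg = solve-∀ ℚ-ring
    right : θ (ψ E ⊛ V) ≈ₚ (ψ E ⊛ V) ⊛ (c ⊛ θ h)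
    right = begin
      θ (ψ E ⊛ V)                                             ≈⟨ θ-⊛ (ψ E) V ⟩
      θ (ψ E) ⊛ V ⊞ ψ E ⊛ θ V                                 ≈⟨ R.+-cong (⊛-cong (R.trans (θ-ψ E) (⊛-cong ≈ₚ-refl (R.trans (ψ-≈ₚ (θ-expₚ h h0)) (ψ-⊛ E (θ h))))) ≈ₚ-refl) (⊛-cong ≈ₚ-refl (θ-expₚ U U0)) ⟩
      (c ⊛ (ψ E ⊛ ψ (θ h))) ⊛ V ⊞ ψ E ⊛ (V ⊛ θ U)             ≈⟨ Id.leibniz c (ψ E) (ψ (θ h)) V (θ U) ⟩
      (ψ E ⊛ V) ⊛ (θ U ⊞ c ⊛ ψ (θ h))                         ≈⟨ ⊛-cong ≈ₚ-refl θU ⟩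
      (ψ E ⊛ V) ⊛ (c ⊛ θ h)                                   ∎
      where open ≈ₚ-Reasoning

  IntS-invₚ : (f : PowerSeries d) → IntS f → IntS (invₚ f)
  IntS-invₚ f If m = subst Int (sym (invₚ-psum f m)) (go ∣ m ∣ₘ)
    where
    g = oneₚ -ₚ f
    Ig : IntS g
    Ig a = Int-sub (IntS-one a) (If a)
    term-int : ∀ n → Int ((const 1ℚ ⊛ g ^ n) m)
    term-int n = subst Int (sym (trans (const-⊛-at 1ℚ (g ^ n) m) (*-identityˡ _))) (IntS-^ Ig n m)
    go : ∀ n → Int (psum (λ _ → 1ℚ) g n m)
    go zero    = term-int 0
    go (suc n) = subst Int (sym (⊞-at (psum (λ _ → 1ℚ) g n) (const 1ℚ ⊛ g ^ suc n) m)) (Int-+ (go n) (term-int (suc n)))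

  module _ {B H : PowerSeries d} (W : DworkPair B H) (B0 : B 𝟎 ≡ 1ℚ) (H0 : H 𝟎 ≡ 0ℚ) where
    open DworkPair W

    -- Multiplied by B ψ(B), the series p h - ψ(h) with h = BH / B becomes p BH ψ(B) - B ψ(BH),
    -- which `Dwork-congruence` controls. The multiplier can be removed because 1/B is p-integral.
    quotient-congruence : ∀ m → Div 1 (⟦ p ⟧ * (BH W ⊛ invₚ B) m - ψ (BH W ⊛ invₚ B) m)
    quotient-congruence m = subst (Div 1) (sym (at U≈ m)) (subst (Div 1) (sym (⊛-at (U ⊛ (B ⊛ ψ B)) (I ⊛ ψ I) m))
        (conv-closed (Div 1) Div-+ m (λ a b _ → Div-*ʳ (UBψB a) (IntS-⊛ II (ψ-closed Int Int-0 II) b))))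
      where
      h I U c : PowerSeries d
      I = invₚ B
      h = BH W ⊛ I
      c = const ⟦ p ⟧
      U a = ⟦ p ⟧ * h a - ψ h a
      II : IntS I
      II = IntS-invₚ B B-int
      BI : B ⊛ I ≈ₚ oneₚ
      BI = ⊛-invₚ B B0
      hB : h ⊛ B ≈ₚ BH W
      hB = R.trans (⊛-assoc (BH W) I B) (R.trans (⊛-cong ≈ₚ-refl (R.trans (⊛-comm I B) BI)) (⊛-identityʳ (BH W)))
      U⊞ψh : U ⊞ ψ h ≈ₚ c ⊛ h
      U⊞ψh = mk≈ₚ (λ a → trans (⊞-at U (ψ h) a) (trans (alg (⟦ p ⟧ * h a) (ψ h a)) (sym (const-⊛-at ⟦ p ⟧ h a))))
        where
        alg : ∀ x y → x - y + y ≡ x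
        alg = solve-∀ ℚ-ring
      identity : U ⊛ (B ⊛ ψ B) ⊞ B ⊛ ψ (BH W) ≈ₚ c ⊛ (BH W ⊛ ψ B)
      identity = begin
        U ⊛ (B ⊛ ψ B) ⊞ B ⊛ ψ (BH W)              ≈⟨ R.+-congˡ (⊛-cong ≈ₚ-refl (R.trans (R.sym (ψ-⊛ h B)) (ψ-≈ₚ hB))) ⟨
        U ⊛ (B ⊛ ψ B) ⊞ B ⊛ (ψ h ⊛ ψ B)           ≈⟨ R.+-congˡ (Id.x*[y*z] (ψ h) B (ψ B)) ⟨
        U ⊛ (B ⊛ ψ B) ⊞ ψ h ⊛ (B ⊛ ψ B)           ≈⟨ R.distribʳ (B ⊛ ψ B) U (ψ h) ⟨
        (U ⊞ ψ h) ⊛ (B ⊛ ψ B)                     ≈⟨ ⊛-cong U⊞ψh ≈ₚ-refl ⟩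
        (c ⊛ h) ⊛ (B ⊛ ψ B)                       ≈⟨ Id.x*y*[z*w] c h B (ψ B) ⟩
        c ⊛ ((h ⊛ B) ⊛ ψ B)                       ≈⟨ ⊛-cong ≈ₚ-refl (⊛-cong hB ≈ₚ-refl) ⟩
        c ⊛ (BH W ⊛ ψ B)                          ∎
        where open ≈ₚ-Reasoning
      UBψB : ∀ a → Div 1 ((U ⊛ (B ⊛ ψ B)) a)
      UBψB a = subst (Div 1) (trans (cong (λ t → - ((B ⊛ ψ (BH W)) a - t)) (sym (trans (trans (sym (⊞-at (U ⊛ (B ⊛ ψ B)) (B ⊛ ψ (BH W)) a)) (at identity a)) (const-⊛-at ⟦ p ⟧ (BH W ⊛ ψ B) a))))
          (alg ((U ⊛ (B ⊛ ψ B)) a) ((B ⊛ ψ (BH W)) a))) (Div-neg (Dwork-congruence W a))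
        where
        alg : ∀ x y → - (y - (x + y)) ≡ x
        alg = solve-∀ ℚ-ring
      U≈ : U ≈ₚ (U ⊛ (B ⊛ ψ B)) ⊛ (I ⊛ ψ I)
      U≈ = R.sym (R.trans (Id.cancel U B (ψ B) I (ψ I)) (R.trans (⊛-cong ≈ₚ-refl (R.trans (⊛-cong BI (R.trans (R.sym (ψ-⊛ B I)) (R.trans (ψ-≈ₚ BI) ψ-one))) (R.*-identityˡ oneₚ))) (⊛-identityʳ U)))

    exp-quotient-integral : IntS (expₚ (BH W *ₚ invₚ B))
    exp-quotient-integral = subst (λ h → IntS (expₚ h)) (⊛-def (BH W) (invₚ B))
      (expₚ-integral (BH W ⊛ invₚ B) (trans (⊛-𝟎 (BH W) (invₚ B)) (trans (cong (λ t → t * B 𝟎 * invₚ B 𝟎) H0) (alg (B 𝟎) (invₚ B 𝟎)))) quotient-congruence)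
      where
      alg : ∀ x y → 0ℚ * x * y ≡ 0ℚ
      alg = solve-∀ ℚ-ring

-- From integrality at every prime to integrality.

prime-divisor : ∀ n → 1 ℕ.< n → ∃ λ p → Prime p × p ∣ n
prime-divisor n@(suc _) 1<n with factorise n
... | record { factors = [] ; isFactorisation = e } = ⊥-elim (ℕP.<-irrefl (sym e) 1<n)
... | record { factors = p ∷ ps ; isFactorisation = e ; factorsPrime = pr ListAll.∷ _ } = p , pr , subst (p ∣_) (sym e) (ℕD.m∣m*n _)

cross-multiply : ∀ {x n e b k} → x * ⟦ e ⟧ ≡ ι n → x * ⟦ b ⟧ ≡ ι k → n ℤ.* ℤ.+ b ≡ k ℤ.* ℤ.+ e
cross-multiply {x} {n} {e} {b} {k} xe≡n xb≡k = ι-injective (begin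
  ι (n ℤ.* ℤ.+ b)      ≡⟨ ι-* n (ℤ.+ b) ⟩
  ι n * ⟦ b ⟧          ≡⟨ cong (_* ⟦ b ⟧) xe≡n ⟨
  x * ⟦ e ⟧ * ⟦ b ⟧    ≡⟨ alg x ⟦ e ⟧ ⟦ b ⟧ ⟩
  x * ⟦ b ⟧ * ⟦ e ⟧    ≡⟨ cong (_* ⟦ e ⟧) xb≡k ⟩
  ι k * ⟦ e ⟧          ≡⟨ ι-* k (ℤ.+ e) ⟨
  ι (k ℤ.* ℤ.+ e)      ∎)
  where
  open ≡-Reasoning
  alg : ∀ x d b → x * d * b ≡ x * b * d
  alg = solve-∀ ℚ-ring

-- Writing x = n / e = k / b with b prime to p gives n b = k e, and Euclid's lemma applies to n b.
numerator-divisible : ∀ {p} (pr : Prime p) {x n e} → x * ⟦ e ⟧ ≡ ι n → Local.Int p pr x → p ∣ e → p ∣ ℤ.∣ n ∣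
numerator-divisible {p} pr {x} {n} {e} xe≡n (Local.mkInt b k p∤b xb≡k) p∣e =
  [ (λ p∣n → p∣n) , (λ p∣b → ⊥-elim (p∤b p∣b)) ]′ (euclidsLemma ℤ.∣ n ∣ b pr p∣nb)
  where
  p∣nb : p ∣ ℤ.∣ n ∣ ℕ.* b
  p∣nb = subst (p ∣_)
    (trans (sym (ℤP.abs-* k (ℤ.+ e))) (trans (cong ℤ.∣_∣ (sym (cross-multiply {x} xe≡n xb≡k))) (ℤP.abs-* n (ℤ.+ b))))
    (ℕD.∣n⇒∣m*n ℤ.∣ k ∣ p∣e)

coprime-↥-↧ : ∀ x → Coprime ℤ.∣ ℚ.↥ x ∣ (ℚ.↧ₙ x)
coprime-↥-↧ (mkℚ n d-1 c) = Coprime.recompute c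

locally-integral⇒integral : ∀ x → (∀ p (pr : Prime p) → Local.Int p pr x) → Σ ℤ (λ c → x ≡ c / 1)
locally-integral⇒integral x int with ℚ.↧ₙ x ℕ.≟ 1
... | yes ↧x≡1 = ℚ.↥ x , trans (sym (*-identityʳ x)) (trans (cong (x *_) (sym (trans (cong ⟦_⟧ ↧x≡1) ι-1))) (trans (↥-↧ x) (ι-def (ℚ.↥ x))))
... | no ↧x≢1 with prime-divisor (ℚ.↧ₙ x) (ℕP.≤∧≢⇒< (s≤s z≤n) (λ e → ↧x≢1 (sym e)))
-- Such a p would divide numerator and denominator of a reduced fraction, hence be 1.
...   | p , pr , p∣↧x = ⊥-elim (¬prime[1] (subst Prime (coprime-↥-↧ x (numerator-divisible pr (↥-↧ x) (int p pr) p∣↧x , p∣↧x)) pr))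

theorem2 : (d k : ℕ) → 0 < d → (k>0 : 0 < k)
    → (L : Vec ℕ d) (N : Fin k → Vec ℕ d)
    → Pointwise _≤_ L (N (fromℕ< k>0))
    → IntegralSeries (q L N)
theorem2 d k _ k>0 L N L≤N m = locally-integral⇒integral (q L N m) (λ p pr →
  -- For this pair `BH` is definitionally `G L N`, and `coeffA N` is `F N`.
  DieudonnéDwork.exp-quotient-integral p pr (Coefficients.coeffA-DworkPair p pr k>0 L N L≤N)
    (Coefficients.coeffA-𝟎 p pr N) (cong harmonic (dot-𝟎 L)) m)
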